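{- Let $k=k(n)$, and for each $n$ fix an edge-coloring of the complete bipartite graph $K_{n,n}$ (not necessarily proper) in which no color appears on more than $n/k$ edges. Let $\mathcal{M}$ be the set of (unordered) pairs of non-incident edges of $K_{n,n}$ that have the same color, and let $\mu=\frac{|\mathcal{M}|}{n(n-1)}$. Let $M$ be a uniformly random perfect matching of $K_{n,n}$ and let $X_M$ be the indicator variable of the event that $M$ is rainbow. (1) If $k\ge 12$, then there exist constants $c_1<1<c_2$ depending only on $k$ such that $$e^{ -c_2\mu}\le \Pr(X_M=1)\le e^{ -c_1\mu}.$$ (2) In particular, if $k=\omega(1)$ (as $n\to\infty$), then $$\Pr(X_M=1)=e^{ -(1+o(1))\mu}.$$ (3) Moreover, if $k=\omega(n^{1/2})$, then $$\Pr(X_M=1)=e^{ -\mu}(1+o(1)).$$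
   Context: A perfect matching of an edge-colored $K_{n,n}$ is rainbow if no two of its edges have the same color. Two edges are non-incident (independent) if they share no end vertex. Edge-colorings need not be proper. Asymptotic notation $o(1)$, $\omega(\cdot)$ refers to $n\to\infty$. -}

module Defs where

open import Data.Fin.Base using (Fin)
import Data.Fin.Properties as Fin
open import Data.Integer.Base using (+_; +≤+; +[1+_]; -[1+_]; ∣_∣)
import Data.Integer.Base as ℤ
import Data.Integer.Properties as ℤ
open import Data.List.Base using (List; []; _∷_; _++_; map; filter; length; allFin; cartesianProduct)
open import Data.List.Membership.Propositional using (_∈_)
import Data.List.Membership.DecPropositional as DecMembership
open import Data.List.Relation.Unary.AllPairs using (AllPairs; allPairs?)
open import Data.Nat.Base as ℕ using (ℕ; zero; suc; z≤n; s≤s)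
import Data.Nat.Properties as ℕ
open import Data.Product.Base using (_×_; _,_; ∃-syntax; proj₁; proj₂)
open import Data.Rational.Base using (ℚ; mkℚ; 0ℚ; 1ℚ; ½; _+_; _*_; _-_; -_; _/_; _≤_; _<_; *<*; fromℚᵘ; toℚᵘ; nonNegative; positive)
  renaming (∣_∣ to ∣_∣ℚ)
open import Data.Rational.Properties
open import Data.Rational.Solver using (module +-*-Solver)
open import Data.Rational.Unnormalised.Base using (mkℚᵘ; *≡*; *≤*)
import Data.Rational.Unnormalised.Base as ℚᵘ
import Data.Rational.Unnormalised.Properties as ℚᵘ
open import Data.Sum.Base using (inj₁; inj₂)
open import Relation.Binary.PropositionalEquality
open import Relation.Nullary using (Dec; yes; no; ¬?; _×-dec_; map′)
open import Relation.Unary using (Decidable)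

fromℕ : ℕ → ℚ
fromℕ n = + n / 1

1/suc : ℕ → ℚ
1/suc n = + 1 / suc n

/-mono-≤ : ∀ a b m p → a ℕ.* suc p ℕ.≤ b ℕ.* suc m → + a / suc m ≤ + b / suc p
/-mono-≤ a b m p h = toℚᵘ-cancel-≤
  (ℚᵘ.≤-respˡ-≃ (ℚᵘ.≃-sym (toℚᵘ-fromℚᵘ (mkℚᵘ (+ a) m)))
    (ℚᵘ.≤-respʳ-≃ (ℚᵘ.≃-sym (toℚᵘ-fromℚᵘ (mkℚᵘ (+ b) p)))
      (*≤* (subst₂ ℤ._≤_ (ℤ.pos-* a (suc p)) (ℤ.pos-* b (suc m)) (+≤+ h)))))

/-suc : ∀ a p → + suc a / suc p ≡ 1/suc p + (+ a / suc p)
/-suc a p = toℚᵘ-injective (ℚᵘ.≃-trans (toℚᵘ-fromℚᵘ (mkℚᵘ (+ suc a) p))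
  (ℚᵘ.≃-sym (ℚᵘ.≃-trans (toℚᵘ-homo-+ (1/suc p) (+ a / suc p))
    (ℚᵘ.≃-trans (ℚᵘ.+-cong (toℚᵘ-fromℚᵘ (mkℚᵘ (+ 1) p)) (toℚᵘ-fromℚᵘ (mkℚᵘ (+ a) p)))
      (*≡* (eq (+ suc p)))))))
  where
  eq : ∀ d → (+ 1 ℤ.* d ℤ.+ + a ℤ.* d) ℤ.* d ≡ + suc a ℤ.* (d ℤ.* d)
  eq d = trans (cong (ℤ._* d) (sym (ℤ.*-distribʳ-+ d (+ 1) (+ a)))) (ℤ.*-assoc (+ suc a) d d)

suc*1/suc : ∀ b → fromℕ (suc b) * 1/suc b ≡ 1ℚ
suc*1/suc b = toℚᵘ-injective (ℚᵘ.≃-trans (toℚᵘ-homo-* (fromℕ (suc b)) (1/suc b))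
  (ℚᵘ.≃-trans (ℚᵘ.*-cong (toℚᵘ-fromℚᵘ (mkℚᵘ (+ suc b) 0)) (toℚᵘ-fromℚᵘ (mkℚᵘ (+ 1) b)))
    (*≡* (trans (ℤ.*-identityʳ _) (trans (ℤ.*-identityʳ (+ suc b))
      (sym (trans (ℤ.*-identityˡ _) (cong +_ (ℕ.*-identityˡ (suc b))))))))))

0<1/suc : ∀ n → 0ℚ < 1/suc n
0<1/suc n = positive⁻¹ (1/suc n) {{normalize-pos 1 (suc n)}}

1/suc-anti : ∀ {m n} → m ℕ.≤ n → 1/suc n ≤ 1/suc m
1/suc-anti {m} {n} m≤n = /-mono-≤ 1 1 n m (ℕ.*-monoʳ-≤ 1 (s≤s m≤n))

fromℕ-mono : ∀ {m n} → m ℕ.≤ n → fromℕ m ≤ fromℕ n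
fromℕ-mono {m} {n} m≤n = /-mono-≤ m n 0 0 (ℕ.*-monoˡ-≤ 1 m≤n)

0≤fromℕ : ∀ n → 0ℚ ≤ fromℕ n
0≤fromℕ n = fromℕ-mono {0} {n} z≤n

archimedean : ∀ q → ∃[ b ] q ≤ fromℕ b
archimedean q@(mkℚ n d c) = ∣ n ∣ , subst (_≤ fromℕ ∣ n ∣) (fromℚᵘ-toℚᵘ q) (le n)
  where
  le : ∀ n → fromℚᵘ (mkℚᵘ n d) ≤ fromℕ ∣ n ∣
  le (+ k) = /-mono-≤ k k d 0 (ℕ.*-monoʳ-≤ k (s≤s z≤n))
  le -[1+ k ] = ≤-trans (neg-antimono-≤ (nonNegative⁻¹ (+ suc k / suc d) {{normalize-nonNeg (suc k) (suc d)}})) (0≤fromℕ (suc k))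

1/suc-small : ∀ ε → 0ℚ < ε → ∃[ N ] 1/suc N ≤ ε
1/suc-small ε@(mkℚ +[1+ k ] d c) _ = d , subst (1/suc d ≤_) (fromℚᵘ-toℚᵘ ε)
  (/-mono-≤ 1 (suc k) d d (ℕ.*-monoˡ-≤ (suc d) {1} {suc k} (s≤s z≤n)))
1/suc-small (mkℚ (+ 0) d c) (*<* (ℤ.+<+ ()))
1/suc-small (mkℚ -[1+ k ] d c) (*<* ())

*-mono-≤-nonNeg : ∀ {a b c d} → 0ℚ ≤ a → a ≤ b → 0ℚ ≤ c → c ≤ d → a * c ≤ b * d
*-mono-≤-nonNeg {a} {b} {c} {d} 0≤a a≤b 0≤c c≤d =
  ≤-trans (*-monoʳ-≤-nonNeg c {{nonNegative 0≤c}} a≤b)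
          (*-monoˡ-≤-nonNeg b {{nonNegative (≤-trans 0≤a a≤b)}} c≤d)

0≤* : ∀ {a b} → 0ℚ ≤ a → 0ℚ ≤ b → 0ℚ ≤ a * b
0≤* {a} {b} 0≤a 0≤b = nonNegative⁻¹ (a * b) {{nonNeg*nonNeg⇒nonNeg a {{nonNegative 0≤a}} b {{nonNegative 0≤b}}}}

0<* : ∀ {a b} → 0ℚ < a → 0ℚ < b → 0ℚ < a * b
0<* {a} {b} 0<a 0<b = positive⁻¹ (a * b) {{pos*pos⇒pos a {{positive 0<a}} b {{positive 0<b}}}}

0≤+ : ∀ {a b} → 0ℚ ≤ a → 0ℚ ≤ b → 0ℚ ≤ a + b
0≤+ = +-mono-≤

0<½* : ∀ {ε} → 0ℚ < ε → 0ℚ < ½ * ε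
0<½* = 0<* (positive⁻¹ ½)

½*+½* : ∀ ε → ½ * ε + ½ * ε ≡ ε
½*+½* ε = trans (sym (*-distribʳ-+ ε ½ ½)) (*-identityˡ ε)

∣∣-≤ : ∀ {a b} → a ≤ b → - a ≤ b → ∣ a ∣ℚ ≤ b
∣∣-≤ {a} a≤b -a≤b with ∣p∣≡p∨∣p∣≡-p a
... | inj₁ e = subst (_≤ _) (sym e) a≤b
... | inj₂ e = subst (_≤ _) (sym e) -a≤b

∣-∣-sym : ∀ a b → ∣ a - b ∣ℚ ≡ ∣ b - a ∣ℚ
∣-∣-sym a b = trans (cong ∣_∣ℚ (solve 2 (λ a b → a :- b := :- (b :- a)) refl a b)) (∣-p∣≡∣p∣ (b - a))
  where open +-*-Solver

∣-∣-triangle : ∀ a b c → ∣ a - c ∣ℚ ≤ ∣ a - b ∣ℚ + ∣ b - c ∣ℚ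
∣-∣-triangle a b c = subst (λ z → ∣ z ∣ℚ ≤ ∣ a - b ∣ℚ + ∣ b - c ∣ℚ)
  (solve 3 (λ a b c → (a :- b) :+ (b :- c) := a :- c) refl a b c)
  (∣p+q∣≤∣p∣+∣q∣ (a - b) (b - c))
  where open +-*-Solver

∣*-*∣-≤ : ∀ a b c d → ∣ a * b - c * d ∣ℚ ≤ ∣ a ∣ℚ * ∣ b - d ∣ℚ + ∣ d ∣ℚ * ∣ a - c ∣ℚ
∣*-*∣-≤ a b c d = subst₂ _≤_
  (cong ∣_∣ℚ (solve 4 (λ a b c d → a :* (b :- d) :+ d :* (a :- c) := a :* b :- c :* d) refl a b c d))
  (cong₂ _+_ (∣p*q∣≡∣p∣*∣q∣ a (b - d)) (∣p*q∣≡∣p∣*∣q∣ d (a - c)))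
  (∣p+q∣≤∣p∣+∣q∣ (a * (b - d)) (d * (a - c)))
  where open +-*-Solver

shrink : ∀ b {a} {ε} → 0ℚ < ε → 0ℚ ≤ a → a ≤ fromℕ b → a * (ε * 1/suc b) ≤ ε
shrink b {a} {ε} 0<ε 0≤a a≤b = ≤-trans
  (*-mono-≤-nonNeg 0≤a (≤-trans a≤b (fromℕ-mono (ℕ.n≤1+n b))) (<⇒≤ (0<* 0<ε (0<1/suc b))) ≤-refl)
  (≤-reflexive (trans
    (solve 3 (λ s e i → s :* (e :* i) := (s :* i) :* e) refl (fromℕ (suc b)) ε (1/suc b))
    (trans (cong (_* ε) (suc*1/suc b)) (*-identityˡ ε))))
  where open +-*-Solver

Cauchy : (ℕ → ℚ) → Set
Cauchy s = ∀ ε → 0ℚ < ε → ∃[ N ] (∀ m n → N ℕ.≤ m → N ℕ.≤ n → ∣ s m - s n ∣ℚ ≤ ε)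

-- The real numbers, as Cauchy sequences of rationals up to _≈ᵣ_.
record ℝ : Set where
  constructor mkℝ
  field
    seq    : ℕ → ℚ
    cauchy : Cauchy seq

open ℝ public

infix 4 _≈ᵣ_ _≤ᵣ_ _<ᵣ_
infixl 6 _+ᵣ_
infixl 7 _*ᵣ_
infix 8 -ᵣ_

_≈ᵣ_ : ℝ → ℝ → Set
x ≈ᵣ y = ∀ ε → 0ℚ < ε → ∃[ N ] (∀ n → N ℕ.≤ n → ∣ seq x n - seq y n ∣ℚ ≤ ε)

_≤ᵣ_ : ℝ → ℝ → Set
x ≤ᵣ y = ∀ ε → 0ℚ < ε → ∃[ N ] (∀ n → N ℕ.≤ n → seq x n ≤ seq y n + ε)

_<ᵣ_ : ℝ → ℝ → Set
x <ᵣ y = ∃[ ε ] (0ℚ < ε × ∃[ N ] (∀ n → N ℕ.≤ n → seq x n + ε ≤ seq y n))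

fromℚ : ℚ → ℝ
fromℚ q = mkℝ (λ _ → q) λ ε 0<ε → 0 , λ _ _ _ _ →
  subst (λ z → ∣ z ∣ℚ ≤ ε) (sym (+-inverseʳ q)) (<⇒≤ 0<ε)

fromℕᵣ : ℕ → ℝ
fromℕᵣ n = fromℚ (fromℕ n)

0ᵣ 1ᵣ : ℝ
0ᵣ = fromℚ 0ℚ
1ᵣ = fromℚ 1ℚ

_+ᵣ_ : ℝ → ℝ → ℝ
x +ᵣ y = mkℝ (λ n → seq x n + seq y n) λ ε 0<ε →
  let (M , hM) = cauchy x (½ * ε) (0<½* 0<ε)
      (N , hN) = cauchy y (½ * ε) (0<½* 0<ε)
  in M ℕ.⊔ N , λ m n m≥ n≥ →
    let a = seq x m ; b = seq y m ; c = seq x n ; d = seq y n in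
    subst (λ z → ∣ z ∣ℚ ≤ ε)
      (solve 4 (λ a b c d → (a :- c) :+ (b :- d) := (a :+ b) :- (c :+ d)) refl a b c d)
      (≤-trans (∣p+q∣≤∣p∣+∣q∣ (a - c) (b - d))
        (≤-trans (+-mono-≤
            (hM m n (ℕ.m⊔n≤o⇒m≤o M N m≥) (ℕ.m⊔n≤o⇒m≤o M N n≥))
            (hN m n (ℕ.m⊔n≤o⇒n≤o M N m≥) (ℕ.m⊔n≤o⇒n≤o M N n≥)))
          (≤-reflexive (½*+½* ε))))
  where open +-*-Solver

-ᵣ_ : ℝ → ℝ
-ᵣ x = mkℝ (λ n → - seq x n) λ ε 0<ε →
  let (N , h) = cauchy x ε 0<ε
  in N , λ m n m≥ n≥ → subst (_≤ ε)
    (trans (∣-∣-sym (seq x m) (seq x n))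
      (cong ∣_∣ℚ (solve 2 (λ a b → b :- a := :- a :- :- b) refl (seq x m) (seq x n))))
    (h m n m≥ n≥)
  where open +-*-Solver

bounded : ∀ x → ∃[ b ] ∃[ N ] (∀ n → N ℕ.≤ n → ∣ seq x n ∣ℚ ≤ fromℕ b)
bounded x =
  let (N , h) = cauchy x 1ℚ (positive⁻¹ 1ℚ)
      (b , hb) = archimedean (1ℚ + ∣ seq x N ∣ℚ)
  in b , N , λ n n≥ → ≤-trans
    (subst (λ z → ∣ z ∣ℚ ≤ 1ℚ + ∣ seq x N ∣ℚ)
      (solve 2 (λ a c → (a :- c) :+ c := a) refl (seq x n) (seq x N))
      (≤-trans (∣p+q∣≤∣p∣+∣q∣ (seq x n - seq x N) (seq x N))
        (+-monoˡ-≤ ∣ seq x N ∣ℚ (h n N n≥ ℕ.≤-refl)))) hb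
  where open +-*-Solver

_*ᵣ_ : ℝ → ℝ → ℝ
x *ᵣ y = mkℝ (λ n → seq x n * seq y n) λ ε 0<ε →
  let (b , B , hB) = bounded x
      (c , C , hC) = bounded y
      0<½ε = 0<½* 0<ε
      (M , hM) = cauchy y (½ * ε * 1/suc b) (0<* 0<½ε (0<1/suc b))
      (N , hN) = cauchy x (½ * ε * 1/suc c) (0<* 0<½ε (0<1/suc c))
      K = (B ℕ.⊔ C) ℕ.⊔ (M ℕ.⊔ N)
      K≥B = ℕ.≤-trans (ℕ.m≤m⊔n B C) (ℕ.m≤m⊔n (B ℕ.⊔ C) (M ℕ.⊔ N))
      K≥C = ℕ.≤-trans (ℕ.m≤n⊔m B C) (ℕ.m≤m⊔n (B ℕ.⊔ C) (M ℕ.⊔ N))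
      K≥M = ℕ.≤-trans (ℕ.m≤m⊔n M N) (ℕ.m≤n⊔m (B ℕ.⊔ C) (M ℕ.⊔ N))
      K≥N = ℕ.≤-trans (ℕ.m≤n⊔m M N) (ℕ.m≤n⊔m (B ℕ.⊔ C) (M ℕ.⊔ N))
  in K , λ m n m≥ n≥ →
    ≤-trans (∣*-*∣-≤ (seq x m) (seq y m) (seq x n) (seq y n))
      (≤-trans (+-mono-≤
          (≤-trans (*-monoˡ-≤-nonNeg ∣ seq x m ∣ℚ {{nonNegative (0≤∣p∣ (seq x m))}}
              (hM m n (ℕ.≤-trans K≥M m≥) (ℕ.≤-trans K≥M n≥)))
            (shrink b 0<½ε (0≤∣p∣ (seq x m)) (hB m (ℕ.≤-trans K≥B m≥))))
          (≤-trans (*-monoˡ-≤-nonNeg ∣ seq y n ∣ℚ {{nonNegative (0≤∣p∣ (seq y n))}}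
              (hN m n (ℕ.≤-trans K≥N m≥) (ℕ.≤-trans K≥N n≥)))
            (shrink c 0<½ε (0≤∣p∣ (seq y n)) (hC n (ℕ.≤-trans K≥C n≥)))))
        (≤-reflexive (½*+½* ε)))

-- expTerm i q = qⁱ / i!
expTerm : ℕ → ℚ → ℚ
expTerm zero    q = 1ℚ
expTerm (suc i) q = expTerm i q * q * 1/suc i

expSum : ℕ → ℚ → ℚ
expSum zero    q = 0ℚ
expSum (suc n) q = expSum n q + expTerm n q

module _ {b : ℚ} (0≤b : 0ℚ ≤ b) where

  0≤1/suc : ∀ n → 0ℚ ≤ 1/suc n
  0≤1/suc n = <⇒≤ (0<1/suc n)

  0≤expTerm : ∀ i → 0ℚ ≤ expTerm i b
  0≤expTerm zero    = <⇒≤ (positive⁻¹ 1ℚ)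
  0≤expTerm (suc i) = 0≤* (0≤* (0≤expTerm i) 0≤b) (0≤1/suc i)

  ∣expTerm∣≤ : ∀ i {q} → ∣ q ∣ℚ ≤ b → ∣ expTerm i q ∣ℚ ≤ expTerm i b
  ∣expTerm∣≤ zero    q≤ = ≤-refl
  ∣expTerm∣≤ (suc i) {q} q≤ = subst (_≤ expTerm (suc i) b)
    (sym (trans (∣p*q∣≡∣p∣*∣q∣ (expTerm i q * q) (1/suc i))
      (cong₂ _*_ (∣p*q∣≡∣p∣*∣q∣ (expTerm i q) q) (0≤p⇒∣p∣≡p (0≤1/suc i)))))
    (*-mono-≤-nonNeg (0≤* (0≤∣p∣ (expTerm i q)) (0≤∣p∣ q))
      (*-mono-≤-nonNeg (0≤∣p∣ (expTerm i q)) (∣expTerm∣≤ i q≤) (0≤∣p∣ q) q≤)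
      (0≤1/suc i) ≤-refl)

  expSum-tail : ∀ N d {q} → ∣ q ∣ℚ ≤ b →
    ∣ expSum (d ℕ.+ N) q - expSum N q ∣ℚ ≤ expSum (d ℕ.+ N) b - expSum N b
  expSum-tail N zero {q} q≤ = ≤-reflexive
    (trans (cong ∣_∣ℚ (+-inverseʳ (expSum N q))) (sym (+-inverseʳ (expSum N b))))
  expSum-tail N (suc d) {q} q≤ = subst₂ _≤_
    (cong ∣_∣ℚ (rearrange (expSum (d ℕ.+ N) q) (expTerm (d ℕ.+ N) q) (expSum N q)))
    (rearrange (expSum (d ℕ.+ N) b) (expTerm (d ℕ.+ N) b) (expSum N b))
    (≤-trans (∣p+q∣≤∣p∣+∣q∣ (expSum (d ℕ.+ N) q - expSum N q) (expTerm (d ℕ.+ N) q))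
      (+-mono-≤ (expSum-tail N d q≤) (∣expTerm∣≤ (d ℕ.+ N) q≤)))
    where
    open +-*-Solver
    rearrange : ∀ s t u → (s - u) + t ≡ (s + t) - u
    rearrange = solve 3 (λ s t u → (s :- u) :+ t := (s :+ t) :- u) refl

  Lipschitz : (ℚ → ℚ) → Set
  Lipschitz f = ∃[ L ] (0ℚ ≤ L × (∀ p q → ∣ p ∣ℚ ≤ b → ∣ q ∣ℚ ≤ b → ∣ f p - f q ∣ℚ ≤ L * ∣ p - q ∣ℚ))

  expTerm-lipschitz : ∀ i → Lipschitz (expTerm i)
  expTerm-lipschitz zero = 0ℚ , ≤-refl , λ p q _ _ → ≤-reflexive (sym (*-zeroˡ ∣ p - q ∣ℚ))
  expTerm-lipschitz (suc i) =
    let (L , 0≤L , h) = expTerm-lipschitz i ; t = expTerm i b ; c = 1/suc i in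
    (t + b * L) * c ,
    0≤* (0≤+ (0≤expTerm i) (0≤* 0≤b 0≤L)) (0≤1/suc i) ,
    λ p q p≤ q≤ →
      let P = expTerm i p ; Q = expTerm i q ; D = ∣ p - q ∣ℚ in
      subst₂ _≤_
        (trans (cong (∣ P * p - Q * q ∣ℚ *_) (sym (0≤p⇒∣p∣≡p (0≤1/suc i))))
          (trans (sym (∣p*q∣≡∣p∣*∣q∣ (P * p - Q * q) c))
            (cong ∣_∣ℚ (solve 3 (λ x y c → (x :- y) :* c := x :* c :- y :* c) refl (P * p) (Q * q) c))))
        (solve 5 (λ t b L c D → (t :* D :+ b :* (L :* D)) :* c := (t :+ b :* L) :* c :* D) refl t b L c D)
        (*-monoʳ-≤-nonNeg c {{nonNegative (0≤1/suc i)}}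
          (≤-trans (∣*-*∣-≤ P p Q q)
            (+-mono-≤
              (*-mono-≤-nonNeg (0≤∣p∣ P) (∣expTerm∣≤ i p≤) (0≤∣p∣ (p - q)) ≤-refl)
              (*-mono-≤-nonNeg (0≤∣p∣ q) q≤ (0≤∣p∣ (P - Q)) (h p q p≤ q≤)))))
    where open +-*-Solver

  expSum-lipschitz : ∀ n → Lipschitz (expSum n)
  expSum-lipschitz zero = 0ℚ , ≤-refl , λ p q _ _ → ≤-reflexive (sym (*-zeroˡ ∣ p - q ∣ℚ))
  expSum-lipschitz (suc n) =
    let (L , 0≤L , h) = expSum-lipschitz n
        (K , 0≤K , k) = expTerm-lipschitz n
    in L + K , 0≤+ 0≤L 0≤K , λ p q p≤ q≤ →
      subst₂ _≤_
        (cong ∣_∣ℚ (solve 4 (λ a b c d → (a :- c) :+ (b :- d) := (a :+ b) :- (c :+ d)) refl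
          (expSum n p) (expTerm n p) (expSum n q) (expTerm n q)))
        (sym (*-distribʳ-+ ∣ p - q ∣ℚ L K))
        (≤-trans (∣p+q∣≤∣p∣+∣q∣ (expSum n p - expSum n q) (expTerm n p - expTerm n q))
          (+-mono-≤ (h p q p≤ q≤) (k p q p≤ q≤)))
    where open +-*-Solver

  halves : ∃[ N ] (∀ i → N ℕ.≤ i → expTerm (suc i) b + expTerm (suc i) b ≤ expTerm i b)
  halves =
    let (N , hN) = archimedean (b + b)
    in N , λ i i≥ →
      let t = expTerm i b in
      ≤-trans
        (≤-reflexive (solve 3 (λ t b c → t :* b :* c :+ t :* b :* c := t :* ((b :+ b) :* c)) refl t b (1/suc i)))
        (≤-trans
          (*-monoˡ-≤-nonNeg t {{nonNegative (0≤expTerm i)}}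
            (≤-trans (*-mono-≤-nonNeg (0≤+ 0≤b 0≤b)
                (≤-trans hN (fromℕ-mono (ℕ.≤-trans i≥ (ℕ.n≤1+n i)))) (0≤1/suc i) ≤-refl)
              (≤-reflexive (suc*1/suc i))))
          (≤-reflexive (*-identityʳ t)))
    where open +-*-Solver

  expTail : ∀ N → (∀ i → N ℕ.≤ i → expTerm (suc i) b + expTerm (suc i) b ≤ expTerm i b) →
    ∀ d → expSum (d ℕ.+ N) b + (expTerm (d ℕ.+ N) b + expTerm (d ℕ.+ N) b)
        ≤ expSum N b + (expTerm N b + expTerm N b)
  expTail N h zero    = ≤-refl
  expTail N h (suc d) = ≤-trans
    (≤-trans (+-monoʳ-≤ (expSum (suc d ℕ.+ N) b) (h (d ℕ.+ N) (ℕ.m≤n+m N d)))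
      (≤-reflexive (+-assoc (expSum (d ℕ.+ N) b) (expTerm (d ℕ.+ N) b) (expTerm (d ℕ.+ N) b))))
    (expTail N h d)

  expTerm-bounded : ∀ N → (∀ i → N ℕ.≤ i → expTerm (suc i) b + expTerm (suc i) b ≤ expTerm i b) →
    ∀ d → expTerm (d ℕ.+ N) b ≤ expTerm N b
  expTerm-bounded N h zero    = ≤-refl
  expTerm-bounded N h (suc d) = ≤-trans
    (≤-trans (≤-trans (≤-reflexive (sym (+-identityʳ (expTerm (suc d ℕ.+ N) b))))
        (+-monoʳ-≤ (expTerm (suc d ℕ.+ N) b) (0≤expTerm (suc d ℕ.+ N))))
      (h (d ℕ.+ N) (ℕ.m≤n+m N d)))
    (expTerm-bounded N h d)

  expSum-small : ∀ ε → 0ℚ < ε → ∃[ N ] (∀ d → expSum (d ℕ.+ N) b - expSum N b ≤ ε)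
  expSum-small ε 0<ε =
    let (M , h) = halves
        K = expTerm M b
        (C , hC) = archimedean (K * b)
        0<½ε = 0<½* 0<ε
        (J , hJ) = 1/suc-small (½ * ε * 1/suc C) (0<* 0<½ε (0<1/suc C))
        i = J ℕ.+ M
        N = suc i
        t≤ : expTerm N b ≤ ½ * ε
        t≤ = ≤-trans
          (*-mono-≤-nonNeg (0≤* (0≤expTerm i) 0≤b)
            (*-monoʳ-≤-nonNeg b {{nonNegative 0≤b}} (expTerm-bounded M h J))
            (0≤1/suc i)
            (≤-trans (1/suc-anti (ℕ.m≤m+n J M)) hJ))
          (shrink C 0<½ε (0≤* (0≤expTerm M) 0≤b) hC)
        h′ = λ j j≥ → h j (ℕ.≤-trans (ℕ.≤-trans (ℕ.m≤n+m M J) (ℕ.n≤1+n i)) j≥)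
    in N , λ d →
      let s = expSum (d ℕ.+ N) b ; t = expTerm (d ℕ.+ N) b ; u = expSum N b ; v = expTerm N b in
      ≤-trans
        (+-monoˡ-≤ (- u)
          (≤-trans (≤-trans (≤-reflexive (sym (+-identityʳ s)))
              (+-monoʳ-≤ s (0≤+ (0≤expTerm (d ℕ.+ N)) (0≤expTerm (d ℕ.+ N)))))
            (expTail N h′ d)))
        (≤-trans (≤-reflexive (solve 2 (λ u v → (u :+ (v :+ v)) :- u := v :+ v) refl u v))
          (≤-trans (+-mono-≤ t≤ t≤) (≤-reflexive (½*+½* ε))))
    where open +-*-Solver

  expSum-tail-small : ∀ ε → 0ℚ < ε →
    ∃[ N ] (∀ n → N ℕ.≤ n → ∀ q → ∣ q ∣ℚ ≤ b → ∣ expSum n q - expSum N q ∣ℚ ≤ ε)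
  expSum-tail-small ε 0<ε =
    let (N , h) = expSum-small ε 0<ε
    in N , λ n n≥ q q≤ → subst (λ k → ∣ expSum k q - expSum N q ∣ℚ ≤ ε) (ℕ.m∸n+n≡m n≥)
      (≤-trans (expSum-tail N (n ℕ.∸ N) q≤) (h (n ℕ.∸ N)))

exp : ℝ → ℝ
exp x = mkℝ (λ n → expSum n (seq x n)) λ ε 0<ε →
  let (b , B , hB) = bounded x
      0≤b = 0≤fromℕ b
      0<½ε = 0<½* 0<ε
      0<¼ε = 0<½* 0<½ε
      (N , hN) = expSum-tail-small 0≤b (½ * (½ * ε)) 0<¼ε
      (L , 0≤L , hL) = expSum-lipschitz 0≤b N
      (l , L≤l) = archimedean L
      (M , hM) = cauchy x (½ * ε * 1/suc l) (0<* 0<½ε (0<1/suc l))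
      K = B ℕ.⊔ (N ℕ.⊔ M)
      K≥B = ℕ.m≤m⊔n B (N ℕ.⊔ M)
      K≥N = ℕ.≤-trans (ℕ.m≤m⊔n N M) (ℕ.m≤n⊔m B (N ℕ.⊔ M))
      K≥M = ℕ.≤-trans (ℕ.m≤n⊔m N M) (ℕ.m≤n⊔m B (N ℕ.⊔ M))
  in K , λ m n m≥ n≥ →
    let p = seq x m ; q = seq x n
        p≤ = hB m (ℕ.≤-trans K≥B m≥)
        q≤ = hB n (ℕ.≤-trans K≥B n≥)
        first : ∣ expSum m p - expSum N p ∣ℚ ≤ ½ * (½ * ε)
        first = hN m (ℕ.≤-trans K≥N m≥) p p≤
        last : ∣ expSum N q - expSum n q ∣ℚ ≤ ½ * (½ * ε)
        last = subst (_≤ ½ * (½ * ε)) (∣-∣-sym (expSum n q) (expSum N q))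
          (hN n (ℕ.≤-trans K≥N n≥) q q≤)
        middle : ∣ expSum N p - expSum N q ∣ℚ ≤ ½ * ε
        middle = ≤-trans (hL p q p≤ q≤)
          (≤-trans (*-monoˡ-≤-nonNeg L {{nonNegative 0≤L}}
              (hM m n (ℕ.≤-trans K≥M m≥) (ℕ.≤-trans K≥M n≥)))
            (shrink l 0<½ε 0≤L L≤l))
    in ≤-trans (∣-∣-triangle (expSum m p) (expSum N p) (expSum n q))
      (≤-trans (+-mono-≤ first
          (≤-trans (∣-∣-triangle (expSum N p) (expSum N q) (expSum n q)) (+-mono-≤ middle last)))
        (≤-reflexive (trans
          (solve 2 (λ h a → h :+ (a :+ h) := a :+ (h :+ h)) refl (½ * (½ * ε)) (½ * ε))
          (trans (cong (λ z → ½ * ε + z) (½*+½* (½ * ε))) (½*+½* ε)))))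
  where open +-*-Solver

⌊√_⌋ : ℕ → ℕ
⌊√ zero ⌋ = 0
⌊√ suc n ⌋ with suc ⌊√ n ⌋ ℕ.* suc ⌊√ n ⌋ ℕ.≤? suc n
... | yes _ = suc ⌊√ n ⌋
... | no  _ = ⌊√ n ⌋

⌊√⌋-lower : ∀ n → ⌊√ n ⌋ ℕ.* ⌊√ n ⌋ ℕ.≤ n
⌊√⌋-lower zero = z≤n
⌊√⌋-lower (suc n) with suc ⌊√ n ⌋ ℕ.* suc ⌊√ n ⌋ ℕ.≤? suc n
... | yes h = h
... | no  _ = ℕ.≤-trans (⌊√⌋-lower n) (ℕ.n≤1+n n)

⌊√⌋-upper : ∀ n → n ℕ.< suc ⌊√ n ⌋ ℕ.* suc ⌊√ n ⌋
⌊√⌋-upper zero = s≤s z≤n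
⌊√⌋-upper (suc n) with suc ⌊√ n ⌋ ℕ.* suc ⌊√ n ⌋ ℕ.≤? suc n
... | yes _ = ℕ.≤-<-trans (⌊√⌋-upper n)
  (ℕ.*-mono-< (ℕ.n<1+n (suc ⌊√ n ⌋)) (ℕ.n<1+n (suc ⌊√ n ⌋)))
... | no  h = ℕ.≰⇒> h

*-square : ∀ a b → (a ℕ.* b) ℕ.* (a ℕ.* b) ≡ (a ℕ.* a) ℕ.* (b ℕ.* b)
*-square a b = ℕ.[m*n]*[o*p]≡[m*o]*[n*p] a b a b

square-cancel-< : ∀ a b → a ℕ.* a ℕ.< b ℕ.* b → a ℕ.< b
square-cancel-< a b h with a ℕ.<? b
... | yes a<b = a<b
... | no  a≮b with () ← ℕ.<⇒≱ h (ℕ.*-mono-≤ (ℕ.≮⇒≥ a≮b) (ℕ.≮⇒≥ a≮b))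

-- ⌊√(n (m+1)²)⌋ / (m+1) is within 1/(m+1) of √n.
√approx : ℕ → ℕ → ℚ
√approx n m = + ⌊√ n ℕ.* (suc m ℕ.* suc m) ⌋ / suc m

√approx-≤ : ∀ n m p → √approx n m ≤ 1/suc p + √approx n p
√approx-≤ n m p = subst (√approx n m ≤_) (/-suc s′ p)
  (/-mono-≤ s (suc s′) m p (ℕ.<⇒≤ (square-cancel-< (s ℕ.* P) (suc s′ ℕ.* M) (begin-strict
    (s ℕ.* P) ℕ.* (s ℕ.* P)              ≡⟨ *-square s P ⟩
    (s ℕ.* s) ℕ.* (P ℕ.* P)              ≤⟨ ℕ.*-monoˡ-≤ (P ℕ.* P) (⌊√⌋-lower (n ℕ.* (M ℕ.* M))) ⟩
    (n ℕ.* (M ℕ.* M)) ℕ.* (P ℕ.* P)      ≡⟨ ℕ.*-assoc n (M ℕ.* M) (P ℕ.* P) ⟩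
    n ℕ.* ((M ℕ.* M) ℕ.* (P ℕ.* P))      ≡⟨ cong (n ℕ.*_) (ℕ.*-comm (M ℕ.* M) (P ℕ.* P)) ⟩
    n ℕ.* ((P ℕ.* P) ℕ.* (M ℕ.* M))      ≡⟨ ℕ.*-assoc n (P ℕ.* P) (M ℕ.* M) ⟨
    (n ℕ.* (P ℕ.* P)) ℕ.* (M ℕ.* M)      <⟨ ℕ.*-monoˡ-< (M ℕ.* M) (⌊√⌋-upper (n ℕ.* (P ℕ.* P))) ⟩
    (suc s′ ℕ.* suc s′) ℕ.* (M ℕ.* M)    ≡⟨ *-square (suc s′) M ⟨
    (suc s′ ℕ.* M) ℕ.* (suc s′ ℕ.* M)    ∎))))
  where
  open ℕ.≤-Reasoning
  M = suc m
  P = suc p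
  s = ⌊√ n ℕ.* (M ℕ.* M) ⌋
  s′ = ⌊√ n ℕ.* (P ℕ.* P) ⌋

√ : ℕ → ℝ
√ n = mkℝ (√approx n) λ ε 0<ε →
  let (N , hN) = 1/suc-small ε 0<ε
      close : ∀ m p → N ℕ.≤ p → √approx n m - √approx n p ≤ ε
      close m p p≥ = ≤-trans
        (+-monoˡ-≤ (- √approx n p) (√approx-≤ n m p))
        (≤-trans (≤-reflexive (solve 2 (λ i a → (i :+ a) :- a := i) refl (1/suc p) (√approx n p)))
          (≤-trans (1/suc-anti p≥) hN))
  in N , λ m p m≥ p≥ → ∣∣-≤ (close m p p≥)
    (subst (_≤ ε)
      (solve 2 (λ a b → b :- a := :- (a :- b)) refl (√approx n m) (√approx n p))
      (close p m m≥))
  where open +-*-Solver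

Eventually : (ℕ → Set) → Set
Eventually P = ∃[ N ] (∀ n → N ℕ.≤ n → P n)

_∈o[1] : (ℕ → ℝ) → Set
f ∈o[1] = ∀ ε → 0ᵣ <ᵣ ε → Eventually λ n → -ᵣ ε ≤ᵣ f n × f n ≤ᵣ ε

-- For g eventually positive.
_∈ω[_] : (ℕ → ℝ) → (ℕ → ℝ) → Set
f ∈ω[ g ] = ∀ C → Eventually λ n → C *ᵣ g n ≤ᵣ f n

-- (u , v) joins vertex u of the left class to vertex v of the right class.
Edge : ℕ → Set
Edge n = Fin n × Fin n

edges : ∀ n → List (Edge n)
edges n = cartesianProduct (allFin n) (allFin n)

Colouring : ℕ → Set
Colouring n = Edge n → ℕ

NonIncident : ∀ {n} → Edge n → Edge n → Set
NonIncident (u , v) (u′ , v′) = u ≢ u′ × v ≢ v′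

nonIncident? : ∀ {n} (e f : Edge n) → Dec (NonIncident e f)
nonIncident? (u , v) (u′ , v′) = ¬? (u Fin.≟ u′) ×-dec ¬? (v Fin.≟ v′)

colourCount : ∀ {n} → Colouring n → ℕ → ℕ
colourCount {n} χ c = length (filter (λ e → χ e ℕ.≟ c) (edges n))

-- No colour appears on more than n/k edges, for k > 0.
Bounded : ∀ {n} → ℝ → Colouring n → Set
Bounded {n} k χ = ∀ c → k *ᵣ fromℕᵣ (colourCount χ c) ≤ᵣ fromℕᵣ n

-- The unordered pairs of entries at distinct positions.
pairs : ∀ {A : Set} → List A → List (A × A)
pairs []       = []
pairs (x ∷ xs) = map (x ,_) xs ++ pairs xs

conflicts : ∀ {n} → Colouring n → List (Edge n × Edge n)
conflicts {n} χ = filter (λ (e , f) → nonIncident? e f ×-dec (χ e ℕ.≟ χ f)) (pairs (edges n))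

-- With the convention a ÷ 0 = 0, which in μ below only concerns n < 2.
_÷ℕ_ : ℕ → ℕ → ℚ
a ÷ℕ zero  = 0ℚ
a ÷ℕ suc b = + a / suc b

μ : ∀ {n} → Colouring n → ℝ
μ {n} χ = fromℚ (length (conflicts χ) ÷ℕ (n ℕ.* (n ℕ.∸ 1)))

-- The subsets of a set listed without repetition by xs, as sublists of xs.
subsets : ∀ {A : Set} → List A → List (List A)
subsets []       = [] ∷ []
subsets (x ∷ xs) = map (x ∷_) (subsets xs) ++ subsets xs

record PerfectMatching {n : ℕ} (M : List (Edge n)) : Set where
  constructor perfectMatching
  field
    independent : AllPairs NonIncident M
    coversLeft  : ∀ u → u ∈ map proj₁ M
    coversRight : ∀ v → v ∈ map proj₂ M

perfectMatching? : ∀ {n} → Decidable (PerfectMatching {n})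
perfectMatching? {n} M =
  map′
    (λ (i , l , r) → perfectMatching i l r)
    (λ (perfectMatching i l r) → i , l , r)
    (allPairs? nonIncident? M
      ×-dec Fin.all? (λ u → u ∈? map proj₁ M)
      ×-dec Fin.all? (λ v → v ∈? map proj₂ M))
  where open DecMembership (Fin._≟_ {n}) using (_∈?_)

perfectMatchings : ∀ n → List (List (Edge n))
perfectMatchings n = filter perfectMatching? (subsets (edges n))

Rainbow : ∀ {n} → Colouring n → List (Edge n) → Set
Rainbow χ = AllPairs (λ e f → χ e ≢ χ f)

rainbow? : ∀ {n} (χ : Colouring n) → Decidable (Rainbow χ)
rainbow? χ = allPairs? (λ e f → ¬? (χ e ℕ.≟ χ f))

Pr[rainbow] : ∀ {n} → Colouring n → ℝ
Pr[rainbow] {n} χ =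
  fromℚ (length (filter (rainbow? χ) (perfectMatchings n)) ÷ℕ length (perfectMatchings n))

{-# OPTIONS --safe #-}
module Submission where

-- The rainbow probability is a product of factors 1 - P(B | the conflicts after B in
-- the list are avoided), one for each conflict B = {e , f}. Relabelling the right class
-- by a transposition moves an edge of a matching anywhere, and it cannot create a
-- conflict that is vertex-disjoint from the moved edge, so conditioning on far conflicts
-- only makes B less likely; this is the lopsided local lemma, which bounds the
-- conditional probability by 3/(n(n-1)) as soon as no colour exceeds n/12 edges. Used as
-- an a priori bound, it shows that the near conflicts cost a factor 1 + O(s/n) only,
-- where s bounds the size of a colour class, and that a switching in the reverse
-- direction spoils only a fraction O(s/n) of the matchings. Hence each factor is
-- 1 - (1 + O(s/n))/(n(n-1)) and the probability is e^{-(1+O(s/n))μ}. In (3), μ ≤ s turns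
-- the error in the exponent into O(s²/n) = o(1). In (1), c₁ = 0 is allowed.

open import Data.Nat.Base using (ℕ)
open import Data.Product.Base using (_×_; ∃-syntax)
open import Defs

import Algebra.Properties.Semiring.Sum
open import Data.Fin.Base using (Fin; zero; suc)
import Data.Fin.Properties as Fin
open import Data.Fin.Permutation using (permutation)
open import Data.Fin.Permutation.Components using (transpose; transpose-inverse)
open import Data.List.Base using (List; []; _∷_; _++_; length; filter; map; lookup; tabulate; allFin; cartesianProductWith)
open import Data.List.Properties using (length-filter)
open import Data.List.Membership.Propositional using (_∈_)
open import Data.List.Membership.Propositional.Properties
open import Data.List.Relation.Binary.Disjoint.Propositional using (Disjoint)
open import Data.List.Relation.Unary.All as All using (All; []; _∷_; all?)
import Data.List.Relation.Unary.All.Properties as All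
open import Data.List.Relation.Unary.AllPairs using (AllPairs; []; _∷_)
import Data.List.Relation.Unary.AllPairs.Properties as AllPairs
open import Data.List.Relation.Unary.Any as Any using (Any; here; there)
open import Data.List.Relation.Unary.Any.Properties using (lookup-index)
open import Data.List.Relation.Unary.Unique.Propositional using (Unique)
import Data.List.Relation.Unary.Unique.Propositional.Properties as Unique
open import Data.Nat.Base as ℕ using (zero; suc; z≤n; s≤s)
import Data.Nat.DivMod as ℕ
import Data.Nat.Properties as ℕ
open import Data.Nat.Tactic.RingSolver using (solve-∀)
open import Data.Product.Base using (_,_; proj₁; proj₂; swap)
open import Data.Product.Properties using (≡-dec)
open import Data.Sum.Base using (_⊎_; inj₁; inj₂; [_,_]′)
open import Data.Unit.Base using (tt)
open import Function.Base using (_∘_; id)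
open import Relation.Binary.PropositionalEquality
open import Relation.Nullary using (Dec; yes; no; ¬_; ¬?; _×-dec_; contradiction)
open import Relation.Nullary.Decidable using (decidable-stable; toSum; toWitness)
open import Relation.Unary using (Decidable)

-- The combinatorial half uses natural numbers only: conditional probabilities are ratios of counts
-- `N P F`, and every estimate is multiplied out. The circularity to be broken is that a conditional
-- probability is easy to bound only if the conflicts already avoided are far from the pair, whereas
-- discarding the near ones requires a bound of the same kind for them. A constant as crude as 3
-- closes this induction; a second pass, in which the crude bound prices the discarded conflicts,
-- then reaches the right constant 1. In the analytic half, (2) asks for a real δ with p =
-- e^(-(1+δ)μ), hence for a logarithm. Since p is a ratio of integers, -log p is a limit of harmonic
-- sums over intervals whose ends have ratio 1/p. Truncations of the exponential series are monotone
-- and multiplicative up to a change of index, but only at nonnegative arguments. Bounds on p are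
-- therefore carried as e^s p ≤ 1 (every truncation) and 1 ≤ e^t p (some truncation), and negative
-- exponents are reached through e^(-x) e^x = 1.

module Counting where

  open import Data.Nat.Base
  open import Data.Nat.DivMod using (m/n*n≤m; m≡m%n+[m/n]*n; m%n<n)
  open import Data.Nat.Properties
  open Algebra.Properties.Semiring.Sum +-*-semiring
    using (sum; sum-cong-≗; ∑-comm; ∑-distrib-+; *-distribˡ-sum; *-distribʳ-sum; sum-permute)

  -- Indicators and finite sums.

  ⟦_⟧ : ∀ {P : Set} → Dec P → ℕ
  ⟦ yes _ ⟧ = 1
  ⟦ no  _ ⟧ = 0

  ⟦⟧-yes : ∀ {P : Set} (p? : Dec P) → P → ⟦ p? ⟧ ≡ 1
  ⟦⟧-yes (yes _) p = refl
  ⟦⟧-yes (no ¬p) p = contradiction p ¬p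

  ⟦⟧-no : ∀ {P : Set} (p? : Dec P) → ¬ P → ⟦ p? ⟧ ≡ 0
  ⟦⟧-no (yes p) ¬p = contradiction p ¬p
  ⟦⟧-no (no _)  ¬p = refl

  ⟦⟧-≤ : ∀ {P : Set} (p? : Dec P) {k : ℕ} → (P → 1 ≤ k) → ⟦ p? ⟧ ≤ k
  ⟦⟧-≤ (yes p) h = h p
  ⟦⟧-≤ (no _)  h = z≤n

  ⟦⟧-mono : ∀ {P Q : Set} (p? : Dec P) (q? : Dec Q) → (P → Q) → ⟦ p? ⟧ ≤ ⟦ q? ⟧
  ⟦⟧-mono p? q? f = ⟦⟧-≤ p? λ p → ≤-reflexive (sym (⟦⟧-yes q? (f p)))

  ⟦⟧-cong : ∀ {P Q : Set} (p? : Dec P) (q? : Dec Q) → (P → Q) → (Q → P) → ⟦ p? ⟧ ≡ ⟦ q? ⟧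
  ⟦⟧-cong p? q? f g = ≤-antisym (⟦⟧-mono p? q? f) (⟦⟧-mono q? p? g)

  ⟦⟧-⊎ : ∀ {P Q R : Set} (p? : Dec P) (q? : Dec Q) (r? : Dec R) →
    (P → Q ⊎ R) → (Q → P) → (R → P) → (Q → ¬ R) → ⟦ p? ⟧ ≡ ⟦ q? ⟧ + ⟦ r? ⟧
  ⟦⟧-⊎ p? (yes q) r? f g h disj = trans (⟦⟧-yes p? (g q)) (cong suc (sym (⟦⟧-no r? (disj q))))
  ⟦⟧-⊎ p? (no ¬q) r? f g h disj = ⟦⟧-cong p? r? (λ p → [ (λ q → contradiction q ¬q) , id ]′ (f p)) h

  ≤-sum : ∀ {n} {f g : Fin n → ℕ} → (∀ i → f i ≤ g i) → sum f ≤ sum g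
  ≤-sum {zero}  h = z≤n
  ≤-sum {suc n} h = +-mono-≤ (h zero) (≤-sum (h ∘ suc))

  sum-const : ∀ n c → sum {n} (λ _ → c) ≡ n * c
  sum-const zero    c = refl
  sum-const (suc n) c = cong (c +_) (sum-const n c)

  sum-zero : ∀ {n} {f : Fin n → ℕ} → (∀ i → f i ≡ 0) → sum f ≡ 0
  sum-zero {n} h = trans (sum-cong-≗ h) (trans (sum-const n 0) (*-zeroʳ n))

  sum-single : ∀ {n} (i : Fin n) {f : Fin n → ℕ} → (∀ j → j ≢ i → f j ≡ 0) → sum f ≡ f i
  sum-single zero    {f} h = trans (cong (f zero +_) (sum-zero λ j → h (suc j) λ ())) (+-identityʳ _)
  sum-single (suc i) {f} h = trans (cong (_+ sum (f ∘ suc)) (h zero λ ()))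
    (sum-single i λ j j≢i → h (suc j) (j≢i ∘ Fin.suc-injective))

  sum-≟ : ∀ {n} (i : Fin n) → sum (λ j → ⟦ i Fin.≟ j ⟧) ≡ 1
  sum-≟ i = trans (sum-single i λ j j≢i → ⟦⟧-no (i Fin.≟ j) (j≢i ∘ sym)) (⟦⟧-yes (i Fin.≟ i) refl)

  module _ {A : Set} where

    ∑∈ : List A → (A → ℕ) → ℕ
    ∑∈ []       f = 0
    ∑∈ (x ∷ xs) f = f x + ∑∈ xs f

    ∑∈-mono : ∀ {xs} {f g : A → ℕ} → All (λ x → f x ≤ g x) xs → ∑∈ xs f ≤ ∑∈ xs g
    ∑∈-mono []       = z≤n
    ∑∈-mono (h ∷ hs) = +-mono-≤ h (∑∈-mono hs)

    ∑∈-cong : ∀ xs {f g : A → ℕ} → (∀ x → f x ≡ g x) → ∑∈ xs f ≡ ∑∈ xs g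
    ∑∈-cong []       h = refl
    ∑∈-cong (x ∷ xs) h = cong₂ _+_ (h x) (∑∈-cong xs h)

    ∑∈-const : ∀ (xs : List A) c → ∑∈ xs (λ _ → c) ≡ length xs * c
    ∑∈-const []       c = refl
    ∑∈-const (x ∷ xs) c = cong (c +_) (∑∈-const xs c)

    ∑∈-*ˡ : ∀ xs c (f : A → ℕ) → c * ∑∈ xs f ≡ ∑∈ xs (λ x → c * f x)
    ∑∈-*ˡ []       c f = *-zeroʳ c
    ∑∈-*ˡ (x ∷ xs) c f = trans (*-distribˡ-+ c (f x) (∑∈ xs f)) (cong (c * f x +_) (∑∈-*ˡ xs c f))

    ∑∈-*ʳ : ∀ xs c (f : A → ℕ) → ∑∈ xs f * c ≡ ∑∈ xs (λ x → f x * c)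
    ∑∈-*ʳ []       c f = refl
    ∑∈-*ʳ (x ∷ xs) c f = trans (*-distribʳ-+ c (f x) (∑∈ xs f)) (cong (f x * c +_) (∑∈-*ʳ xs c f))

    ∑∈-++ : ∀ xs ys (f : A → ℕ) → ∑∈ (xs ++ ys) f ≡ ∑∈ xs f + ∑∈ ys f
    ∑∈-++ []       ys f = refl
    ∑∈-++ (x ∷ xs) ys f = trans (cong (f x +_) (∑∈-++ xs ys f)) (sym (+-assoc (f x) _ _))

    ∑∈-+ : ∀ xs (f g : A → ℕ) → ∑∈ xs (λ x → f x + g x) ≡ ∑∈ xs f + ∑∈ xs g
    ∑∈-+ []       f g = refl
    ∑∈-+ (x ∷ xs) f g = trans (cong (f x + g x +_) (∑∈-+ xs f g)) (eq (f x) (g x) (∑∈ xs f) (∑∈ xs g))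
      where
      eq : ∀ a b c d → a + b + (c + d) ≡ a + c + (b + d)
      eq = solve-∀

    sum-∑∈ : ∀ {n} xs (f : Fin n → A → ℕ) → sum (λ i → ∑∈ xs (f i)) ≡ ∑∈ xs (λ x → sum (λ i → f i x))
    sum-∑∈ {n} []       f = trans (sum-const n 0) (*-zeroʳ n)
    sum-∑∈ {n} (x ∷ xs) f = trans (∑-distrib-+ (λ i → f i x) (λ i → ∑∈ xs (f i)))
      (cong (sum (λ i → f i x) +_) (sum-∑∈ xs f))

    ∑∈-any : ∀ {xs} {f : A → ℕ} → Any (λ x → 1 ≤ f x) xs → 1 ≤ ∑∈ xs f
    ∑∈-any {x ∷ xs} {f} (here h)  = ≤-trans h (m≤m+n (f x) (∑∈ xs f))
    ∑∈-any {x ∷ xs} {f} (there h) = ≤-trans (∑∈-any h) (m≤n+m (∑∈ xs f) (f x))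

    module _ {P : A → Set} (P? : Decidable P) where

      ∑∈-filter-≤ : ∀ xs (f : A → ℕ) → ∑∈ (filter P? xs) f ≤ ∑∈ xs f
      ∑∈-filter-≤ [] f = z≤n
      ∑∈-filter-≤ (x ∷ xs) f with P? x
      ... | yes _ = +-monoʳ-≤ (f x) (∑∈-filter-≤ xs f)
      ... | no  _ = ≤-trans (∑∈-filter-≤ xs f) (m≤n+m _ (f x))

      ∑∈-partition : ∀ xs (f : A → ℕ) → ∑∈ (filter (¬? ∘ P?) xs) f + ∑∈ (filter P? xs) f ≡ ∑∈ xs f
      ∑∈-partition [] f = refl
      ∑∈-partition (x ∷ xs) f with P? x
      ... | yes _ = trans (comm (∑∈ (filter (¬? ∘ P?) xs) f) (f x) (∑∈ (filter P? xs) f)) (cong (f x +_) (∑∈-partition xs f))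
        where
        comm : ∀ a b c → a + (b + c) ≡ b + (a + c)
        comm = solve-∀
      ... | no  _ = trans (+-assoc (f x) (∑∈ (filter (¬? ∘ P?) xs) f) _) (cong (f x +_) (∑∈-partition xs f))

  -- Transpositions.

  module _ {n : ℕ} where

    transpose-ˡ : ∀ (v a : Fin n) → transpose v a v ≡ a
    transpose-ˡ v a with v Fin.≟ v
    ... | yes _  = refl
    ... | no v≢v = contradiction refl v≢v

    transpose-ʳ : ∀ (v a : Fin n) → transpose v a a ≡ v
    transpose-ʳ v a with a Fin.≟ v
    ... | yes a≡v = a≡v
    ... | no _ with a Fin.≟ a
    ...   | yes _  = refl
    ...   | no a≢a = contradiction refl a≢a

    transpose-other : ∀ (v a x : Fin n) → x ≢ v → x ≢ a → transpose v a x ≡ x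
    transpose-other v a x x≢v x≢a with x Fin.≟ v
    ... | yes x≡v = contradiction x≡v x≢v
    ... | no _ with x Fin.≟ a
    ...   | yes x≡a = contradiction x≡a x≢a
    ...   | no _    = refl

    -- A transposition changes two values only. Applied to an edge disjoint from (u , v), this says
    -- from which edge a switching can have created it.
    transpose-moved : ∀ (v a x : Fin n) → transpose v a x ≢ v → x ≢ transpose v a x → transpose v a x ≡ a × x ≡ v
    transpose-moved v a x ≢v moved with x Fin.≟ v
    ... | yes x≡v = refl , x≡v
    ... | no _ with x Fin.≟ a
    ...   | yes _ = contradiction refl ≢v
    ...   | no _  = contradiction refl moved

  -- The power inequality behind the local lemma.

  ^-distribʳ-* : ∀ a b k → (a * b) ^ k ≡ a ^ k * b ^ k
  ^-distribʳ-* a b zero    = refl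
  ^-distribʳ-* a b (suc k) = trans (cong (a * b *_) (^-distribʳ-* a b k)) ([m*n]*[o*p]≡[m*o]*[n*p] a b (a ^ k) (b ^ k))

  block-power : ∀ c d k {X Y} .{{_ : NonZero c}} → c * X ≤ d * Y → d ^ k ≤ c ^ k * 3 → X ^ k ≤ 3 * Y ^ k
  block-power c d k {X} {Y} h c≤d = *-cancelˡ-≤ (c ^ k) {{m^n≢0 c k}} (begin
    c ^ k * X ^ k          ≡⟨ ^-distribʳ-* c X k ⟨
    (c * X) ^ k            ≤⟨ ^-monoˡ-≤ k h ⟩
    (d * Y) ^ k            ≡⟨ ^-distribʳ-* d Y k ⟩
    d ^ k * Y ^ k          ≤⟨ *-monoˡ-≤ (Y ^ k) c≤d ⟩
    c ^ k * 3 * Y ^ k      ≡⟨ *-assoc (c ^ k) 3 (Y ^ k) ⟩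
    c ^ k * (3 * Y ^ k)    ∎)
    where open ≤-Reasoning

  -- Splitting j into eight blocks brings (1 - 3/(x+3))ʲ ≥ (1 - 1/8)⁸ > 1/3 down to Bernoulli's inequality.
  power-bound : ∀ x j → 3 * (j + 7) ≤ x + 3 → (x + 3) ^ j ≤ 3 * x ^ j
  power-bound x j h = *-cancelʳ-≤ ((x + 3) ^ j) (3 * x ^ j) (D ^ r) {{m^n≢0 D r {{D≢0}}}} (begin
    D ^ j * D ^ r          ≡⟨ ^-distribˡ-+-* D j r ⟨
    D ^ (j + r)            ≡⟨ cong (D ^_) (m+[n∸m]≡n j≤) ⟩
    D ^ (q * 8)            ≤⟨ blocks ⟩
    3 * x ^ (q * 8)        ≡⟨ cong (λ z → 3 * x ^ z) (m+[n∸m]≡n j≤) ⟨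
    3 * x ^ (j + r)        ≡⟨ cong (3 *_) (^-distribˡ-+-* x j r) ⟩
    3 * (x ^ j * x ^ r)    ≡⟨ *-assoc 3 (x ^ j) (x ^ r) ⟨
    3 * x ^ j * x ^ r      ≤⟨ *-monoʳ-≤ (3 * x ^ j) (^-monoˡ-≤ r (m≤m+n x 3)) ⟩
    3 * x ^ j * D ^ r      ∎)
    where
    open ≤-Reasoning
    D = x + 3
    -- j is rounded up to a multiple of 8, whence the 7 in the hypothesis.
    q = (j + 7) / 8
    r = q * 8 ∸ j
    D≢0 : NonZero D
    D≢0 = >-nonZero (≤-trans (s≤s z≤n) (m≤n+m 3 x))
    j≤ : j ≤ q * 8
    j≤ = +-cancelʳ-≤ 7 j (q * 8) (≤-trans (≤-reflexive (m≡m%n+[m/n]*n (j + 7) 8))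
      (≤-trans (+-monoˡ-≤ (q * 8) (≤-pred (m%n<n (j + 7) 8))) (≤-reflexive (+-comm 7 (q * 8)))))
    24q≤D : 3 * (q * 8) ≤ D
    24q≤D = ≤-trans (*-monoʳ-≤ 3 (m/n*n≤m (j + 7) 8)) h
    -- Bernoulli's inequality (x/D)^q ≥ 1 - 3q/D, cleared of denominators.
    bernoulli : ∀ q → D ^ q * D ≤ D * x ^ q + 3 * q * D ^ q
    bernoulli zero = ≤-reflexive (e D)
      where
      e : ∀ D → 1 * D ≡ D * 1 + 0
      e = solve-∀
    bernoulli (suc q) = begin
      D * D ^ q * D                                   ≡⟨ *-assoc D (D ^ q) D ⟩
      D * (D ^ q * D)                                 ≤⟨ *-monoʳ-≤ D (bernoulli q) ⟩
      D * (D * x ^ q + 3 * q * D ^ q)                 ≡⟨ e x (x ^ q) (D ^ q) q ⟩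
      D * (x * x ^ q) + 3 * D * x ^ q + 3 * q * (D * D ^ q) ≤⟨ +-monoˡ-≤ _ (+-monoʳ-≤ (D * (x * x ^ q)) (*-monoʳ-≤ (3 * D) (^-monoˡ-≤ q (m≤m+n x 3)))) ⟩
      D * (x * x ^ q) + 3 * D * D ^ q + 3 * q * (D * D ^ q) ≡⟨ e′ D (x * x ^ q) (D ^ q) q ⟩
      D * (x * x ^ q) + 3 * suc q * (D * D ^ q)       ∎
      where
      e : ∀ x X Y q → (x + 3) * ((x + 3) * X + 3 * q * Y) ≡ (x + 3) * (x * X) + 3 * (x + 3) * X + 3 * q * ((x + 3) * Y)
      e = solve-∀
      e′ : ∀ D X Y q → D * X + 3 * D * Y + 3 * q * (D * Y) ≡ D * X + 3 * (1 + q) * (D * Y)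
      e′ = solve-∀
    seven : 7 * D ^ q ≤ 8 * x ^ q
    seven = *-cancelʳ-≤ (7 * D ^ q) (8 * x ^ q) D {{D≢0}} (+-cancelʳ-≤ (D ^ q * D) _ _ (begin
      7 * D ^ q * D + D ^ q * D                ≡⟨ e₁ (D ^ q) D ⟩
      8 * (D ^ q * D)                          ≤⟨ *-monoʳ-≤ 8 (bernoulli q) ⟩
      8 * (D * x ^ q + 3 * q * D ^ q)          ≡⟨ e₂ D (x ^ q) (D ^ q) q ⟩
      8 * x ^ q * D + D ^ q * (3 * (q * 8))    ≤⟨ +-monoʳ-≤ (8 * x ^ q * D) (*-monoʳ-≤ (D ^ q) 24q≤D) ⟩
      8 * x ^ q * D + D ^ q * D                ∎))
      where
      e₁ : ∀ X D → 7 * X * D + X * D ≡ 8 * (X * D)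
      e₁ = solve-∀
      e₂ : ∀ D X Y q → 8 * (D * X + 3 * q * Y) ≡ 8 * X * D + Y * (3 * (q * 8))
      e₂ = solve-∀
    blocks : D ^ (q * 8) ≤ 3 * x ^ (q * 8)
    blocks = subst₂ (λ X Y → X ≤ 3 * Y) (^-*-assoc D q 8) (^-*-assoc x q 8)
      (block-power 7 8 8 {D ^ q} {x ^ q} seven (≤ᵇ⇒≤ (8 ^ 8) (7 ^ 8 * 3) tt))

  -- A finite family of perfect matchings σ ω, closed under relabelling the right class by transpositions.
  module Switching (n m : ℕ) (σ : Fin m → Fin n → Fin n)
    (σ-injective : ∀ ω {u u′} → σ ω u ≡ σ ω u′ → u ≡ u′)
    (T : Fin n → Fin n → Fin m → Fin m)
    (σ-T : ∀ v a ω u → σ (T v a ω) u ≡ transpose v a (σ ω u))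
    (sum-T : ∀ v a (f : Fin m → ℕ) → sum f ≡ sum (f ∘ T v a))
    where

    -- Counting matchings with prescribed edges and avoided pairs.

    Pair : Set
    Pair = Edge n × Edge n

    _≟ₑ_ : (e f : Edge n) → Dec (e ≡ f)
    _≟ₑ_ = ≡-dec Fin._≟_ Fin._≟_

    _∈ω_ : Edge n → Fin m → Set
    (u , v) ∈ω ω = σ ω u ≡ v

    Contains : List (Edge n) → Fin m → Set
    Contains P ω = All (_∈ω ω) P

    AvoidsPair : Fin m → Pair → Set
    AvoidsPair ω (g , h) = ¬ (g ∈ω ω × h ∈ω ω)

    avoidsPair? : ∀ ω B → Dec (AvoidsPair ω B)
    avoidsPair? ω ((u , v) , (u′ , v′)) = ¬? ((σ ω u Fin.≟ v) ×-dec (σ ω u′ Fin.≟ v′))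

    W : List (Edge n) → List Pair → Fin m → Set
    W P F ω = Contains P ω × All (AvoidsPair ω) F

    W? : ∀ P F ω → Dec (W P F ω)
    W? P F ω = all? (λ (u , v) → σ ω u Fin.≟ v) P ×-dec all? (avoidsPair? ω) F

    -- `N P F` / `N [] F` is the probability that a random matching contains `P`, given that it
    -- avoids `F`.
    N : List (Edge n) → List Pair → ℕ
    N P F = sum (λ ω → ⟦ W? P F ω ⟧)

    N-mono : ∀ {P F P′ F′} → (∀ ω → W P F ω → W P′ F′ ω) → N P F ≤ N P′ F′
    N-mono {P} {F} {P′} {F′} h = ≤-sum λ ω → ⟦⟧-mono (W? P F ω) (W? P′ F′ ω) (h ω)

    N-zero : ∀ {P F} → (∀ ω → ¬ W P F ω) → N P F ≡ 0
    N-zero {P} {F} h = sum-zero λ ω → ⟦⟧-no (W? P F ω) (h ω)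

    -- With `P` empty, this yields the factor of one conflict in the product for the rainbow
    -- probability: avoiding (g , h) too removes exactly the matchings that contain both edges.
    N-cons : ∀ P g h F → N P F ≡ N P ((g , h) ∷ F) + N (g ∷ h ∷ P) F
    N-cons P g h F = trans
      (sum-cong-≗ λ ω → ⟦⟧-⊎ (W? P F ω) (W? P ((g , h) ∷ F) ω) (W? (g ∷ h ∷ P) F ω)
        (split ω)
        (λ { (p , _ ∷ a) → p , a })
        (λ { (_ ∷ _ ∷ p , a) → p , a })
        (λ { (_ , ¬gh ∷ _) (g∈ ∷ h∈ ∷ _ , _) → ¬gh (g∈ , h∈) }))
      (∑-distrib-+ (λ ω → ⟦ W? P ((g , h) ∷ F) ω ⟧) (λ ω → ⟦ W? (g ∷ h ∷ P) F ω ⟧))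
      where
      split : ∀ ω → W P F ω → W P ((g , h) ∷ F) ω ⊎ W (g ∷ h ∷ P) F ω
      split ω (p , a) with (σ ω (proj₁ g) Fin.≟ proj₂ g) ×-dec (σ ω (proj₁ h) Fin.≟ proj₂ h)
      ... | yes (g∈ , h∈) = inj₂ (g∈ ∷ h∈ ∷ p , a)
      ... | no ¬gh        = inj₁ (p , ¬gh ∷ a)

    -- The partner of `u` takes exactly one value. Both switchings compare a single summand with all
    -- n of them.
    N-total : ∀ u Q F → sum (λ a → N ((u , a) ∷ Q) F) ≡ N Q F
    N-total u Q F = trans (∑-comm (λ a ω → ⟦ W? ((u , a) ∷ Q) F ω ⟧)) (sum-cong-≗ λ ω →
      trans (sum-single (σ ω u) (λ a a≢ → ⟦⟧-no (W? ((u , a) ∷ Q) F ω) λ { (e ∷ _ , _) → a≢ (sym e) }))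
        (⟦⟧-cong (W? ((u , σ ω u) ∷ Q) F ω) (W? Q F ω) (λ { (_ ∷ q , a) → q , a }) (λ (q , a) → refl ∷ q , a)))

    -- Switchings in both directions.

    Away : List (Edge n) → Pair → Set
    Away P (g , h) = All (λ p → NonIncident p g × NonIncident p h) P

    away? : ∀ P B → Dec (Away P B)
    away? P (g , h) = all? (λ p → nonIncident? p g ×-dec nonIncident? p h) P

    RightFree : Fin n → List (Edge n) → Set
    RightFree a = All (λ (q : Edge n) → proj₂ q ≢ a)

    rightCount : List (Edge n) → Fin n → ℕ
    rightCount Q a = ∑∈ Q (λ q → ⟦ proj₂ q Fin.≟ a ⟧)

    sum-rightCount : ∀ Q → sum (rightCount Q) ≡ length Q
    sum-rightCount Q = trans (sum-∑∈ Q (λ a q → ⟦ proj₂ q Fin.≟ a ⟧))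
      (trans (∑∈-cong Q λ q → sum-≟ (proj₂ q)) (trans (∑∈-const Q 1) (*-identityʳ (length Q))))

    rightFree? : ∀ Q a → Dec (RightFree a Q)
    rightFree? Q a = all? (λ (q : Edge n) → ¬? (proj₂ q Fin.≟ a)) Q

    occupied : ∀ Q a → ¬ RightFree a Q → Any (λ (q : Edge n) → proj₂ q ≡ a) Q
    occupied Q a ¬free = Any.map (λ {q} → decidable-stable (proj₂ q Fin.≟ a)) (All.¬All⇒Any¬ (λ (q : Edge n) → ¬? (proj₂ q Fin.≟ a)) Q ¬free)

    rightCount-pos : ∀ Q a → ¬ RightFree a Q → 1 ≤ rightCount Q a
    rightCount-pos Q a ¬free = ∑∈-any (Any.map (λ {q} e → ≤-reflexive (sym (⟦⟧-yes (proj₂ q Fin.≟ a) e))) (occupied Q a ¬free))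

    Contains-T : ∀ {v a ω Q} → RightFree v Q → RightFree a Q →
      Contains Q ω → Contains Q (T v a ω)
    Contains-T [] [] [] = []
    Contains-T {v} {a} {ω} {q ∷ _} (≢v ∷ hv) (≢a ∷ ha) (e ∷ c) =
      trans (σ-T v a ω (proj₁ q)) (trans (cong (transpose v a) e) (transpose-other v a (proj₂ q) ≢v ≢a))
        ∷ Contains-T hv ha c

    -- `T v a` moves the edge at `u` from `v` to `a` and respects `Q` if `a` is not a right end of
    -- `Q`. The other new edge ends in `v`, so every new edge meets (u , v) and none lies in a pair
    -- of `F`. The right ends of `Q` are paid for by the term with `length Q`.
    switch-≤ : ∀ u v Q F → All (Away ((u , v) ∷ Q)) F → RightFree v Q →
      n * N ((u , v) ∷ Q) F ≤ N Q F + length Q * N ((u , v) ∷ Q) F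
    switch-≤ u v Q F away Q≢v = begin
      n * X                                                      ≡⟨ sum-const n X ⟨
      sum {n} (λ _ → X)                                          ≤⟨ ≤-sum bound ⟩
      sum (λ a → N ((u , a) ∷ Q) F + rightCount Q a * X)         ≡⟨ ∑-distrib-+ (λ a → N ((u , a) ∷ Q) F) (λ a → rightCount Q a * X) ⟩
      sum (λ a → N ((u , a) ∷ Q) F) + sum (λ a → rightCount Q a * X) ≡⟨ cong₂ _+_ (N-total u Q F) (trans (sym (*-distribʳ-sum X (rightCount Q))) (cong (_* X) (sum-rightCount Q))) ⟩
      N Q F + length Q * X                                       ∎
      where
      open ≤-Reasoning
      X = N ((u , v) ∷ Q) F
      back : ∀ {a ω} g → σ ω u ≡ v → NonIncident (u , v) g → g ∈ω T v a ω → g ∈ω ω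
      back {a} {ω} g eu (u≢ , v≢) g∈ with σ ω (proj₁ g) Fin.≟ proj₂ g
      ... | yes e = e
      ... | no ≢ = contradiction (σ-injective ω (trans eu (sym (proj₂ moved)))) u≢
        where
        g∈′ = trans (sym (σ-T v a ω (proj₁ g))) g∈
        moved = transpose-moved v a (σ ω (proj₁ g)) (λ e → v≢ (trans (sym e) g∈′)) (λ e → ≢ (trans e g∈′))
      bound : ∀ a → X ≤ N ((u , a) ∷ Q) F + rightCount Q a * X
      bound a with rightFree? Q a
      ... | no ¬free = ≤-trans (≤-trans (≤-reflexive (sym (*-identityˡ X))) (*-monoˡ-≤ X (rightCount-pos Q a ¬free))) (m≤n+m _ _)
      ... | yes free = ≤-trans (≤-trans
          (≤-sum λ ω → ⟦⟧-mono (W? ((u , v) ∷ Q) F ω) (W? ((u , a) ∷ Q) F (T v a ω)) (step ω))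
          (≤-reflexive (sym (sum-T v a (λ ω → ⟦ W? ((u , a) ∷ Q) F ω ⟧)))))
        (m≤m+n _ _)
        where
        step : ∀ ω → W ((u , v) ∷ Q) F ω → W ((u , a) ∷ Q) F (T v a ω)
        step ω (eu ∷ q , good) =
          trans (σ-T v a ω u) (trans (cong (transpose v a) eu) (transpose-ˡ v a)) ∷ Contains-T Q≢v free q ,
          All.zipWith (λ { {g , h} ((ug , uh) ∷ _ , ¬gh) (g∈ , h∈) → ¬gh (back g eu ug g∈ , back h eu uh h∈) }) (away , good)

    falling : ℕ → ℕ
    falling zero    = 1
    falling (suc r) = (n ∸ r) * falling r

    DistinctRight : List (Edge n) → Set
    DistinctRight = AllPairs (λ p q → proj₂ q ≢ proj₂ p)

    -- One switching for each edge of `P`; the edges further down the list block `length Q` right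
    -- vertices.
    falling-≤ : ∀ P F → All (Away P) F → DistinctRight P → falling (length P) * N P F ≤ N [] F
    falling-≤ [] F _ _ = ≤-reflexive (+-identityʳ _)
    falling-≤ ((u , v) ∷ Q) F away (≢v ∷ dQ) = begin
      (n ∸ length Q) * falling (length Q) * X   ≡⟨ comm (n ∸ length Q) (falling (length Q)) X ⟩
      falling (length Q) * ((n ∸ length Q) * X) ≤⟨ *-monoʳ-≤ (falling (length Q)) drop ⟩
      falling (length Q) * N Q F                ≤⟨ falling-≤ Q F (All.map All.tail away) dQ ⟩
      N [] F                                    ∎
      where
      open ≤-Reasoning
      X = N ((u , v) ∷ Q) F
      comm : ∀ a b c → a * b * c ≡ b * (a * c)
      comm = solve-∀
      drop : (n ∸ length Q) * X ≤ N Q F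
      drop = ≤-trans (≤-reflexive (*-distribʳ-∸ X n (length Q)))
        (m≤n+o⇒m∸n≤o _ _ (≤-trans (switch-≤ u v Q F away ≢v) (≤-reflexive (+-comm (N Q F) _))))

    -- The matchings spoilt by switching an edge onto (u , v): the pair (g , h) is created
    -- when the new edge is g, coming from (g₁ , v) and (u , g₂), or likewise h.
    spoiltBy : Fin n → Fin n → List (Edge n) → List Pair → Pair → ℕ
    spoiltBy u v Q F (g , h) =
      N ((proj₁ g , v) ∷ (u , proj₂ g) ∷ h ∷ Q) F + N ((proj₁ h , v) ∷ (u , proj₂ h) ∷ g ∷ Q) F

    -- `T v a` is now run from (u , a) to (u , v). Besides (u , v) it creates the edge (w , a),
    -- where w was the partner of `v`, and this edge may complete a pair of `F`; matchings lost in
    -- this way are charged to `spoiltBy`.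
    switch-≥ : ∀ u v Q F → All (Away ((u , v) ∷ Q)) F → All (λ (g , h) → NonIncident g h) F →
      All (NonIncident (u , v)) Q → (∀ a → rightCount Q a ≤ 1) →
      N Q F + length Q * N ((u , v) ∷ Q) F ≤ n * N ((u , v) ∷ Q) F + ∑∈ F (spoiltBy u v Q F)
    switch-≥ u v Q F away indep freeQ count≤1 = begin
      N Q F + length Q * X
        ≡⟨ cong₂ _+_ (N-total u Q F) (trans (sym (*-distribʳ-sum X (rightCount Q))) (cong (_* X) (sum-rightCount Q))) ⟨
      sum (λ a → N ((u , a) ∷ Q) F) + sum (λ a → rightCount Q a * X)
        ≡⟨ ∑-distrib-+ (λ a → N ((u , a) ∷ Q) F) (λ a → rightCount Q a * X) ⟨
      sum (λ a → N ((u , a) ∷ Q) F + rightCount Q a * X)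
        ≤⟨ ≤-sum bound ⟩
      sum (λ a → X + ∑∈ F (λ B → spoilt a B))
        ≡⟨ ∑-distrib-+ (λ _ → X) (λ a → ∑∈ F (spoilt a)) ⟩
      sum {n} (λ _ → X) + sum (λ a → ∑∈ F (spoilt a))
        ≡⟨ cong₂ _+_ (sum-const n X) (trans (sum-∑∈ F spoilt) (∑∈-cong F total)) ⟩
      n * X + ∑∈ F (spoiltBy u v Q F) ∎
      where
      open ≤-Reasoning
      X = N ((u , v) ∷ Q) F
      K₁ K₂ : Pair → List (Edge n)
      K₁ (g , h) = (proj₁ g , v) ∷ (u , proj₂ g) ∷ h ∷ Q
      K₂ (g , h) = (proj₁ h , v) ∷ (u , proj₂ h) ∷ g ∷ Q
      spoiltAt : Fin n → Fin m → Pair → ℕ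
      spoiltAt a ω B@(g , h) =
        ⟦ proj₂ g Fin.≟ a ⟧ * ⟦ W? (K₁ B) F ω ⟧ + ⟦ proj₂ h Fin.≟ a ⟧ * ⟦ W? (K₂ B) F ω ⟧
      spoilt : Fin n → Pair → ℕ
      spoilt a B@(g , h) = ⟦ proj₂ g Fin.≟ a ⟧ * N (K₁ B) F + ⟦ proj₂ h Fin.≟ a ⟧ * N (K₂ B) F
      total : ∀ B → sum (λ a → spoilt a B) ≡ spoiltBy u v Q F B
      total B@(g , h) = trans (∑-distrib-+ (λ a → ⟦ proj₂ g Fin.≟ a ⟧ * N (K₁ B) F) (λ a → ⟦ proj₂ h Fin.≟ a ⟧ * N (K₂ B) F))
        (cong₂ _+_ (one (proj₂ g) (N (K₁ B) F)) (one (proj₂ h) (N (K₂ B) F)))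
        where
        one : ∀ i c → sum (λ a → ⟦ i Fin.≟ a ⟧ * c) ≡ c
        one i c = trans (sym (*-distribʳ-sum c (λ a → ⟦ i Fin.≟ a ⟧))) (trans (cong (_* c) (sum-≟ i)) (*-identityˡ c))
      sum-spoiltAt : ∀ a → sum (λ ω → ∑∈ F (spoiltAt a ω)) ≡ ∑∈ F (spoilt a)
      sum-spoiltAt a = trans (sum-∑∈ F (spoiltAt a)) (∑∈-cong F λ B@(g , h) →
        trans (∑-distrib-+ (λ ω → ⟦ proj₂ g Fin.≟ a ⟧ * ⟦ W? (K₁ B) F ω ⟧) (λ ω → ⟦ proj₂ h Fin.≟ a ⟧ * ⟦ W? (K₂ B) F ω ⟧))
          (sym (cong₂ _+_ (*-distribˡ-sum ⟦ proj₂ g Fin.≟ a ⟧ (λ ω → ⟦ W? (K₁ B) F ω ⟧))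
            (*-distribˡ-sum ⟦ proj₂ h Fin.≟ a ⟧ (λ ω → ⟦ W? (K₂ B) F ω ⟧)))))

      moved : ∀ {a ω} g → NonIncident (u , v) g → g ∈ω T v a ω → ¬ g ∈ω ω → proj₂ g ≡ a × σ ω (proj₁ g) ≡ v
      moved {a} {ω} g (_ , v≢) g∈ g∉ =
        let g∈′ = trans (sym (σ-T v a ω (proj₁ g))) g∈
            (e , e′) = transpose-moved v a (σ ω (proj₁ g)) (λ e → v≢ (trans (sym e) g∈′)) (λ e → g∉ (trans e g∈′))
        in trans (sym g∈′) e , e′

      pointwise : ∀ a ω → RightFree a Q →
        ⟦ W? ((u , a) ∷ Q) F ω ⟧ ≤ ⟦ W? ((u , v) ∷ Q) F (T v a ω) ⟧ + ∑∈ F (spoiltAt a ω)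
      pointwise a ω free = ⟦⟧-≤ (W? ((u , a) ∷ Q) F ω) λ { (eu ∷ cQ , good) → case-good eu cQ good }
        where
        case-good : σ ω u ≡ a → Contains Q ω → All (AvoidsPair ω) F →
          1 ≤ ⟦ W? ((u , v) ∷ Q) F (T v a ω) ⟧ + ∑∈ F (spoiltAt a ω)
        case-good eu cQ good = [ kept , spoils ]′ (toSum (all? (avoidsPair? (T v a ω)) F))
          where
          kept : All (AvoidsPair (T v a ω)) F → 1 ≤ ⟦ W? ((u , v) ∷ Q) F (T v a ω) ⟧ + ∑∈ F (spoiltAt a ω)
          kept good′ = ≤-trans (≤-reflexive (sym (⟦⟧-yes (W? ((u , v) ∷ Q) F (T v a ω))
                (trans (σ-T v a ω u) (trans (cong (transpose v a) eu) (transpose-ʳ v a))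
                  ∷ Contains-T (All.map (λ ni e → proj₂ ni (sym e)) freeQ) free cQ , good′)))) (m≤m+n _ _)
          bad : ∀ g h → NonIncident (u , v) g → NonIncident (u , v) h → NonIncident g h → AvoidsPair ω (g , h) →
            ¬ AvoidsPair (T v a ω) (g , h) → 1 ≤ spoiltAt a ω (g , h)
          bad g h ug uh gh av ¬av = cases (toSum (σ ω (proj₁ g) Fin.≟ proj₂ g)) (toSum (σ ω (proj₁ h) Fin.≟ proj₂ h))
            where
            g-moved : ¬ g ∈ω ω → proj₂ g ≡ a × σ ω (proj₁ g) ≡ v
            g-moved = moved g ug (decidable-stable (σ (T v a ω) (proj₁ g) Fin.≟ proj₂ g) λ ¬g → ¬av (¬g ∘ proj₁))
            h-moved : ¬ h ∈ω ω → proj₂ h ≡ a × σ ω (proj₁ h) ≡ v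
            h-moved = moved h uh (decidable-stable (σ (T v a ω) (proj₁ h) Fin.≟ proj₂ h) λ ¬h → ¬av (¬h ∘ proj₂))
            cases : g ∈ω ω ⊎ ¬ g ∈ω ω → h ∈ω ω ⊎ ¬ h ∈ω ω → 1 ≤ spoiltAt a ω (g , h)
            cases (inj₁ g∈) (inj₁ h∈) = contradiction (g∈ , h∈) av
            -- Two new edges would share their left vertex, the old partner of `v`.
            cases (inj₂ g∉) (inj₂ h∉) = contradiction
              (σ-injective ω (trans (proj₂ (g-moved g∉)) (sym (proj₂ (h-moved h∉))))) (proj₁ gh)
            cases (inj₂ g∉) (inj₁ h∈) = let (e , e′) = g-moved g∉ in
              ≤-trans (≤-reflexive (sym (cong₂ _*_ (⟦⟧-yes (proj₂ g Fin.≟ a) e)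
                (⟦⟧-yes (W? (K₁ (g , h)) F ω) (e′ ∷ trans eu (sym e) ∷ h∈ ∷ cQ , good))))) (m≤m+n _ _)
            cases (inj₁ g∈) (inj₂ h∉) = let (e , e′) = h-moved h∉ in
              ≤-trans (≤-reflexive (sym (cong₂ _*_ (⟦⟧-yes (proj₂ h Fin.≟ a) e)
                (⟦⟧-yes (W? (K₂ (g , h)) F ω) (e′ ∷ trans eu (sym e) ∷ g∈ ∷ cQ , good))))) (m≤n+m _ _)
          find : ∀ L → All (Away ((u , v) ∷ Q)) L → All (λ (g , h) → NonIncident g h) L → All (AvoidsPair ω) L →
            Any (λ B → ¬ AvoidsPair (T v a ω) B) L → Any (λ B → 1 ≤ spoiltAt a ω B) L
          find ((g , h) ∷ L) (((ug , uh) ∷ _) ∷ _) (gh ∷ _) (av ∷ _) (here ¬av) = here (bad g h ug uh gh av ¬av)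
          find (_ ∷ L) (_ ∷ aw) (_ ∷ ni) (_ ∷ av) (there any) = there (find L aw ni av any)
          spoils : ¬ All (AvoidsPair (T v a ω)) F → 1 ≤ ⟦ W? ((u , v) ∷ Q) F (T v a ω) ⟧ + ∑∈ F (spoiltAt a ω)
          spoils ¬good′ = ≤-trans (∑∈-any (find F away indep good (All.¬All⇒Any¬ (avoidsPair? (T v a ω)) F ¬good′))) (m≤n+m _ _)

      bound : ∀ a → N ((u , a) ∷ Q) F + rightCount Q a * X ≤ X + ∑∈ F (spoilt a)
      bound a with rightFree? Q a
      -- If `a` is a right end of `Q`, no matching contains both (u , a) and `Q`, and by `count≤1`
      -- the remaining term is at most one copy of `X`.
      ... | no ¬free = ≤-trans (≤-trans
              (≤-reflexive (cong (_+ rightCount Q a * X) (N-zero λ { ω (eu ∷ cQ , _) → clash Q freeQ cQ (occupied Q a ¬free) eu })))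
              (≤-trans (*-monoˡ-≤ X (count≤1 a)) (≤-reflexive (*-identityˡ X)))) (m≤m+n _ _)
        where
        clash : ∀ {ω} L → All (NonIncident (u , v)) L → Contains L ω → Any (λ (q : Edge n) → proj₂ q ≡ a) L → ¬ σ ω u ≡ a
        clash {ω} (q ∷ L) (ni ∷ _) (c ∷ _) (here e) eu = proj₁ ni (σ-injective ω (trans eu (trans (sym e) (sym c))))
        clash (_ ∷ L) (_ ∷ ni) (_ ∷ c) (there any) eu = clash L ni c any eu
      ... | yes free = begin
        N ((u , a) ∷ Q) F + rightCount Q a * X
          ≡⟨ cong (λ z → N ((u , a) ∷ Q) F + z * X) (zero-count Q free) ⟩
        N ((u , a) ∷ Q) F + 0
          ≡⟨ +-identityʳ _ ⟩
        N ((u , a) ∷ Q) F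
          ≤⟨ ≤-sum (λ ω → pointwise a ω free) ⟩
        sum (λ ω → ⟦ W? ((u , v) ∷ Q) F (T v a ω) ⟧ + ∑∈ F (spoiltAt a ω))
          ≡⟨ ∑-distrib-+ (λ ω → ⟦ W? ((u , v) ∷ Q) F (T v a ω) ⟧) (λ ω → ∑∈ F (spoiltAt a ω)) ⟩
        sum (λ ω → ⟦ W? ((u , v) ∷ Q) F (T v a ω) ⟧) + sum (λ ω → ∑∈ F (spoiltAt a ω))
          ≡⟨ cong₂ _+_ (sym (sum-T v a (λ ω → ⟦ W? ((u , v) ∷ Q) F ω ⟧))) (sum-spoiltAt a) ⟩
        X + ∑∈ F (spoilt a) ∎
        where
        zero-count : ∀ L → RightFree a L → rightCount L a ≡ 0
        zero-count [] [] = refl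
        zero-count (q ∷ L) (≢a ∷ h) = cong₂ _+_ (⟦⟧-no (proj₂ q Fin.≟ a) ≢a) (zero-count L h)

    -- Neighbourhoods in a sparse graph on the edges.

    ∑ₑ : (Edge n → ℕ) → ℕ
    ∑ₑ φ = sum (λ u → sum (λ v → φ (u , v)))

    ∑ₑ-+ : ∀ φ ψ → ∑ₑ (λ e → φ e + ψ e) ≡ ∑ₑ φ + ∑ₑ ψ
    ∑ₑ-+ φ ψ = trans (sum-cong-≗ λ u → ∑-distrib-+ (λ v → φ (u , v)) (λ v → ψ (u , v)))
      (∑-distrib-+ (λ u → sum (λ v → φ (u , v))) (λ u → sum (λ v → ψ (u , v))))

    ∑ₑ-∑∈ : ∀ P (f : Edge n → Edge n → ℕ) → ∑ₑ (λ e → ∑∈ P (f e)) ≡ ∑∈ P (λ p → ∑ₑ (λ e → f e p))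
    ∑ₑ-∑∈ P f = trans (sum-cong-≗ λ u → sum-∑∈ P (λ v → f (u , v)))
      (sum-∑∈ P (λ u p → sum (λ v → f (u , v) p)))

    ∑ₑ-1 : ∑ₑ (λ _ → 1) ≡ n * n
    ∑ₑ-1 = trans (sum-cong-≗ {n} λ u → trans (sum-const n 1) (*-identityʳ n)) (sum-const n n)

    ∑ₑ-left : ∀ w → ∑ₑ (λ e → ⟦ w Fin.≟ proj₁ e ⟧) ≡ n
    ∑ₑ-left w = trans (sum-cong-≗ λ u → sum-const n ⟦ w Fin.≟ u ⟧)
      (trans (sym (*-distribˡ-sum n (λ u → ⟦ w Fin.≟ u ⟧))) (trans (cong (n *_) (sum-≟ w)) (*-identityʳ n)))

    ∑ₑ-right : ∀ w → ∑ₑ (λ e → ⟦ w Fin.≟ proj₂ e ⟧) ≡ n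
    ∑ₑ-right w = trans (sum-cong-≗ {n} λ u → sum-≟ w) (trans (sum-const n 1) (*-identityʳ n))

    ∑ₑ-single : ∀ e → ∑ₑ (λ x → ⟦ x ≟ₑ e ⟧) ≡ 1
    ∑ₑ-single (w , z) = trans
      (sum-single w λ u u≢ → sum-zero λ v → ⟦⟧-no ((u , v) ≟ₑ (w , z)) (u≢ ∘ cong proj₁))
      (trans (sum-single z λ v v≢ → ⟦⟧-no ((w , v) ≟ₑ (w , z)) (v≢ ∘ cong proj₂)) (⟦⟧-yes ((w , z) ≟ₑ (w , z)) refl))

    -- Every edge has degree at most t in the graph F on the edges of K_{n,n}, stated
    -- with a weight φ so that one hypothesis bounds all the neighbourhood counts.
    record Sparse (t : ℕ) (F : List Pair) : Set where
      constructor mkSparse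
      field
        weight-≤ : ∀ φ → ∑∈ F (λ (g , h) → φ g + φ h) ≤ t * ∑ₑ φ

    open Sparse

    Indep : List Pair → Set
    Indep = All (λ (g , h) → NonIncident g h)

    near far : List (Edge n) → List Pair → List Pair
    near P = filter (¬? ∘ away? P)
    far  P = filter (away? P)

    touches : List (Edge n) → Edge n → ℕ
    touches P e = ∑∈ P (λ p → ⟦ proj₁ p Fin.≟ proj₁ e ⟧ + ⟦ proj₂ p Fin.≟ proj₂ e ⟧)

    ∑ₑ-touches : ∀ P → ∑ₑ (touches P) ≡ length P * (n + n)
    ∑ₑ-touches P = trans (∑ₑ-∑∈ P (λ e p → ⟦ proj₁ p Fin.≟ proj₁ e ⟧ + ⟦ proj₂ p Fin.≟ proj₂ e ⟧))
      (trans (∑∈-cong P λ p → trans (∑ₑ-+ (λ e → ⟦ proj₁ p Fin.≟ proj₁ e ⟧) (λ e → ⟦ proj₂ p Fin.≟ proj₂ e ⟧))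
        (cong₂ _+_ (∑ₑ-left (proj₁ p)) (∑ₑ-right (proj₂ p)))) (∑∈-const P (n + n)))

    touches-pos : ∀ P g h → ¬ Away P (g , h) → 1 ≤ touches P g + touches P h
    touches-pos P g h ¬away = ≤-trans
      (∑∈-any (Any.map (λ {p} → touch p) (All.¬All⇒Any¬ (λ p → nonIncident? p g ×-dec nonIncident? p h) P ¬away)))
      (≤-reflexive (∑∈-+ P (λ p → ⟦ proj₁ p Fin.≟ proj₁ g ⟧ + ⟦ proj₂ p Fin.≟ proj₂ g ⟧)
        (λ p → ⟦ proj₁ p Fin.≟ proj₁ h ⟧ + ⟦ proj₂ p Fin.≟ proj₂ h ⟧)))
      where
      touch₁ : ∀ p x → ¬ NonIncident p x → 1 ≤ ⟦ proj₁ p Fin.≟ proj₁ x ⟧ + ⟦ proj₂ p Fin.≟ proj₂ x ⟧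
      touch₁ p x ¬ni with proj₁ p Fin.≟ proj₁ x | proj₂ p Fin.≟ proj₂ x
      ... | yes _ | _     = s≤s z≤n
      ... | no _  | yes _ = s≤s z≤n
      ... | no ≢ₗ | no ≢ᵣ = contradiction (≢ₗ , ≢ᵣ) ¬ni
      touch : ∀ p → ¬ (NonIncident p g × NonIncident p h) →
        1 ≤ ⟦ proj₁ p Fin.≟ proj₁ g ⟧ + ⟦ proj₂ p Fin.≟ proj₂ g ⟧ + (⟦ proj₁ p Fin.≟ proj₁ h ⟧ + ⟦ proj₂ p Fin.≟ proj₂ h ⟧)
      touch p ¬both with nonIncident? p g
      ... | no ¬pg = ≤-trans (touch₁ p g ¬pg) (m≤m+n _ _)
      ... | yes pg = ≤-trans (touch₁ p h λ ph → ¬both (pg , ph)) (m≤n+m _ (⟦ proj₁ p Fin.≟ proj₁ g ⟧ + ⟦ proj₂ p Fin.≟ proj₂ g ⟧))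

    -- The weight is `touches P`: every vertex lies on n edges, so each edge of `P` contributes 2n
    -- to the total.
    length-near : ∀ t P F → Sparse t F → length (near P F) ≤ t * (length P * (n + n))
    length-near t P F sparse = begin
      length (near P F)                            ≡⟨ trans (∑∈-const (near P F) 1) (*-identityʳ _) ⟨
      ∑∈ (near P F) (λ _ → 1)                      ≤⟨ ∑∈-mono (All.map (λ { {g , h} ¬away → touches-pos P g h ¬away }) (All.all-filter (¬? ∘ away? P) F)) ⟩
      ∑∈ (near P F) (λ (g , h) → touches P g + touches P h) ≤⟨ ∑∈-filter-≤ (¬? ∘ away? P) F _ ⟩
      ∑∈ F (λ (g , h) → touches P g + touches P h) ≤⟨ weight-≤ sparse (touches P) ⟩
      t * ∑ₑ (touches P)                           ≡⟨ cong (t *_) (∑ₑ-touches P) ⟩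
      t * (length P * (n + n))                     ∎
      where open ≤-Reasoning

    sparse-far : ∀ {t} P F → Sparse t F → Sparse t (far P F)
    sparse-far P F sparse = mkSparse λ φ → ≤-trans (∑∈-filter-≤ (away? P) F _) (weight-≤ sparse φ)

    sparse-partition : ∀ {t} P F → Sparse t F → Sparse t (near P F ++ far P F)
    sparse-partition P F sparse = mkSparse λ φ → ≤-trans (≤-reflexive
      (trans (∑∈-++ (near P F) (far P F) _) (∑∈-partition (away? P) F _))) (weight-≤ sparse φ)

    sparse-tail : ∀ {t B F} → Sparse t (B ∷ F) → Sparse t F
    sparse-tail {t} {g , h} sparse = mkSparse λ φ → ≤-trans (m≤n+m _ (φ g + φ h)) (weight-≤ sparse φ)

    indep-partition : ∀ P F → Indep F → Indep (near P F ++ far P F)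
    indep-partition P F indep = All.++⁺ (All.filter⁺ (¬? ∘ away? P) indep) (All.filter⁺ (away? P) indep)

    length-partition : ∀ P F → length (near P F ++ far P F) ≡ length F
    length-partition P F = trans (sym (count (near P F ++ far P F)))
      (trans (∑∈-++ (near P F) (far P F) (λ _ → 1)) (trans (∑∈-partition (away? P) F (λ _ → 1)) (count F)))
      where
      count : ∀ (L : List Pair) → ∑∈ L (λ _ → 1) ≡ length L
      count L = trans (∑∈-const L 1) (*-identityʳ (length L))

    -- Avoidance does not depend on the order of the list, so the near pairs may be put in front of
    -- the far ones and peeled off one at a time.
    N-partition : ∀ Q P F → N Q (near P F ++ far P F) ≤ N Q F
    N-partition Q P F = N-mono λ { ω (c , avoids) → c ,
      All.filter⁻ (away? P) (All.++⁻ʳ (near P F) avoids) (All.++⁻ˡ (near P F) avoids) }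

    N-far : ∀ P Q F → N P F ≤ N P (far Q F)
    N-far P Q F = N-mono λ { ω (c , avoids) → c , All.filter⁺ (away? Q) avoids }

    far-away : ∀ P F → All (Away P) (far P F)
    far-away P F = All.all-filter (away? P) F

    D : ℕ
    D = n * (n ∸ 1)

    -- Two switchings. As 1/D is the unconditional probability of two disjoint edges, conditioning
    -- on distant conflicts does not raise it.
    pair-far : ∀ e f F → All (Away (e ∷ f ∷ [])) F → NonIncident e f → D * N (e ∷ f ∷ []) F ≤ N [] F
    pair-far e f F away ni = ≤-trans (≤-reflexive (cong (_* N (e ∷ f ∷ []) F) (eq n (n ∸ 1))))
      (falling-≤ (e ∷ f ∷ []) F away (((proj₂ ni ∘ sym) ∷ []) ∷ [] ∷ []))
      where
      eq : ∀ a b → a * b ≡ b * (a * 1)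
      eq = solve-∀

    -- The lopsided local lemma.

    module LocalLemma (t : ℕ) (12[1+t]≤n : 12 * suc t ≤ n) where

      n≥12 : 12 ≤ n
      n≥12 = ≤-trans (*-monoʳ-≤ 12 (s≤s (z≤n {t}))) 12[1+t]≤n

      -- The origin of 12: a pair of edges has at most 4nt near conflicts, and 3 * 4nt must fit
      -- below n(n - 1), with room left for the rounding in `power-bound`.
      room : ∀ j → j ≤ t * (2 * (n + n)) → 3 * (j + 7) ≤ D
      room j j≤ = begin
        3 * (j + 7)                        ≤⟨ *-monoʳ-≤ 3 (+-monoˡ-≤ 7 j≤) ⟩
        3 * (t * (2 * (n + n)) + 7)        ≡⟨ e₁ n t ⟩
        n * (12 * t) + 21                  ≤⟨ +-monoʳ-≤ (n * (12 * t)) (≤-trans (m≤m+n 21 111) (*-monoˡ-≤ 11 n≥12)) ⟩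
        n * (12 * t) + n * 11              ≡⟨ *-distribˡ-+ n (12 * t) 11 ⟨
        n * (12 * t + 11)                  ≤⟨ *-monoʳ-≤ n (≤-trans (≤-reflexive (e₂ t)) (∸-monoˡ-≤ 1 12[1+t]≤n)) ⟩
        n * (n ∸ 1)                        ∎
        where
        open ≤-Reasoning
        e₁ : ∀ n t → 3 * (t * (2 * (n + n)) + 7) ≡ n * (12 * t) + 21
        e₁ = solve-∀
        e₂ : ∀ t → 12 * t + 11 ≡ 12 * suc t ∸ 1
        e₂ t = sym (cong (_∸ 1) (e₃ t))
          where
          e₃ : ∀ t → 12 * suc t ≡ 1 + (12 * t + 11)
          e₃ = solve-∀

      -- x / D is 1 - 3/D, the least factor that one conflict can contribute.
      x : ℕ
      x = D ∸ 3

      21≤D : 21 ≤ D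
      21≤D = room 0 z≤n

      x+3≡D : x + 3 ≡ D
      x+3≡D = m∸n+n≡m (≤-trans (m≤m+n 3 18) 21≤D)

      x≢0 : NonZero x
      x≢0 = >-nonZero (∸-monoˡ-≤ 3 (≤-trans (m≤m+n 4 17) 21≤D))

      D≢0 : NonZero D
      D≢0 = >-nonZero (≤-trans (m≤m+n 1 20) 21≤D)

      -- Induction on the number of conflicts. `pair-far` handles the far ones; putting back the j
      -- near ones costs a factor of at least (1 - 3/D)^j by the induction hypothesis, which
      -- `power-bound` keeps above 1/3, so the constant 3 reproduces itself. The recursion is on the
      -- bound `k` of the length, because `chain` runs over a rearrangement of `F` and not over its
      -- tails.
      pair-≤-below : ∀ k F → length F ≤ k → Sparse t F → Indep F → ∀ e f → NonIncident e f →
        D * N (e ∷ f ∷ []) F ≤ 3 * N [] F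
      pair-≤-below k F F≤k sparse indep e f ni =
        *-cancelʳ-≤ (D * N P F) (3 * N [] F) (x ^ j) {{m^n≢0 x j {{x≢0}}}} (begin
          D * N P F * x ^ j             ≤⟨ *-monoˡ-≤ (x ^ j) (*-monoʳ-≤ D (N-far P P F)) ⟩
          D * N P (far P F) * x ^ j     ≤⟨ *-monoˡ-≤ (x ^ j) (pair-far e f (far P F) (far-away P F) ni) ⟩
          N [] (far P F) * x ^ j        ≤⟨ chain k (near P F) (≤-trans (≤-reflexive (length-partition P F)) F≤k) (sparse-partition P F sparse) (indep-partition P F indep) ⟩
          D ^ j * N [] (near P F ++ far P F) ≤⟨ *-mono-≤ power (N-partition [] P F) ⟩
          3 * x ^ j * N [] F            ≡⟨ eq (x ^ j) (N [] F) ⟩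
          3 * N [] F * x ^ j            ∎)
        where
        open ≤-Reasoning
        P = e ∷ f ∷ []
        j = length (near P F)
        eq : ∀ a b → 3 * a * b ≡ 3 * b * a
        eq = solve-∀
        power : D ^ j ≤ 3 * x ^ j
        power = subst (λ z → z ^ j ≤ 3 * x ^ j) x+3≡D
          (power-bound x j (subst (3 * (j + 7) ≤_) (sym x+3≡D) (room j (length-near t P F sparse))))
        chain : ∀ k L → length (L ++ far P F) ≤ k → Sparse t (L ++ far P F) → Indep (L ++ far P F) →
          N [] (far P F) * x ^ length L ≤ D ^ length L * N [] (L ++ far P F)
        chain k [] _ _ _ = ≤-reflexive (trans (*-identityʳ _) (sym (*-identityˡ _)))
        chain (suc k) ((g , h) ∷ L) (s≤s l≤k) sp (gh ∷ ind) = begin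
          N [] (far P F) * (x * x ^ length L)        ≡⟨ e₁ (N [] (far P F)) x (x ^ length L) ⟩
          x * (N [] (far P F) * x ^ length L)        ≤⟨ *-monoʳ-≤ x (chain k L l≤k (sparse-tail sp) ind) ⟩
          x * (D ^ length L * N [] R)                ≡⟨ e₁ x (D ^ length L) (N [] R) ⟩
          D ^ length L * (x * N [] R)                ≤⟨ *-monoʳ-≤ (D ^ length L) step ⟩
          D ^ length L * (D * N [] ((g , h) ∷ R))    ≡⟨ e₂ (D ^ length L) D (N [] ((g , h) ∷ R)) ⟩
          D * D ^ length L * N [] ((g , h) ∷ R)      ∎
          where
          R = L ++ far P F
          e₁ : ∀ a b c → a * (b * c) ≡ b * (a * c)
          e₁ = solve-∀
          e₂ : ∀ a b c → a * (b * c) ≡ b * a * c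
          e₂ = solve-∀
          step : x * N [] R ≤ D * N [] ((g , h) ∷ R)
          step = +-cancelʳ-≤ (3 * N [] R) _ _ (begin
            x * N [] R + 3 * N [] R                               ≡⟨ *-distribʳ-+ (N [] R) x 3 ⟨
            (x + 3) * N [] R                                      ≡⟨ cong (_* N [] R) x+3≡D ⟩
            D * N [] R                                            ≡⟨ cong (D *_) (N-cons [] g h R) ⟩
            D * (N [] ((g , h) ∷ R) + N (g ∷ h ∷ []) R)           ≡⟨ *-distribˡ-+ D (N [] ((g , h) ∷ R)) _ ⟩
            D * N [] ((g , h) ∷ R) + D * N (g ∷ h ∷ []) R         ≤⟨ +-monoʳ-≤ (D * N [] ((g , h) ∷ R)) (pair-≤-below k R l≤k (sparse-tail sp) ind g h gh) ⟩
            D * N [] ((g , h) ∷ R) + 3 * N [] R                   ∎)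

      pair-≤ : ∀ F → Sparse t F → Indep F → ∀ e f → NonIncident e f → D * N (e ∷ f ∷ []) F ≤ 3 * N [] F
      pair-≤ F = pair-≤-below (length F) F ≤-refl

      -- A union bound over the near pairs, each priced by `pair-≤`. The relative loss is O(t/n),
      -- whereas in the local lemma itself it was a constant factor.
      far-≤ : ∀ P F → Sparse t F → Indep F →
        D * N [] (far P F) ≤ D * N [] F + t * (length P * (n + n)) * (3 * N [] (far P F))
      far-≤ P F sparse indep = ≤-trans
        (chain (near P F) (sparse-partition P F sparse) (indep-partition P F indep))
        (+-mono-≤ (*-monoʳ-≤ D (N-partition [] P F)) (*-monoˡ-≤ (3 * N [] (far P F)) (length-near t P F sparse)))
        where
        open ≤-Reasoning
        N₀ = N [] (far P F)
        chain : ∀ L → Sparse t (L ++ far P F) → Indep (L ++ far P F) →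
          D * N₀ ≤ D * N [] (L ++ far P F) + length L * (3 * N₀)
        chain [] _ _ = m≤m+n _ 0
        chain ((g , h) ∷ L) sp (gh ∷ ind) = begin
          D * N₀                                                     ≤⟨ chain L (sparse-tail sp) ind ⟩
          D * N [] R + length L * (3 * N₀)                           ≡⟨ cong (λ z → D * z + length L * (3 * N₀)) (N-cons [] g h R) ⟩
          D * (N [] ((g , h) ∷ R) + N (g ∷ h ∷ []) R) + length L * (3 * N₀) ≡⟨ eq D (N [] ((g , h) ∷ R)) (N (g ∷ h ∷ []) R) (length L * (3 * N₀)) ⟩
          D * N [] ((g , h) ∷ R) + (D * N (g ∷ h ∷ []) R + length L * (3 * N₀)) ≤⟨ +-monoʳ-≤ (D * N [] ((g , h) ∷ R)) (+-monoˡ-≤ (length L * (3 * N₀))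
                (≤-trans (pair-≤ R (sparse-tail sp) ind g h gh) (*-monoʳ-≤ 3 (N-mono {F = R} λ { ω (c , a) → c , All.++⁻ʳ L a })))) ⟩
          D * N [] ((g , h) ∷ R) + (3 * N₀ + length L * (3 * N₀))    ∎
          where
          R = L ++ far P F
          eq : ∀ a b c d → a * (b + c) + d ≡ a * b + (a * c + d)
          eq = solve-∀

    nonIncident-of : ∀ {ω} p x → p ∈ω ω → x ∈ω ω → x ≢ p → NonIncident p x
    nonIncident-of {ω} (u , v) (u′ , v′) p∈ x∈ x≢p =
      (λ { refl → x≢p (cong (u ,_) (trans (sym x∈) p∈)) }) ,
      (λ { refl → x≢p (cong (_, v) (σ-injective ω (trans x∈ (sym p∈)))) })

    spoilt-distinct : ∀ {u v Q g h} → Away ((u , v) ∷ Q) (g , h) → NonIncident g h →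
      All (NonIncident (u , v)) Q → DistinctRight Q →
      DistinctRight ((proj₁ g , v) ∷ (u , proj₂ g) ∷ h ∷ Q)
    spoilt-distinct (((_ , v≢g) , (_ , v≢h)) ∷ away) (_ , g≢h) freeQ dQ =
      ((v≢g ∘ sym) ∷ (v≢h ∘ sym) ∷ All.map (λ ni → proj₂ ni ∘ sym) freeQ) ∷
      ((g≢h ∘ sym) ∷ All.map (proj₂ ∘ proj₁) away) ∷
      All.map (proj₂ ∘ proj₂) away ∷ dQ

    -- Sharp conditional probabilities.

    module Sharp (t : ℕ) (100[1+t]≤n : 100 * suc t ≤ n) where

      open LocalLemma t (≤-trans (*-monoˡ-≤ (suc t) (m≤m+n 12 88)) 100[1+t]≤n)

      n≥100 : 100 ≤ n
      n≥100 = ≤-trans (*-monoʳ-≤ 100 (s≤s (z≤n {t}))) 100[1+t]≤n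

      n≢0 : NonZero n
      n≢0 = >-nonZero (≤-trans (m≤m+n 1 99) n≥100)

      48t≤n∸1 : 48 * t ≤ n ∸ 1
      48t≤n∸1 = ≤-trans (≤-trans (*-monoˡ-≤ t (m≤m+n 48 52)) (≤-trans (m≤m+n (100 * t) 99) (≤-reflexive (cong (_∸ 1) (eq t)))))
        (∸-monoˡ-≤ 1 100[1+t]≤n)
        where
        eq : ∀ t → 1 + (100 * t + 99) ≡ 100 * suc t
        eq = solve-∀

      -- Four edges have at most 8nt near pairs, and 2 * 8nt * 3 = 48nt is at most D.
      far-half : ∀ P F → length P ≤ 4 → Sparse t F → Indep F → N [] (far P F) ≤ 2 * N [] F
      far-half P F P≤4 sparse indep = *-cancelˡ-≤ D {{D≢0}} (+-cancelʳ-≤ (D * N₀) _ _ (begin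
        D * N₀ + D * N₀                              ≡⟨ e₁ (D * N₀) ⟩
        2 * (D * N₀)                                 ≤⟨ *-monoʳ-≤ 2 (far-≤ P F sparse indep) ⟩
        2 * (D * N [] F + t * (length P * (n + n)) * (3 * N₀)) ≤⟨ *-monoʳ-≤ 2 (+-monoʳ-≤ (D * N [] F) (*-monoˡ-≤ (3 * N₀) (*-monoʳ-≤ t (*-monoˡ-≤ (n + n) P≤4)))) ⟩
        2 * (D * N [] F + t * (4 * (n + n)) * (3 * N₀)) ≡⟨ e₂ D (N [] F) t n N₀ ⟩
        D * (2 * N [] F) + n * (48 * t) * N₀         ≤⟨ +-monoʳ-≤ (D * (2 * N [] F)) (*-monoˡ-≤ N₀ (*-monoʳ-≤ n 48t≤n∸1)) ⟩
        D * (2 * N [] F) + D * N₀                    ∎))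
        where
        open ≤-Reasoning
        N₀ = N [] (far P F)
        e₁ : ∀ a → a + a ≡ 2 * a
        e₁ = solve-∀
        e₂ : ∀ D N t n N₀ → 2 * (D * N + t * (4 * (n + n)) * (3 * N₀)) ≡ D * (2 * N) + n * (48 * t) * N₀
        e₂ = solve-∀

      9n≤10[n∸i] : ∀ i → i ≤ 10 → 9 * n ≤ 10 * (n ∸ i)
      9n≤10[n∸i] i i≤10 = ≤-trans (m+n≤o⇒m≤o∸n (9 * n) (begin
        9 * n + 10 * i   ≤⟨ +-monoʳ-≤ (9 * n) (≤-trans (*-monoʳ-≤ 10 i≤10) n≥100) ⟩
        9 * n + n        ≡⟨ eq n ⟩
        10 * n           ∎)) (≤-reflexive (sym (*-distribˡ-∸ 10 n i)))
        where
        open ≤-Reasoning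
        eq : ∀ n → 9 * n + n ≡ 10 * n
        eq = solve-∀

      power≤falling : ∀ r → r ≤ 10 → 9 ^ r * n ^ r ≤ 10 ^ r * falling r
      power≤falling zero    _    = ≤-refl
      power≤falling (suc r) r≤10 = begin
        9 * 9 ^ r * (n * n ^ r)                    ≡⟨ [m*n]*[o*p]≡[m*o]*[n*p] 9 (9 ^ r) n (n ^ r) ⟩
        9 * n * (9 ^ r * n ^ r)                    ≤⟨ *-mono-≤ (9n≤10[n∸i] r (≤-trans (n≤1+n r) r≤10)) (power≤falling r (≤-trans (n≤1+n r) r≤10)) ⟩
        10 * (n ∸ r) * (10 ^ r * falling r)        ≡⟨ [m*n]*[o*p]≡[m*o]*[n*p] 10 (n ∸ r) (10 ^ r) (falling r) ⟩
        10 * 10 ^ r * ((n ∸ r) * falling r)        ∎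
        where open ≤-Reasoning

      10^≤2*9^ : ∀ r → r ≤ 4 → 10 ^ r ≤ 9 ^ r * 2
      10^≤2*9^ 0 _ = m≤m+n 1 1
      10^≤2*9^ 1 _ = m≤m+n 10 8
      10^≤2*9^ 2 _ = ≤ᵇ⇒≤ 100 162 tt
      10^≤2*9^ 3 _ = ≤ᵇ⇒≤ 1000 1458 tt
      10^≤2*9^ 4 _ = ≤ᵇ⇒≤ 10000 13122 tt
      10^≤2*9^ (suc (suc (suc (suc (suc _))))) (s≤s (s≤s (s≤s (s≤s ()))))

      -- One factor 2 is lost between n^r and `falling r`, for r ≤ 4 and n ≥ 100, and another in
      -- dropping the near pairs. A constant is good enough, as these counts enter error terms only.
      few-≤ : ∀ P F → length P ≤ 4 → DistinctRight P → Sparse t F → Indep F → n ^ length P * N P F ≤ 4 * N [] F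
      few-≤ P F P≤4 distinct sparse indep = *-cancelˡ-≤ (9 ^ r) {{m^n≢0 9 r}} (begin
        9 ^ r * (n ^ r * N P F)                ≡⟨ *-assoc (9 ^ r) (n ^ r) (N P F) ⟨
        9 ^ r * n ^ r * N P F                  ≤⟨ *-mono-≤ (power≤falling r (≤-trans P≤4 (m≤m+n 4 6))) (N-far P P F) ⟩
        10 ^ r * falling r * N P (far P F)     ≡⟨ *-assoc (10 ^ r) (falling r) _ ⟩
        10 ^ r * (falling r * N P (far P F))   ≤⟨ *-mono-≤ (10^≤2*9^ r P≤4) (≤-trans (falling-≤ P (far P F) (far-away P F) distinct) (far-half P F P≤4 sparse indep)) ⟩
        9 ^ r * 2 * (2 * N [] F)               ≡⟨ eq (9 ^ r) (N [] F) ⟩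
        9 ^ r * (4 * N [] F)                   ∎)
        where
        open ≤-Reasoning
        r = length P
        eq : ∀ a b → a * 2 * (2 * b) ≡ a * (4 * b)
        eq = solve-∀

      -- There are at most tn²/2 pairs, two ways to be spoilt by each, and 3 + |Q| prescribed edges
      -- per way, so the total is at most (tn²/2) * 2 * 4 / n^(3 + |Q|) relative to `N [] F`.
      spoilt-≤ : ∀ u v Q F → length Q ≤ 1 → All (NonIncident (u , v)) Q → DistinctRight Q →
        All (Away ((u , v) ∷ Q)) F → Sparse t F → Indep F →
        n ^ suc (length Q) * ∑∈ F (spoiltBy u v Q F) ≤ 4 * t * N [] F
      spoilt-≤ u v Q F Q≤1 freeQ dQ away sparse indep =
        *-cancelˡ-≤ (2 * (n * n)) {{m*n≢0 2 (n * n) {{_}} {{m*n≢0 n n {{n≢0}} {{n≢0}}}}}} (begin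
          2 * (n * n) * (n ^ suc (length Q) * S)  ≡⟨ e₁ n (n ^ suc (length Q)) S ⟩
          2 * (n ^ (3 + length Q) * S)            ≤⟨ *-monoʳ-≤ 2 each ⟩
          2 * (length F * (8 * N [] F))           ≡⟨ e₂ (length F) (N [] F) ⟩
          length F * 2 * (8 * N [] F)             ≡⟨ cong (_* (8 * N [] F)) (∑∈-const F 2) ⟨
          ∑∈ F (λ _ → 2) * (8 * N [] F)           ≤⟨ *-monoˡ-≤ (8 * N [] F) (Sparse.weight-≤ sparse (λ _ → 1)) ⟩
          t * ∑ₑ (λ _ → 1) * (8 * N [] F)         ≡⟨ cong (λ z → t * z * (8 * N [] F)) ∑ₑ-1 ⟩
          t * (n * n) * (8 * N [] F)              ≡⟨ e₃ t n (N [] F) ⟩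
          2 * (n * n) * (4 * t * N [] F)          ∎)
        where
        open ≤-Reasoning
        S = ∑∈ F (spoiltBy u v Q F)
        e₁ : ∀ n X S → 2 * (n * n) * (X * S) ≡ 2 * (n * (n * X) * S)
        e₁ = solve-∀
        e₂ : ∀ l N → 2 * (l * (8 * N)) ≡ l * 2 * (8 * N)
        e₂ = solve-∀
        e₃ : ∀ t n N → t * (n * n) * (8 * N) ≡ 2 * (n * n) * (4 * t * N)
        e₃ = solve-∀
        e₄ : ∀ N → 4 * N + 4 * N ≡ 8 * N
        e₄ = solve-∀
        one : ∀ {g h} → Away ((u , v) ∷ Q) (g , h) → NonIncident g h →
          n ^ (3 + length Q) * spoiltBy u v Q F (g , h) ≤ 8 * N [] F
        one {g} {h} aw gh = begin
          n ^ (3 + length Q) * spoiltBy u v Q F (g , h)  ≡⟨ *-distribˡ-+ (n ^ (3 + length Q)) (N ((proj₁ g , v) ∷ (u , proj₂ g) ∷ h ∷ Q) F) _ ⟩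
          _                                              ≤⟨ +-mono-≤
              (few-≤ ((proj₁ g , v) ∷ (u , proj₂ g) ∷ h ∷ Q) F (+-monoʳ-≤ 3 Q≤1) (spoilt-distinct aw gh freeQ dQ) sparse indep)
              (few-≤ ((proj₁ h , v) ∷ (u , proj₂ h) ∷ g ∷ Q) F (+-monoʳ-≤ 3 Q≤1)
                (spoilt-distinct (All.map (λ (a , b) → b , a) aw) ((proj₁ gh ∘ sym) , (proj₂ gh ∘ sym)) freeQ dQ) sparse indep) ⟩
          4 * N [] F + 4 * N [] F                        ≡⟨ e₄ (N [] F) ⟩
          8 * N [] F                                     ∎
        each : n ^ (3 + length Q) * S ≤ length F * (8 * N [] F)
        each = ≤-trans (≤-reflexive (∑∈-*ˡ F (n ^ (3 + length Q)) (spoiltBy u v Q F)))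
          (≤-trans (∑∈-mono (All.zipWith (λ (aw , gh) → one aw gh) (away , indep)))
            (≤-reflexive (∑∈-const F (8 * N [] F))))

      -- The lower bound needs it: if {e , f} occurs in `F` already, no matching that avoids `F`
      -- contains both edges.
      Fresh : Edge n → Edge n → List Pair → Set
      Fresh e f = All (λ B → B ≢ (e , f) × B ≢ (f , e))

      module Pairs (e f : Edge n) (ef : NonIncident e f) (F : List Pair)
        (sparse : Sparse t F) (indep : Indep F) where

        open ≤-Reasoning

        P : List (Edge n)
        P = e ∷ f ∷ []

        F₂ : List Pair
        F₂ = far P F

        sparse₂ : Sparse t F₂
        sparse₂ = sparse-far P F sparse

        indep₂ : Indep F₂
        indep₂ = All.filter⁺ (away? P) indep

        N₀ : ℕ
        N₀ = N [] F₂

        N≤N₀ : N [] F ≤ N₀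
        N≤N₀ = N-far [] P F

        γ : Edge n → ℕ
        γ x = ⟦ x ≟ₑ e ⟧ + ⟦ x ≟ₑ f ⟧

        -- `few-≤` asks for distinct right ends; if `x` and `z` share theirs, no matching contains
        -- both.
        third : ∀ x y z → NonIncident y x → NonIncident y z → x ≢ z → n ^ 3 * N (x ∷ y ∷ z ∷ []) F₂ ≤ 4 * N₀
        third x y z yx yz x≢z with proj₂ x Fin.≟ proj₂ z
        ... | no xz = few-≤ (x ∷ y ∷ z ∷ []) F₂ (m≤m+n 3 1)
                ((proj₂ yx ∷ (xz ∘ sym) ∷ []) ∷ ((proj₂ yz ∘ sym) ∷ []) ∷ [] ∷ []) sparse₂ indep₂
        ... | yes e = ≤-trans (≤-reflexive (trans
                (cong (n ^ 3 *_) (N-zero {F = F₂} λ { ω (x∈ ∷ _ ∷ z∈ ∷ [] , _) →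
                  proj₂ (nonIncident-of {ω} z x z∈ x∈ x≢z) (sym e) })) (*-zeroʳ (n ^ 3)))) z≤n

        -- Distinct edges of a matching are disjoint, so a near pair can occur together with `P`
        -- only if it shares an edge with `P`. Three edges then remain, of probability O(1/n³), and
        -- `γ` records the shared edge, so that `Sparse` limits the total weight of such pairs to
        -- 2t.
        near-term : ∀ g h → ¬ Away P (g , h) → NonIncident g h → (g , h) ≢ (e , f) × (g , h) ≢ (f , e) →
          n ^ 3 * N (g ∷ h ∷ P) F₂ ≤ 4 * N₀ * (γ g + γ h)
        near-term g h ¬away gh (≢ef , ≢fe) =
          cases (toSum (g ≟ₑ e)) (toSum (g ≟ₑ f)) (toSum (h ≟ₑ e)) (toSum (h ≟ₑ f))
          where
          fe : NonIncident f e
          fe = (proj₁ ef ∘ sym) , (proj₂ ef ∘ sym)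
          hg : NonIncident h g
          hg = (proj₁ gh ∘ sym) , (proj₂ gh ∘ sym)
          by : ∀ {X} → (∀ ω → W (g ∷ h ∷ P) F₂ ω → W X F₂ ω) → n ^ 3 * N X F₂ ≤ 4 * N₀ → 1 ≤ γ g + γ h →
            n ^ 3 * N (g ∷ h ∷ P) F₂ ≤ 4 * N₀ * (γ g + γ h)
          by sub bound pos = ≤-trans (*-monoʳ-≤ (n ^ 3) (N-mono sub))
            (≤-trans bound (≤-trans (≤-reflexive (sym (*-identityʳ (4 * N₀)))) (*-monoʳ-≤ (4 * N₀) pos)))
          cases : g ≡ e ⊎ g ≢ e → g ≡ f ⊎ g ≢ f → h ≡ e ⊎ h ≢ e → h ≡ f ⊎ h ≢ f →
            n ^ 3 * N (g ∷ h ∷ P) F₂ ≤ 4 * N₀ * (γ g + γ h)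
          cases (inj₁ g≡e) _ _ _ = by (λ { ω (_ ∷ c , a) → c , a })
            (third h e f (subst (λ z → NonIncident z h) g≡e gh) ef (λ h≡f → ≢ef (cong₂ _,_ g≡e h≡f)))
            (≤-trans (≤-reflexive (sym (⟦⟧-yes (g ≟ₑ e) g≡e))) (≤-trans (m≤m+n _ ⟦ g ≟ₑ f ⟧) (m≤m+n (γ g) (γ h))))
          cases _ (inj₁ g≡f) _ _ = by (λ { ω (_ ∷ c₁ ∷ c₂ ∷ c₃ ∷ [] , a) → c₁ ∷ c₃ ∷ c₂ ∷ [] , a })
            (third h f e (subst (λ z → NonIncident z h) g≡f gh) fe (λ h≡e → ≢fe (cong₂ _,_ g≡f h≡e)))
            (≤-trans (≤-reflexive (sym (⟦⟧-yes (g ≟ₑ f) g≡f))) (≤-trans (m≤n+m _ ⟦ g ≟ₑ e ⟧) (m≤m+n (γ g) (γ h))))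
          cases _ _ (inj₁ h≡e) _ = by (λ { ω (c₀ ∷ _ ∷ c , a) → c₀ ∷ c , a })
            (third g e f (subst (λ z → NonIncident z g) h≡e hg) ef (λ g≡f → ≢fe (cong₂ _,_ g≡f h≡e)))
            (≤-trans (≤-reflexive (sym (⟦⟧-yes (h ≟ₑ e) h≡e))) (≤-trans (m≤m+n _ ⟦ h ≟ₑ f ⟧) (m≤n+m (γ h) (γ g))))
          cases _ _ _ (inj₁ h≡f) = by (λ { ω (c₀ ∷ _ ∷ c₂ ∷ c₃ ∷ [] , a) → c₀ ∷ c₃ ∷ c₂ ∷ [] , a })
            (third g f e (subst (λ z → NonIncident z g) h≡f hg) fe (λ g≡e → ≢ef (cong₂ _,_ g≡e h≡f)))
            (≤-trans (≤-reflexive (sym (⟦⟧-yes (h ≟ₑ f) h≡f))) (≤-trans (m≤n+m _ ⟦ h ≟ₑ e ⟧) (m≤n+m (γ h) (γ g))))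
          cases (inj₂ g≢e) (inj₂ g≢f) (inj₂ h≢e) (inj₂ h≢f) = ≤-trans (≤-reflexive (trans
            (cong (n ^ 3 *_) (N-zero {F = F₂} λ { ω (g∈ ∷ h∈ ∷ e∈ ∷ f∈ ∷ [] , _) → ¬away
              ((nonIncident-of {ω} e g e∈ g∈ g≢e , nonIncident-of {ω} e h e∈ h∈ h≢e) ∷
               (nonIncident-of {ω} f g f∈ g∈ g≢f , nonIncident-of {ω} f h f∈ h∈ h≢f) ∷ []) }))
            (*-zeroʳ (n ^ 3)))) z≤n

        E₃ : ℕ
        E₃ = ∑∈ (near P F) (λ (g , h) → N (g ∷ h ∷ P) F₂)

        N-near : N P F₂ ≤ N P F + E₃
        N-near = ≤-trans (chain (near P F)) (+-monoˡ-≤ E₃ (N-partition P P F))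
          where
          chain : ∀ L → N P F₂ ≤ N P (L ++ F₂) + ∑∈ L (λ (g , h) → N (g ∷ h ∷ P) F₂)
          chain [] = m≤m+n _ 0
          chain ((g , h) ∷ L) = begin
            N P F₂                                                  ≤⟨ chain L ⟩
            N P R + S                                               ≡⟨ cong (_+ S) (N-cons P g h R) ⟩
            N P ((g , h) ∷ R) + N (g ∷ h ∷ P) R + S                 ≡⟨ +-assoc (N P ((g , h) ∷ R)) _ S ⟩
            N P ((g , h) ∷ R) + (N (g ∷ h ∷ P) R + S)               ≤⟨ +-monoʳ-≤ (N P ((g , h) ∷ R)) (+-monoˡ-≤ S (N-mono {F = R} λ { ω (c , a) → c , All.++⁻ʳ L a })) ⟩
            N P ((g , h) ∷ R) + (N (g ∷ h ∷ P) F₂ + S)              ∎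
            where
            R = L ++ F₂
            S = ∑∈ L (λ (g , h) → N (g ∷ h ∷ P) F₂)

        E₃-≤ : Fresh e f F → n ^ 3 * E₃ ≤ 8 * t * N₀
        E₃-≤ fresh = begin
          n ^ 3 * E₃
            ≡⟨ ∑∈-*ˡ (near P F) (n ^ 3) (λ (g , h) → N (g ∷ h ∷ P) F₂) ⟩
          ∑∈ (near P F) (λ (g , h) → n ^ 3 * N (g ∷ h ∷ P) F₂)
            ≤⟨ ∑∈-mono (All.zipWith (λ { {g , h} (¬away , gh , fr) → near-term g h ¬away gh fr })
                (All.all-filter (¬? ∘ away? P) F , All.zip (All.filter⁺ (¬? ∘ away? P) indep , All.filter⁺ (¬? ∘ away? P) fresh))) ⟩
          ∑∈ (near P F) (λ (g , h) → 4 * N₀ * (γ g + γ h))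
            ≡⟨ ∑∈-*ˡ (near P F) (4 * N₀) (λ (g , h) → γ g + γ h) ⟨
          4 * N₀ * ∑∈ (near P F) (λ (g , h) → γ g + γ h)
            ≤⟨ *-monoʳ-≤ (4 * N₀) (≤-trans (∑∈-filter-≤ (¬? ∘ away? P) F _) (Sparse.weight-≤ sparse γ)) ⟩
          4 * N₀ * (t * ∑ₑ γ)
            ≡⟨ cong (λ z → 4 * N₀ * (t * z)) (trans (∑ₑ-+ (λ x → ⟦ x ≟ₑ e ⟧) (λ x → ⟦ x ≟ₑ f ⟧)) (cong₂ _+_ (∑ₑ-single e) (∑ₑ-single f))) ⟩
          4 * N₀ * (t * 2)
            ≡⟨ eq t N₀ ⟩
          8 * t * N₀ ∎
          where
          eq : ∀ t N → 4 * N * (t * 2) ≡ 8 * t * N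
          eq = solve-∀

        n′ : ℕ
        n′ = n ∸ 1

        1+n′≡n : suc n′ ≡ n
        1+n′≡n = m+[n∸m]≡n (≤-trans (m≤m+n 1 99) n≥100)

        -- Relative to N₀ / n, switching in `f` and then `e` loses 4t each, and restoring the near
        -- pairs loses 8t by `E₃-≤`. The sum 16t is relaxed to 24t to agree with `pair-≤-sharp`.
        pair-≥ : Fresh e f F → (n ∸ 24 * t) * N [] F ≤ n * (D * N P F)
        pair-≥ fresh = begin
          (n ∸ 24 * t) * N [] F          ≤⟨ *-mono-≤ (∸-monoʳ-≤ n (*-monoˡ-≤ t (m≤m+n 16 8))) N≤N₀ ⟩
          (n ∸ 16 * t) * N₀              ≡⟨ *-distribʳ-∸ N₀ n (16 * t) ⟩
          n * N₀ ∸ 16 * t * N₀           ≤⟨ m≤n+o⇒m∸n≤o (n * N₀) (16 * t * N₀) (≤-trans main (≤-reflexive (+-comm _ (16 * t * N₀)))) ⟩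
          n * (D * N P F)                ∎
          where
          Nf = N (f ∷ []) F₂
          Nef = N P F₂
          E₁ = ∑∈ F₂ (spoiltBy (proj₁ f) (proj₂ f) [] F₂)
          E₂ = ∑∈ F₂ (spoiltBy (proj₁ e) (proj₂ e) (f ∷ []) F₂)
          one≤ : ∀ a → rightCount (f ∷ []) a ≤ 1
          one≤ a = ≤-trans (≤-reflexive (+-identityʳ _)) (⟦⟧-≤ (proj₂ f Fin.≟ a) (λ _ → ≤-refl))
          step₁ : N₀ + 0 ≤ n * Nf + E₁
          step₁ = switch-≥ (proj₁ f) (proj₂ f) [] F₂ (All.map All.tail (far-away P F)) indep₂ [] (λ _ → z≤n)
          step₂ : Nf + 1 * Nef ≤ n * Nef + E₂
          step₂ = switch-≥ (proj₁ e) (proj₂ e) (f ∷ []) F₂ (far-away P F) indep₂ (ef ∷ []) one≤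
          e₁ : n ^ 1 * E₁ ≤ 4 * t * N₀
          e₁ = spoilt-≤ (proj₁ f) (proj₂ f) [] F₂ z≤n [] [] (All.map All.tail (far-away P F)) sparse₂ indep₂
          e₂ : n ^ 2 * E₂ ≤ 4 * t * N₀
          e₂ = spoilt-≤ (proj₁ e) (proj₂ e) (f ∷ []) F₂ ≤-refl (ef ∷ []) ([] ∷ []) (far-away P F) sparse₂ indep₂
          eq₁ : ∀ n N E → n * (n * N + E) ≡ n * n * N + n * 1 * E
          eq₁ = solve-∀
          eq₂ : ∀ k N E → (1 + k) * (1 + k) * ((1 + k) * N + E) ≡ (1 + k) * (1 + k) * k * N + (1 + k) * ((1 + k) * 1) * E + (1 + k) * (1 + k) * (1 * N)
          eq₂ = solve-∀
          eq₃ : ∀ n k N E → n * n * k * (N + E) ≡ n * (n * k * N) + n * n * k * E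
          eq₃ = solve-∀
          eq₄ : ∀ t N X → X + 8 * t * N + 4 * t * N + 4 * t * N ≡ X + 16 * t * N
          eq₄ = solve-∀
          -- Cancelling `1 * Nef` turns n into n - 1: the edge `f` already blocks one right vertex.
          step₂′ : n * n * Nf ≤ n * n * n′ * Nef + 4 * t * N₀
          step₂′ = +-cancelʳ-≤ (n * n * (1 * Nef)) _ _ (begin
            n * n * Nf + n * n * (1 * Nef)                            ≡⟨ *-distribˡ-+ (n * n) Nf (1 * Nef) ⟨
            n * n * (Nf + 1 * Nef)                                    ≤⟨ *-monoʳ-≤ (n * n) step₂ ⟩
            n * n * (n * Nef + E₂)                                    ≡⟨ subst (λ z → z * z * (z * Nef + E₂) ≡ z * z * n′ * Nef + z * (z * 1) * E₂ + z * z * (1 * Nef)) 1+n′≡n (eq₂ n′ Nef E₂) ⟩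
            n * n * n′ * Nef + n ^ 2 * E₂ + n * n * (1 * Nef)         ≤⟨ +-monoˡ-≤ (n * n * (1 * Nef)) (+-monoʳ-≤ (n * n * n′ * Nef) e₂) ⟩
            n * n * n′ * Nef + 4 * t * N₀ + n * n * (1 * Nef)         ∎)
          step₃ : n * n * n′ * Nef ≤ n * (D * N P F) + 8 * t * N₀
          step₃ = begin
            n * n * n′ * Nef                          ≤⟨ *-monoʳ-≤ (n * n * n′) N-near ⟩
            n * n * n′ * (N P F + E₃)                 ≡⟨ eq₃ n n′ (N P F) E₃ ⟩
            n * (D * N P F) + n * n * n′ * E₃         ≤⟨ +-monoʳ-≤ (n * (D * N P F)) (≤-trans (*-monoˡ-≤ E₃ cube) (E₃-≤ fresh)) ⟩
            n * (D * N P F) + 8 * t * N₀              ∎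
            where
            cube : n * n * n′ ≤ n ^ 3
            cube = ≤-trans (*-monoʳ-≤ (n * n) (m∸n≤m n 1)) (≤-reflexive (eq n))
              where
              eq : ∀ n → n * n * n ≡ n * (n * (n * 1))
              eq = solve-∀
          main : n * N₀ ≤ n * (D * N P F) + 16 * t * N₀
          main = begin
            n * N₀                                    ≤⟨ *-monoʳ-≤ n (≤-trans (≤-reflexive (sym (+-identityʳ N₀))) step₁) ⟩
            n * (n * Nf + E₁)                         ≡⟨ eq₁ n Nf E₁ ⟩
            n * n * Nf + n ^ 1 * E₁                   ≤⟨ +-mono-≤ (≤-trans step₂′ (+-monoˡ-≤ (4 * t * N₀) step₃)) e₁ ⟩
            n * (D * N P F) + 8 * t * N₀ + 4 * t * N₀ + 4 * t * N₀ ≡⟨ eq₄ t N₀ (n * (D * N P F)) ⟩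
            n * (D * N P F) + 16 * t * N₀             ∎

        -- For the far conflicts `pair-far` has no error at all. Returning from N₀ to `N [] F` costs
        -- 12t/(n - 1) by `far-≤` with two edges, which is at most 24t/n.
        pair-≤-sharp : (n ∸ 24 * t) * (D * N P F) ≤ n * N [] F
        pair-≤-sharp = begin
          (n ∸ 24 * t) * (D * N P F)     ≤⟨ *-monoʳ-≤ (n ∸ 24 * t) (≤-trans (*-monoʳ-≤ D (N-far P P F)) (pair-far e f F₂ (far-away P F) ef)) ⟩
          (n ∸ 24 * t) * N₀              ≡⟨ *-distribʳ-∸ N₀ n (24 * t) ⟩
          n * N₀ ∸ 24 * t * N₀           ≤⟨ m≤n+o⇒m∸n≤o (n * N₀) (24 * t * N₀) (≤-trans main (≤-reflexive (+-comm _ (24 * t * N₀)))) ⟩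
          n * N [] F                     ∎
          where
          d = N₀ ∸ N [] F
          N₀≡ : N₀ ≡ N [] F + d
          N₀≡ = sym (m+[n∸m]≡n N≤N₀)
          eq₁ : ∀ n k N d → n * (k * N + k * d) ≡ n * k * (N + d)
          eq₁ = solve-∀
          eq₂ : ∀ n k N t N₀ → n * k * N + t * (2 * (n + n)) * (3 * N₀) ≡ n * (k * N + 12 * t * N₀)
          eq₂ = solve-∀
          d≤ : n′ * d ≤ 12 * t * N₀
          d≤ = +-cancelˡ-≤ (n′ * N [] F) _ _ (*-cancelˡ-≤ n {{n≢0}} (begin
            n * (n′ * N [] F + n′ * d)                            ≡⟨ eq₁ n n′ (N [] F) d ⟩
            n * n′ * (N [] F + d)                                 ≡⟨ cong (D *_) N₀≡ ⟨
            D * N₀                                                ≤⟨ far-≤ P F sparse indep ⟩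
            D * N [] F + t * (2 * (n + n)) * (3 * N₀)             ≡⟨ eq₂ n n′ (N [] F) t N₀ ⟩
            n * (n′ * N [] F + 12 * t * N₀)                       ∎))
          n≤2n′ : n ≤ 2 * n′
          n≤2n′ = begin
            n          ≡⟨ 1+n′≡n ⟨
            1 + n′     ≤⟨ +-monoˡ-≤ n′ (≤-trans (m≤m+n 1 98) (∸-monoˡ-≤ 1 n≥100)) ⟩
            n′ + n′    ≡⟨ cong (n′ +_) (+-identityʳ n′) ⟨
            2 * n′     ∎
          main : n * N₀ ≤ n * N [] F + 24 * t * N₀
          main = begin
            n * N₀                          ≡⟨ cong (n *_) N₀≡ ⟩
            n * (N [] F + d)                ≡⟨ *-distribˡ-+ n (N [] F) d ⟩
            n * N [] F + n * d              ≤⟨ +-monoʳ-≤ (n * N [] F) (*-monoˡ-≤ d n≤2n′) ⟩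
            n * N [] F + 2 * n′ * d         ≡⟨ cong (n * N [] F +_) (*-assoc 2 n′ d) ⟩
            n * N [] F + 2 * (n′ * d)       ≤⟨ +-monoʳ-≤ (n * N [] F) (*-monoʳ-≤ 2 d≤) ⟩
            n * N [] F + 2 * (12 * t * N₀)  ≡⟨ cong (n * N [] F +_) (eq₃ t N₀) ⟩
            n * N [] F + 24 * t * N₀        ∎
            where
            eq₃ : ∀ t N → 2 * (12 * t * N) ≡ 24 * t * N
            eq₃ = solve-∀

  -- Lists without repetition, their sublists and pairs.

  module _ {A : Set} where

    AllPairs-lookup : ∀ {R : A → A → Set} {xs x y} → (∀ {x y} → R x y → R y x) → AllPairs R xs →
      x ∈ xs → y ∈ xs → x ≡ y ⊎ R x y
    AllPairs-lookup R-sym (r ∷ rs) (here refl) (here refl) = inj₁ refl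
    AllPairs-lookup R-sym (r ∷ rs) (here refl) (there y∈)  = inj₂ (All.lookup r y∈)
    AllPairs-lookup R-sym (r ∷ rs) (there x∈)  (here refl) = inj₂ (R-sym (All.lookup r x∈))
    AllPairs-lookup R-sym (r ∷ rs) (there x∈)  (there y∈)  = AllPairs-lookup R-sym rs x∈ y∈

    AllPairs-map∈ : ∀ {R S : A → A → Set} {xs} → AllPairs R xs → (∀ {x y} → x ∈ xs → y ∈ xs → R x y → S x y) →
      AllPairs S xs
    AllPairs-map∈ []       f = []
    AllPairs-map∈ (r ∷ rs) f = All.tabulate (λ y∈ → f (here refl) (there y∈) (All.lookup r y∈)) ∷
      AllPairs-map∈ rs (λ x∈ y∈ → f (there x∈) (there y∈))

    lookup-injective : ∀ {xs : List A} → Unique xs → ∀ i j → lookup xs i ≡ lookup xs j → i ≡ j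
    lookup-injective (x≢ ∷ u) zero    zero    e = refl
    lookup-injective (x≢ ∷ u) zero    (suc j) e = contradiction e (All.lookup x≢ (∈-lookup j))
    lookup-injective (x≢ ∷ u) (suc i) zero    e = contradiction (sym e) (All.lookup x≢ (∈-lookup i))
    lookup-injective (x≢ ∷ u) (suc i) (suc j) e = cong suc (lookup-injective u i j e)

    module _ {P : A → Set} (P? : Decidable P) where

      ∑∈-filter : ∀ xs (f : A → ℕ) → ∑∈ (filter P? xs) f ≡ ∑∈ xs (λ x → ⟦ P? x ⟧ * f x)
      ∑∈-filter [] f = refl
      ∑∈-filter (x ∷ xs) f with P? x
      ... | yes _ = cong₂ _+_ (sym (+-identityʳ (f x))) (∑∈-filter xs f)
      ... | no  _ = ∑∈-filter xs f

      length-filter-∑∈ : ∀ xs → length (filter P? xs) ≡ ∑∈ xs (λ x → ⟦ P? x ⟧)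
      length-filter-∑∈ xs = trans (sym (trans (∑∈-const (filter P? xs) 1) (*-identityʳ _)))
        (trans (∑∈-filter xs (λ _ → 1)) (∑∈-cong xs λ x → *-identityʳ ⟦ P? x ⟧))

    ∑∈-lookup : ∀ xs (f : A → ℕ) → ∑∈ xs f ≡ sum (λ i → f (lookup xs i))
    ∑∈-lookup []       f = refl
    ∑∈-lookup (x ∷ xs) f = cong (f x +_) (∑∈-lookup xs f)

    ∑∈-tabulate : ∀ {n} (h : Fin n → A) (f : A → ℕ) → ∑∈ (tabulate h) f ≡ sum (f ∘ h)
    ∑∈-tabulate {zero}  h f = refl
    ∑∈-tabulate {suc n} h f = cong (f (h zero) +_) (∑∈-tabulate (h ∘ suc) f)

    ∑∈-map : ∀ {B : Set} (h : B → A) xs (f : A → ℕ) → ∑∈ (map h xs) f ≡ ∑∈ xs (f ∘ h)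
    ∑∈-map h []       f = refl
    ∑∈-map h (x ∷ xs) f = cong (f (h x) +_) (∑∈-map h xs f)

    ∑∈-mono∈ : ∀ xs {f g : A → ℕ} → (∀ {x} → x ∈ xs → f x ≤ g x) → ∑∈ xs f ≤ ∑∈ xs g
    ∑∈-mono∈ xs h = ∑∈-mono (All.tabulate h)

    subset-∈ : ∀ {xs ys : List A} {x} → ys ∈ subsets xs → x ∈ ys → x ∈ xs
    subset-∈ {[]} (here refl) ()
    subset-∈ {x₀ ∷ xs} ys∈ x∈ with ∈-++⁻ (map (x₀ ∷_) (subsets xs)) ys∈
    ... | inj₂ ys∈′ = there (subset-∈ ys∈′ x∈)
    ... | inj₁ ys∈′ with ∈-map⁻ (x₀ ∷_) ys∈′
    ...   | zs , zs∈ , refl with x∈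
    ...     | here refl = here refl
    ...     | there x∈′ = there (subset-∈ zs∈ x∈′)

    filter-∈-subsets : ∀ {P : A → Set} (P? : Decidable P) xs → filter P? xs ∈ subsets xs
    filter-∈-subsets P? [] = here refl
    filter-∈-subsets P? (x ∷ xs) with P? x
    ... | yes _ = ∈-++⁺ˡ (∈-map⁺ (x ∷_) (filter-∈-subsets P? xs))
    ... | no  _ = ∈-++⁺ʳ (map (x ∷_) (subsets xs)) (filter-∈-subsets P? xs)

    subsets-unique : ∀ {xs : List A} → Unique xs → Unique (subsets xs)
    subsets-unique [] = [] ∷ []
    subsets-unique {x ∷ xs} (x∉ ∷ u) = Unique.++⁺ (Unique.map⁺ (λ { refl → refl }) (subsets-unique u)) (subsets-unique u) disjoint
      where
      disjoint : Disjoint (map (x ∷_) (subsets xs)) (subsets xs)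
      disjoint (v∈ , v∈′) with ∈-map⁻ (x ∷_) v∈
      ... | zs , _ , refl = All.lookup x∉ (subset-∈ v∈′ (here refl)) refl

    -- Sublists inherit the order of `xs`, so their members determine them.
    subset-ext : ∀ {xs ys zs : List A} → Unique xs → ys ∈ subsets xs → zs ∈ subsets xs →
      (∀ {x} → x ∈ ys → x ∈ zs) → (∀ {x} → x ∈ zs → x ∈ ys) → ys ≡ zs
    subset-ext {[]} _ (here refl) (here refl) _ _ = refl
    subset-ext {x ∷ xs} (x∉ ∷ u) ys∈ zs∈ ⊆ ⊇ with ∈-++⁻ (map (x ∷_) (subsets xs)) ys∈ | ∈-++⁻ (map (x ∷_) (subsets xs)) zs∈
    ... | inj₂ ys∈′ | inj₂ zs∈′ = subset-ext u ys∈′ zs∈′ ⊆ ⊇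
    ... | inj₁ ys∈′ | inj₂ zs∈′ with ∈-map⁻ (x ∷_) ys∈′
    ...   | _ , _ , refl = contradiction refl (All.lookup x∉ (subset-∈ zs∈′ (⊆ (here refl))))
    subset-ext {x ∷ xs} (x∉ ∷ u) ys∈ zs∈ ⊆ ⊇ | inj₂ ys∈′ | inj₁ zs∈′ with ∈-map⁻ (x ∷_) zs∈′
    ...   | _ , _ , refl = contradiction refl (All.lookup x∉ (subset-∈ ys∈′ (⊇ (here refl))))
    subset-ext {x ∷ xs} (x∉ ∷ u) ys∈ zs∈ ⊆ ⊇ | inj₁ ys∈′ | inj₁ zs∈′ with ∈-map⁻ (x ∷_) ys∈′ | ∈-map⁻ (x ∷_) zs∈′
    ...   | as , as∈ , refl | bs , bs∈ , refl = cong (x ∷_) (subset-ext u as∈ bs∈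
            (λ y∈ → drop (subset-∈ as∈ y∈) (⊆ (there y∈))) (λ y∈ → drop (subset-∈ bs∈ y∈) (⊇ (there y∈))))
      where
      drop : ∀ {y ys} → y ∈ xs → y ∈ x ∷ ys → y ∈ ys
      drop y∈xs (here refl) = contradiction refl (All.lookup x∉ y∈xs)
      drop _    (there y∈)  = y∈

  module _ {A : Set} where

    pairs-complete : ∀ {xs : List A} {x y} → x ∈ xs → y ∈ xs → x ≢ y → (x , y) ∈ pairs xs ⊎ (y , x) ∈ pairs xs
    pairs-complete (here refl) (here refl) x≢y = contradiction refl x≢y
    pairs-complete (here refl) (there y∈)  x≢y = inj₁ (∈-++⁺ˡ (∈-map⁺ (_ ,_) y∈))
    pairs-complete (there x∈)  (here refl) x≢y = inj₂ (∈-++⁺ˡ (∈-map⁺ (_ ,_) x∈))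
    pairs-complete {z ∷ xs} (there x∈) (there y∈) x≢y =
      [ inj₁ ∘ ∈-++⁺ʳ (map (z ,_) xs) , inj₂ ∘ ∈-++⁺ʳ (map (z ,_) xs) ]′ (pairs-complete x∈ y∈ x≢y)

    ∈-pairs : ∀ {xs : List A} {x y} → (x , y) ∈ pairs xs → x ∈ xs × y ∈ xs
    ∈-pairs {z ∷ xs} p∈ with ∈-++⁻ (map (z ,_) xs) p∈
    ... | inj₂ p∈′ = there (proj₁ (∈-pairs p∈′)) , there (proj₂ (∈-pairs p∈′))
    ... | inj₁ p∈′ with ∈-map⁻ (z ,_) p∈′
    ...   | _ , y∈ , refl = here refl , there y∈

    DistinctPairs : A × A → A × A → Set
    DistinctPairs B C = C ≢ B × C ≢ swap B

    -- The source of `Fresh`: an unordered pair is listed once, in only one of its two orders.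
    pairs-distinct : ∀ {xs : List A} → Unique xs → AllPairs DistinctPairs (pairs xs)
    pairs-distinct [] = []
    pairs-distinct {x ∷ xs} (x∉ ∷ u) = AllPairs.++⁺
      (AllPairs.map⁺ (AllPairs-map∈ u λ _ z∈ y≢z → (λ { refl → y≢z refl }) , (λ { refl → All.lookup x∉ z∈ refl })))
      (pairs-distinct u)
      (All.map⁺ (All.tabulate λ y∈ → All.tabulate λ p∈ →
        (λ { refl → All.lookup x∉ (proj₁ (∈-pairs p∈)) refl }) , (λ { refl → All.lookup x∉ (proj₂ (∈-pairs p∈)) refl })))

    -- The double sum meets every unordered pair in both orders; only the diagonal is dropped.
    ∑∈-pairs : ∀ xs (ψ : A → A → ℕ) → ∑∈ (pairs xs) (λ (x , y) → ψ x y + ψ y x) ≤ ∑∈ xs (λ x → ∑∈ xs (ψ x))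
    ∑∈-pairs []       ψ = z≤n
    ∑∈-pairs (x ∷ xs) ψ = begin
      ∑∈ (map (x ,_) xs ++ pairs xs) (λ (x , y) → ψ x y + ψ y x)
        ≡⟨ trans (∑∈-++ (map (x ,_) xs) (pairs xs) _) (cong (_+ S) (trans (∑∈-map (x ,_) xs _) (∑∈-+ xs (ψ x) (λ y → ψ y x)))) ⟩
      ∑∈ xs (ψ x) + ∑∈ xs (λ y → ψ y x) + S
        ≤⟨ +-monoʳ-≤ (∑∈ xs (ψ x) + ∑∈ xs (λ y → ψ y x)) (∑∈-pairs xs ψ) ⟩
      ∑∈ xs (ψ x) + ∑∈ xs (λ y → ψ y x) + ∑∈ xs (λ y → ∑∈ xs (ψ y))
        ≤⟨ m≤n+m _ (ψ x x) ⟩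
      ψ x x + (∑∈ xs (ψ x) + ∑∈ xs (λ y → ψ y x) + ∑∈ xs (λ y → ∑∈ xs (ψ y)))
        ≡⟨ eq (ψ x x) _ _ _ ⟩
      ψ x x + ∑∈ xs (ψ x) + (∑∈ xs (λ y → ψ y x) + ∑∈ xs (λ y → ∑∈ xs (ψ y)))
        ≡⟨ cong (ψ x x + ∑∈ xs (ψ x) +_) (∑∈-+ xs (λ y → ψ y x) (λ y → ∑∈ xs (ψ y))) ⟨
      ψ x x + ∑∈ xs (ψ x) + ∑∈ xs (λ y → ψ y x + ∑∈ xs (ψ y)) ∎
      where
      open ≤-Reasoning
      S = ∑∈ (pairs xs) (λ (x , y) → ψ x y + ψ y x)
      eq : ∀ a b c d → a + (b + c + d) ≡ a + b + (c + d)
      eq = solve-∀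

  -- Perfect matchings as permutations.

  module Matchings (n : ℕ) where

    Ω : List (List (Edge n))
    Ω = perfectMatchings n

    m : ℕ
    m = length Ω

    edges-unique : Unique (edges n)
    edges-unique = Unique.cartesianProduct⁺ (Unique.allFin⁺ n) (Unique.allFin⁺ n)

    ∈-edges : ∀ e → e ∈ edges n
    ∈-edges (u , v) = ∈-cartesianProduct⁺ (∈-allFin u) (∈-allFin v)

    nonIncident-sym : ∀ {e f : Edge n} → NonIncident e f → NonIncident f e
    nonIncident-sym (a , b) = (a ∘ sym) , (b ∘ sym)

    M : Fin m → List (Edge n)
    M = lookup Ω

    M-subset : ∀ i → M i ∈ subsets (edges n)
    M-subset i = proj₁ (∈-filter⁻ perfectMatching? {xs = subsets (edges n)} (∈-lookup {xs = Ω} i))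

    M-perfect : ∀ i → PerfectMatching (M i)
    M-perfect i = proj₂ (∈-filter⁻ perfectMatching? {xs = subsets (edges n)} (∈-lookup {xs = Ω} i))

    partner : ∀ i u → ∃[ v ] (u , v) ∈ M i
    partner i u with ∈-map⁻ proj₁ (PerfectMatching.coversLeft (M-perfect i) u)
    ... | (_ , v) , e∈ , refl = v , e∈

    σ : Fin m → Fin n → Fin n
    σ i u = proj₁ (partner i u)

    M-related : ∀ i {e f} → e ∈ M i → f ∈ M i → e ≡ f ⊎ NonIncident e f
    M-related i = AllPairs-lookup nonIncident-sym (PerfectMatching.independent (M-perfect i))

    ∈M⇒σ : ∀ i {u v} → (u , v) ∈ M i → σ i u ≡ v
    ∈M⇒σ i {u} {v} e∈ with M-related i (proj₂ (partner i u)) e∈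
    ... | inj₁ e        = cong proj₂ e
    ... | inj₂ (≢ , _)  = contradiction refl ≢

    σ⇒∈M : ∀ i {u v} → σ i u ≡ v → (u , v) ∈ M i
    σ⇒∈M i {u} refl = proj₂ (partner i u)

    σ-injective : ∀ i {u u′} → σ i u ≡ σ i u′ → u ≡ u′
    σ-injective i {u} {u′} e with M-related i (σ⇒∈M i e) (σ⇒∈M i {u′} refl)
    ... | inj₁ e′      = cong proj₁ e′
    ... | inj₂ (_ , ≢) = contradiction refl ≢

    σ-surjective : ∀ i v → ∃[ u ] σ i u ≡ v
    σ-surjective i v with ∈-map⁻ proj₂ (PerfectMatching.coversRight (M-perfect i) v)
    ... | (u , _) , e∈ , refl = u , ∈M⇒σ i e∈

    -- Makes `T v a` a bijection of the indices, so that sums over all matchings can be reindexed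
    -- along it.
    σ-ext : ∀ i j → (∀ u → σ i u ≡ σ j u) → i ≡ j
    σ-ext i j h = lookup-injective (Unique.filter⁺ perfectMatching? (subsets-unique edges-unique)) i j
      (subset-ext edges-unique (M-subset i) (M-subset j)
        (λ { {u , v} e∈ → σ⇒∈M j (trans (sym (h u)) (∈M⇒σ i e∈)) })
        (λ { {u , v} e∈ → σ⇒∈M i (trans (h u) (∈M⇒σ j e∈)) }))

    module _ (τ : Fin n → Fin n) (τ-injective : ∀ {u u′} → τ u ≡ τ u′ → u ≡ u′) (τ-surjective : ∀ v → ∃[ u ] τ u ≡ v) where

      on-graph? : Decidable (λ ((u , v) : Edge n) → τ u ≡ v)
      on-graph? (u , v) = τ u Fin.≟ v

      -- Filtering `edges n` lists the graph of τ in the order used by `subsets`, so it is literally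
      -- an entry of `Ω`.
      graph : List (Edge n)
      graph = filter on-graph? (edges n)

      ∈-graph : ∀ u → (u , τ u) ∈ graph
      ∈-graph u = ∈-filter⁺ on-graph? (∈-edges (u , τ u)) refl

      graph-∈ : graph ∈ Ω
      graph-∈ = ∈-filter⁺ perfectMatching? (filter-∈-subsets on-graph? (edges n)) (perfectMatching
        (AllPairs-map∈ (Unique.filter⁺ on-graph? edges-unique) λ {x} {y} x∈ y∈ x≢y →
          independent x y (proj₂ (∈-filter⁻ on-graph? {xs = edges n} x∈)) (proj₂ (∈-filter⁻ on-graph? {xs = edges n} y∈)) x≢y)
        (λ u → ∈-map⁺ proj₁ (∈-graph u))
        (λ v → let (u , e) = τ-surjective v in subst (_∈ map proj₂ graph) e (∈-map⁺ proj₂ (∈-graph u))))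
        where
        independent : ∀ x y → τ (proj₁ x) ≡ proj₂ x → τ (proj₁ y) ≡ proj₂ y → x ≢ y → NonIncident x y
        independent (u , _) (u′ , _) refl refl x≢y =
          (λ { refl → x≢y refl }) , (λ e → x≢y (cong₂ _,_ (τ-injective e) e))

      index : Fin m
      index = Any.index graph-∈

      σ-index : ∀ u → σ index u ≡ τ u
      σ-index u = ∈M⇒σ index (subst ((u , τ u) ∈_) (lookup-index graph-∈) (∈-graph u))

    transpose-injective : ∀ v a {x y : Fin n} → transpose v a x ≡ transpose v a y → x ≡ y
    transpose-injective v a e =
      trans (sym (transpose-inverse a v)) (trans (cong (transpose a v) e) (transpose-inverse a v))

    module _ (v a : Fin n) (i : Fin m) where

      τ-injective : ∀ {u u′} → transpose v a (σ i u) ≡ transpose v a (σ i u′) → u ≡ u′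
      τ-injective = σ-injective i ∘ transpose-injective v a

      τ-surjective : ∀ w → ∃[ u ] transpose v a (σ i u) ≡ w
      τ-surjective w = let (u , e) = σ-surjective i (transpose a v w) in
        u , trans (cong (transpose v a) e) (transpose-inverse v a)

      T : Fin m
      T = index (transpose v a ∘ σ i) τ-injective τ-surjective

      σ-T : ∀ u → σ T u ≡ transpose v a (σ i u)
      σ-T = σ-index (transpose v a ∘ σ i) τ-injective τ-surjective

    T-inverse : ∀ v a i → T v a (T a v i) ≡ i
    T-inverse v a i = σ-ext (T v a (T a v i)) i λ u → trans (σ-T v a (T a v i) u)
      (trans (cong (transpose v a) (σ-T a v i u)) (transpose-inverse v a))

    sum-T : ∀ v a (f : Fin m → ℕ) → sum f ≡ sum (f ∘ T v a)
    sum-T v a f = sum-permute f (permutation (T v a) (T a v) (T-inverse v a) (T-inverse a v))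

    m-pos : 1 ≤ m
    m-pos = ≤-trans (s≤s z≤n) (Fin.toℕ<n (index id id (λ v → v , refl)))

    open Switching n m σ σ-injective T σ-T sum-T public

    ∑∈-edges : ∀ φ → ∑∈ (edges n) φ ≡ ∑ₑ φ
    ∑∈-edges φ = trans (product (allFin n)) (∑∈-tabulate id (λ u → sum (λ v → φ (u , v))))
      where
      product : ∀ us → ∑∈ (cartesianProductWith _,_ us (allFin n)) φ ≡ ∑∈ us (λ u → sum (λ v → φ (u , v)))
      product []       = refl
      product (u ∷ us) = trans (∑∈-++ (map (u ,_) (allFin n)) _ φ)
        (cong₂ _+_ (trans (∑∈-map (u ,_) (allFin n) φ) (∑∈-tabulate id (λ v → φ (u , v)))) (product us))

    N-empty : N [] [] ≡ m
    N-empty = trans (sum-const m 1) (*-identityʳ m)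

    -- The conflicts of a colouring.

    module Colour (χ : Colouring n) where

      conflict? : (B : Edge n × Edge n) → Dec (NonIncident (proj₁ B) (proj₂ B) × χ (proj₁ B) ≡ χ (proj₂ B))
      conflict? (e , f) = nonIncident? e f ×-dec (χ e ≟ χ f)

      F : List (Edge n × Edge n)
      F = conflicts χ

      ∈F : ∀ {e f} → (e , f) ∈ F → NonIncident e f × χ e ≡ χ f
      ∈F B∈ = proj₂ (∈-filter⁻ conflict? {xs = pairs (edges n)} B∈)

      rainbow⇒avoids : ∀ i → Rainbow χ (M i) → All (AvoidsPair i) F
      rainbow⇒avoids i rainbow = All.tabulate λ { {g , h} B∈ (g∈ , h∈) →
        let (ni , same) = ∈F B∈ in
        [ (λ g≡h → proj₁ ni (cong proj₁ g≡h)) , (λ ≢ → ≢ same) ]′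
          (AllPairs-lookup (λ r → r ∘ sym) rainbow (σ⇒∈M i g∈) (σ⇒∈M i h∈)) }

      avoids⇒rainbow : ∀ i → All (AvoidsPair i) F → Rainbow χ (M i)
      avoids⇒rainbow i avoids = AllPairs-map∈ (PerfectMatching.independent (M-perfect i)) λ {e} {f} e∈ f∈ ni same →
        [ (λ p∈ → All.lookup avoids (∈-filter⁺ conflict? p∈ (ni , same)) (∈M⇒σ i e∈ , ∈M⇒σ i f∈))
        , (λ p∈ → All.lookup avoids (∈-filter⁺ conflict? p∈ (nonIncident-sym ni , sym same)) (∈M⇒σ i f∈ , ∈M⇒σ i e∈))
        ]′ (pairs-complete (∈-edges e) (∈-edges f) (proj₁ ni ∘ cong proj₁))

      rainbow-count : length (filter (rainbow? χ) Ω) ≡ N [] F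
      rainbow-count = trans (length-filter-∑∈ (rainbow? χ) Ω) (trans (∑∈-lookup Ω (λ ω → ⟦ rainbow? χ ω ⟧))
        (sum-cong-≗ λ i → ⟦⟧-cong (rainbow? χ (M i)) (W? [] F i)
          (λ r → [] , rainbow⇒avoids i r) (λ (_ , a) → avoids⇒rainbow i a)))

      F-indep : Indep F
      F-indep = All.map proj₁ (All.all-filter conflict? (pairs (edges n)))

      F-distinct : AllPairs DistinctPairs F
      F-distinct = AllPairs.filter⁺ conflict? (pairs-distinct edges-unique)

      -- An edge takes one of the at most t + 1 places in its own colour class (`itself`), which
      -- leaves at most t edges to conflict with it.
      F-sparse : ∀ t → (∀ c → colourCount χ c ≤ suc t) → Sparse t F
      F-sparse t few = mkSparse λ φ → begin
        ∑∈ F (λ (g , h) → φ g + φ h)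
          ≡⟨ ∑∈-filter conflict? (pairs (edges n)) _ ⟩
        ∑∈ (pairs (edges n)) (λ (g , h) → ⟦ conflict? (g , h) ⟧ * (φ g + φ h))
          ≡⟨ ∑∈-cong (pairs (edges n)) (λ (g , h) → trans (*-distribˡ-+ ⟦ conflict? (g , h) ⟧ (φ g) (φ h))
              (cong₂ _+_ (*-comm ⟦ conflict? (g , h) ⟧ (φ g)) (trans (*-comm ⟦ conflict? (g , h) ⟧ (φ h)) (cong (φ h *_) (conflict-sym g h))))) ⟩
        ∑∈ (pairs (edges n)) (λ (g , h) → φ g * ⟦ conflict? (g , h) ⟧ + φ h * ⟦ conflict? (h , g) ⟧)
          ≤⟨ ∑∈-pairs (edges n) (λ g h → φ g * ⟦ conflict? (g , h) ⟧) ⟩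
        ∑∈ (edges n) (λ g → ∑∈ (edges n) (λ h → φ g * ⟦ conflict? (g , h) ⟧))
          ≤⟨ ∑∈-mono∈ (edges n) (λ {g} _ → ≤-trans (≤-reflexive (sym (∑∈-*ˡ (edges n) (φ g) _))) (*-monoʳ-≤ (φ g) (degree g))) ⟩
        ∑∈ (edges n) (λ g → φ g * t)
          ≡⟨ trans (sym (∑∈-*ʳ (edges n) t φ)) (trans (*-comm (∑∈ (edges n) φ) t) (cong (t *_) (∑∈-edges φ))) ⟩
        t * ∑ₑ φ ∎
        where
        open ≤-Reasoning
        conflict-sym : ∀ g h → ⟦ conflict? (g , h) ⟧ ≡ ⟦ conflict? (h , g) ⟧
        conflict-sym g h = ⟦⟧-cong (conflict? (g , h)) (conflict? (h , g))
          (λ (a , b) → nonIncident-sym a , sym b) (λ (a , b) → nonIncident-sym a , sym b)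
        itself : ∀ g → 1 ≤ ∑∈ (edges n) (λ h → ⟦ g ≟ₑ h ⟧)
        itself g = ∑∈-any (Any.map (λ {h} e → ≤-reflexive (sym (⟦⟧-yes (g ≟ₑ h) e))) (∈-edges g))
        degree : ∀ g → ∑∈ (edges n) (λ h → ⟦ conflict? (g , h) ⟧) ≤ t
        degree g = ≤-pred (begin
          1 + ∑∈ (edges n) (λ h → ⟦ conflict? (g , h) ⟧)
            ≤⟨ +-monoˡ-≤ _ (itself g) ⟩
          ∑∈ (edges n) (λ h → ⟦ g ≟ₑ h ⟧) + ∑∈ (edges n) (λ h → ⟦ conflict? (g , h) ⟧)
            ≡⟨ ∑∈-+ (edges n) (λ h → ⟦ g ≟ₑ h ⟧) (λ h → ⟦ conflict? (g , h) ⟧) ⟨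
          ∑∈ (edges n) (λ h → ⟦ g ≟ₑ h ⟧ + ⟦ conflict? (g , h) ⟧)
            ≤⟨ ∑∈-mono∈ (edges n) (λ {h} _ → same h) ⟩
          ∑∈ (edges n) (λ h → ⟦ χ h ≟ χ g ⟧)
            ≡⟨ length-filter-∑∈ (λ e → χ e ≟ χ g) (edges n) ⟨
          colourCount χ (χ g)
            ≤⟨ few (χ g) ⟩
          suc t ∎)
          where
          same : ∀ h → ⟦ g ≟ₑ h ⟧ + ⟦ conflict? (g , h) ⟧ ≤ ⟦ χ h ≟ χ g ⟧
          same h with g ≟ₑ h
          ... | no _     = ⟦⟧-mono (conflict? (g , h)) (χ h ≟ χ g) (sym ∘ proj₂)
          ... | yes refl = ≤-reflexive (trans
            (cong suc (⟦⟧-no (conflict? (g , g)) (λ c → proj₁ (proj₁ c) refl)))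
            (sym (⟦⟧-yes (χ g ≟ χ g) refl)))

open Counting using (module Matchings; DistinctPairs; ∑∈-const)
open import Data.Rational.Base using (ℚ; 0ℚ; 1ℚ; ½; _+_; _*_; _-_; -_; _≤_; _<_; nonNegative; positive)
  renaming (∣_∣ to ∣_∣ℚ)
open import Data.Rational.Properties
open import Data.Rational.Solver using (module +-*-Solver)
open +-*-Solver

-- Inequalities between rationals.

≤⇒0≤- : ∀ {a b} → a ≤ b → 0ℚ ≤ b - a
≤⇒0≤- {a} {b} a≤b = subst (_≤ b - a) (+-inverseʳ a) (+-monoˡ-≤ (- a) a≤b)

-- For use with the ring solver: `c` displays b - a as an expression that is visibly nonnegative.
≤-cert : ∀ {a b c} → 0ℚ ≤ c → b - a ≡ c → a ≤ b
≤-cert {a} {b} {c} 0≤c e = subst₂ _≤_ (+-identityˡ a)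
  (trans (cong (_+ a) (sym e)) (solve 2 (λ a b → b :- a :+ a := b) refl a b)) (+-monoˡ-≤ a 0≤c)

0≤1 : 0ℚ ≤ 1ℚ
0≤1 = <⇒≤ (positive⁻¹ 1ℚ)

*-monoˡ : ∀ {a b c} → 0ℚ ≤ a → b ≤ c → a * b ≤ a * c
*-monoˡ {a} 0≤a = *-monoˡ-≤-nonNeg a {{nonNegative 0≤a}}

*-monoʳ : ∀ {a b c} → 0ℚ ≤ a → b ≤ c → b * a ≤ c * a
*-monoʳ {a} 0≤a = *-monoʳ-≤-nonNeg a {{nonNegative 0≤a}}

*-cancelʳ : ∀ {a b c} → 0ℚ < a → b * a ≤ c * a → b ≤ c
*-cancelʳ {a} 0<a = *-cancelʳ-≤-pos a {{positive 0<a}}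

fromℕ-suc : ∀ n → fromℕ (suc n) ≡ 1ℚ + fromℕ n
fromℕ-suc n = /-suc n 0

fromℕ-+ : ∀ m n → fromℕ (m ℕ.+ n) ≡ fromℕ m + fromℕ n
fromℕ-+ zero    n = sym (+-identityˡ _)
fromℕ-+ (suc m) n = trans (fromℕ-suc (m ℕ.+ n)) (trans (cong (1ℚ +_) (fromℕ-+ m n))
  (trans (sym (+-assoc 1ℚ (fromℕ m) (fromℕ n))) (cong (_+ fromℕ n) (sym (fromℕ-suc m)))))

fromℕ-* : ∀ m n → fromℕ (m ℕ.* n) ≡ fromℕ m * fromℕ n
fromℕ-* zero    n = sym (*-zeroˡ (fromℕ n))
fromℕ-* (suc m) n = trans (fromℕ-+ n (m ℕ.* n)) (trans (cong (λ z → fromℕ n + z) (fromℕ-* m n))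
  (trans (solve 2 (λ a b → b :+ a :* b := (con 1ℚ :+ a) :* b) refl (fromℕ m) (fromℕ n))
    (cong (_* fromℕ n) (sym (fromℕ-suc m)))))

-- Truncations of the exponential series.

∑< : ℕ → (ℕ → ℚ) → ℚ
∑< zero    f = 0ℚ
∑< (suc n) f = ∑< n f + f n

∑<-cong : ∀ n {f g} → (∀ i → i ℕ.< n → f i ≡ g i) → ∑< n f ≡ ∑< n g
∑<-cong zero    h = refl
∑<-cong (suc n) h = cong₂ _+_ (∑<-cong n (λ i i<n → h i (ℕ.m≤n⇒m≤1+n i<n))) (h n ℕ.≤-refl)

∑<-mono : ∀ n {f g} → (∀ i → i ℕ.< n → f i ≤ g i) → ∑< n f ≤ ∑< n g
∑<-mono zero    h = ≤-refl
∑<-mono (suc n) h = +-mono-≤ (∑<-mono n (λ i i<n → h i (ℕ.m≤n⇒m≤1+n i<n))) (h n ℕ.≤-refl)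

∑<-+ : ∀ n f g → ∑< n (λ i → f i + g i) ≡ ∑< n f + ∑< n g
∑<-+ zero    f g = refl
∑<-+ (suc n) f g = trans (cong (_+ (f n + g n)) (∑<-+ n f g))
  (solve 4 (λ a b c d → (a :+ b) :+ (c :+ d) := (a :+ c) :+ (b :+ d)) refl (∑< n f) (∑< n g) (f n) (g n))

∑<-*ˡ : ∀ n c f → c * ∑< n f ≡ ∑< n (λ i → c * f i)
∑<-*ˡ zero    c f = *-zeroʳ c
∑<-*ˡ (suc n) c f = trans (*-distribˡ-+ c (∑< n f) (f n)) (cong (_+ c * f n) (∑<-*ˡ n c f))

∑<-head : ∀ n f → ∑< (suc n) f ≡ f 0 + ∑< n (λ i → f (suc i))
∑<-head zero    f = +-comm 0ℚ (f 0)
∑<-head (suc n) f = trans (cong (_+ f (suc n)) (∑<-head n f)) (+-assoc (f 0) _ (f (suc n)))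

∣∑<∣≤ : ∀ n f → ∣ ∑< n f ∣ℚ ≤ ∑< n (λ i → ∣ f i ∣ℚ)
∣∑<∣≤ zero    f = ≤-refl
∣∑<∣≤ (suc n) f = ≤-trans (∣p+q∣≤∣p∣+∣q∣ (∑< n f) (f n)) (+-monoˡ-≤ ∣ f n ∣ℚ (∣∑<∣≤ n f))

expSum-∑< : ∀ n p → expSum n p ≡ ∑< n (λ i → expTerm i p)
expSum-∑< zero    p = refl
expSum-∑< (suc n) p = cong (_+ expTerm n p) (expSum-∑< n p)

expTerm-suc : ∀ i p → fromℕ (suc i) * expTerm (suc i) p ≡ p * expTerm i p
expTerm-suc i p = trans
  (solve 4 (λ s t p r → s :* (t :* p :* r) := (s :* r) :* (p :* t)) refl (fromℕ (suc i)) (expTerm i p) p (1/suc i))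
  (trans (cong (_* (p * expTerm i p)) (suc*1/suc i)) (*-identityˡ _))

-- The m-th term of the Cauchy product of the series at p and at q.
conv : ℕ → ℚ → ℚ → ℚ
conv m p q = ∑< (suc m) (λ i → expTerm i p * expTerm (m ℕ.∸ i) q)

-- Write m + 1 as i + (m + 1 - i) and let each part cancel against one factorial: the differential
-- equation of e^(px) e^(qx), in place of binomial coefficients.
conv-suc : ∀ m p q → fromℕ (suc m) * conv (suc m) p q ≡ (p + q) * conv m p q
conv-suc m p q = trans (∑<-*ˡ (suc (suc m)) (fromℕ (suc m)) _)
  (trans (∑<-cong (suc (suc m)) split)
  (trans (∑<-+ (suc (suc m)) g h)
  (trans (cong₂ _+_ gsum hsum) (sym (*-distribʳ-+ (conv m p q) p q)))))
  where
  g h c : ℕ → ℚ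
  g i = (fromℕ i * expTerm i p) * expTerm (suc m ℕ.∸ i) q
  h i = expTerm i p * (fromℕ (suc m ℕ.∸ i) * expTerm (suc m ℕ.∸ i) q)
  c i = expTerm i p * expTerm (m ℕ.∸ i) q
  split : ∀ i → i ℕ.< suc (suc m) → fromℕ (suc m) * (expTerm i p * expTerm (suc m ℕ.∸ i) q) ≡ g i + h i
  split i (s≤s i≤) = trans
    (cong (_* (expTerm i p * expTerm (suc m ℕ.∸ i) q))
      (trans (cong fromℕ (sym (ℕ.m+[n∸m]≡n i≤))) (fromℕ-+ i (suc m ℕ.∸ i))))
    (solve 4 (λ a b x y → (a :+ b) :* (x :* y) := (a :* x) :* y :+ x :* (b :* y)) refl
      (fromℕ i) (fromℕ (suc m ℕ.∸ i)) (expTerm i p) (expTerm (suc m ℕ.∸ i) q))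
  gsum : ∑< (suc (suc m)) g ≡ p * conv m p q
  gsum = trans (∑<-head (suc m) g) (trans
    (cong₂ _+_ (trans (cong (_* expTerm (suc m) q) (*-zeroˡ 1ℚ)) (*-zeroˡ (expTerm (suc m) q)))
      (∑<-cong (suc m) (λ i _ → trans (cong (_* expTerm (m ℕ.∸ i) q) (expTerm-suc i p))
        (*-assoc p (expTerm i p) (expTerm (m ℕ.∸ i) q)))))
    (trans (+-identityˡ _) (sym (∑<-*ˡ (suc m) p c))))
  hterm : ∀ i → i ℕ.< suc m → h i ≡ q * c i
  hterm i (s≤s i≤) rewrite ℕ.+-∸-assoc 1 i≤ = trans
    (cong (expTerm i p *_) (expTerm-suc (m ℕ.∸ i) q))
    (solve 3 (λ a q b → a :* (q :* b) := q :* (a :* b)) refl (expTerm i p) q (expTerm (m ℕ.∸ i) q))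
  hsum : ∑< (suc (suc m)) h ≡ q * conv m p q
  hsum = trans (cong₂ _+_
      (trans (∑<-cong (suc m) hterm) (sym (∑<-*ˡ (suc m) q c)))
      (trans (cong (λ z → expTerm (suc m) p * (fromℕ z * expTerm z q)) (ℕ.n∸n≡0 (suc m)))
        (trans (cong (expTerm (suc m) p *_) (*-zeroˡ 1ℚ)) (*-zeroʳ (expTerm (suc m) p)))))
    (+-identityʳ _)

expTerm-+ : ∀ m p q → expTerm m (p + q) ≡ conv m p q
expTerm-+ zero    p q = refl
expTerm-+ (suc m) p q = trans
  (trans (cong (λ z → z * (p + q) * 1/suc m) (expTerm-+ m p q))
    (cong (_* 1/suc m) (trans (*-comm (conv m p q) (p + q)) (sym (conv-suc m p q)))))
  (trans (solve 3 (λ s c r → s :* c :* r := (s :* r) :* c) refl (fromℕ (suc m)) (conv (suc m) p q) (1/suc m))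
    (trans (cong (_* conv (suc m) p q) (suc*1/suc m)) (*-identityˡ _)))

-- The products run over the triangle i + j < n, in `expSum-*` over a rectangle; the
-- multiplicativity estimates compare these index sets.
expSum-+ : ∀ n p q → expSum n (p + q) ≡ ∑< n (λ i → expTerm i p * expSum (n ℕ.∸ i) q)
expSum-+ zero    p q = refl
expSum-+ (suc n) p q = trans (cong₂ _+_ ih (expTerm-+ n p q))
  (trans (sym (∑<-+ (suc n) _ _)) (∑<-cong (suc n) step))
  where
  ih : expSum n (p + q) ≡ ∑< (suc n) (λ i → expTerm i p * expSum (n ℕ.∸ i) q)
  ih = trans (expSum-+ n p q) (sym (trans
    (cong (λ z → ∑< n (λ i → expTerm i p * expSum (n ℕ.∸ i) q) + expTerm n p * expSum z q) (ℕ.n∸n≡0 n))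
    (trans (cong (∑< n (λ i → expTerm i p * expSum (n ℕ.∸ i) q) +_) (*-zeroʳ (expTerm n p))) (+-identityʳ _))))
  step : ∀ i → i ℕ.< suc n →
    expTerm i p * expSum (n ℕ.∸ i) q + expTerm i p * expTerm (n ℕ.∸ i) q ≡ expTerm i p * expSum (suc n ℕ.∸ i) q
  step i (s≤s i≤) rewrite ℕ.+-∸-assoc 1 i≤ = sym (*-distribˡ-+ (expTerm i p) (expSum (n ℕ.∸ i) q) (expTerm (n ℕ.∸ i) q))

expSum-* : ∀ a b p q → expSum a p * expSum b q ≡ ∑< a (λ i → expTerm i p * expSum b q)
expSum-* a b p q = trans (*-comm (expSum a p) (expSum b q)) (trans (cong (expSum b q *_) (expSum-∑< a p))
  (trans (∑<-*ˡ a (expSum b q) _) (∑<-cong a (λ i _ → *-comm (expSum b q) (expTerm i p)))))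

≤+ : ∀ {a b} → 0ℚ ≤ b → a ≤ a + b
≤+ {a} 0≤b = subst (_≤ a + _) (+-identityʳ a) (+-monoʳ-≤ a 0≤b)

expTerm-mono : ∀ i {p q} → 0ℚ ≤ p → p ≤ q → expTerm i p ≤ expTerm i q
expTerm-mono i {p} {q} 0≤p p≤q = subst (_≤ expTerm i q) (0≤p⇒∣p∣≡p (0≤expTerm 0≤p i))
  (∣expTerm∣≤ (≤-trans 0≤p p≤q) i (subst (_≤ q) (sym (0≤p⇒∣p∣≡p 0≤p)) p≤q))

expSum-mono : ∀ n {p q} → 0ℚ ≤ p → p ≤ q → expSum n p ≤ expSum n q
expSum-mono zero    0≤p p≤q = ≤-refl
expSum-mono (suc n) 0≤p p≤q = +-mono-≤ (expSum-mono n 0≤p p≤q) (expTerm-mono n 0≤p p≤q)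

module _ {p : ℚ} (0≤p : 0ℚ ≤ p) where

  0≤expSum : ∀ n → 0ℚ ≤ expSum n p
  0≤expSum zero    = ≤-refl
  0≤expSum (suc n) = 0≤+ (0≤expSum n) (0≤expTerm 0≤p n)

  expSum-+ˡ : ∀ d n → expSum n p ≤ expSum (d ℕ.+ n) p
  expSum-+ˡ zero    n = ≤-refl
  expSum-+ˡ (suc d) n = ≤-trans (expSum-+ˡ d n) (≤+ (0≤expTerm 0≤p (d ℕ.+ n)))

  expSum-monoˡ : ∀ {m n} → m ℕ.≤ n → expSum m p ≤ expSum n p
  expSum-monoˡ {m} {n} m≤n = subst (λ k → expSum m p ≤ expSum k p) (ℕ.m∸n+n≡m m≤n) (expSum-+ˡ (n ℕ.∸ m) m)

  1+≤expSum : ∀ n → 1ℚ + p ≤ expSum (2 ℕ.+ n) p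
  1+≤expSum n = ≤-trans
    (≤-reflexive (solve 1 (λ p → con 1ℚ :+ p := con 0ℚ :+ con 1ℚ :+ con 1ℚ :* p :* con 1ℚ) refl p))
    (expSum-monoˡ {2} {2 ℕ.+ n} (ℕ.m≤m+n 2 n))

  -- Each term is at most p times the preceding one, as in a geometric series; `bound` carries the
  -- next term along as the remainder.
  expSum-geometric : p ≤ 1ℚ → ∀ n → expSum n p * (1ℚ - p) ≤ 1ℚ
  expSum-geometric p≤1 n = ≤-trans (≤+ (0≤expTerm 0≤p n)) (bound n)
    where
    bound : ∀ n → expSum n p * (1ℚ - p) + expTerm n p ≤ 1ℚ
    bound zero    = ≤-reflexive (trans (cong (_+ 1ℚ) (*-zeroˡ (1ℚ - p))) (+-identityˡ 1ℚ))
    bound (suc n) = ≤-trans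
      (≤-trans (+-monoʳ-≤ ((expSum n p + expTerm n p) * (1ℚ - p))
          (≤-trans (*-monoˡ (0≤* (0≤expTerm 0≤p n) 0≤p) (1/suc-anti {0} {n} z≤n))
            (≤-reflexive (*-identityʳ _))))
        (≤-reflexive (solve 3 (λ S t p → (S :+ t) :* (con 1ℚ :- p) :+ t :* p := S :* (con 1ℚ :- p) :+ t) refl
          (expSum n p) (expTerm n p) p)))
      (bound n)

-- The triangle i + j < n lies in the n by n square.
expSum-+-≤ : ∀ n {p q} → 0ℚ ≤ p → 0ℚ ≤ q → expSum n (p + q) ≤ expSum n p * expSum n q
expSum-+-≤ n {p} {q} 0≤p 0≤q = subst₂ _≤_ (sym (expSum-+ n p q)) (sym (expSum-* n n p q))
  (∑<-mono n (λ i _ → *-monoˡ (0≤expTerm 0≤p i) (expSum-monoˡ 0≤q (ℕ.m∸n≤m n i))))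

-- The a by b rectangle lies in the triangle i + j < a + b.
expSum-*-≤ : ∀ a b {p q} → 0ℚ ≤ p → 0ℚ ≤ q → expSum a p * expSum b q ≤ expSum (a ℕ.+ b) (p + q)
expSum-*-≤ a b {p} {q} 0≤p 0≤q = subst₂ _≤_ (sym (expSum-* a b p q)) (sym (expSum-+ (a ℕ.+ b) p q))
  (≤-trans
    (∑<-mono a (λ i i<a → *-monoˡ (0≤expTerm 0≤p i)
      (expSum-monoˡ 0≤q (subst (b ℕ.≤_) (sym (ℕ.+-∸-comm b (ℕ.<⇒≤ i<a))) (ℕ.m≤n+m b (a ℕ.∸ i))))))
    (∑<-monoˡ b))
  where
  f : ℕ → ℚ
  f i = expTerm i p * expSum (a ℕ.+ b ℕ.∸ i) q
  ∑<-monoˡ : ∀ d → ∑< a f ≤ ∑< (a ℕ.+ d) f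
  ∑<-monoˡ zero    = ≤-reflexive (cong (λ k → ∑< k f) (sym (ℕ.+-identityʳ a)))
  ∑<-monoˡ (suc d) = subst (λ k → ∑< a f ≤ ∑< k f) (sym (ℕ.+-suc a d))
    (≤-trans (∑<-monoˡ d) (≤+ (0≤* (0≤expTerm 0≤p (a ℕ.+ d)) (0≤expSum 0≤q (a ℕ.+ b ℕ.∸ (a ℕ.+ d))))))

expSum-0 : ∀ n → expSum (suc n) 0ℚ ≡ 1ℚ
expSum-0 zero    = refl
expSum-0 (suc n) = trans (cong (expSum (suc n) 0ℚ +_)
    (trans (cong (_* 1/suc n) (*-zeroʳ (expTerm n 0ℚ))) (*-zeroˡ (1/suc n))))
  (trans (+-identityʳ _) (expSum-0 n))

∣-∣≤ : ∀ {p b} → 0ℚ ≤ p → p ≤ b → ∣ - p ∣ℚ ≤ b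
∣-∣≤ {p} 0≤p p≤b = subst (_≤ _) (sym (trans (∣-p∣≡∣p∣ p) (0≤p⇒∣p∣≡p 0≤p))) p≤b

∣∣≤ : ∀ {p b} → 0ℚ ≤ p → p ≤ b → ∣ p ∣ℚ ≤ b
∣∣≤ {p} 0≤p p≤b = subst (_≤ _) (sym (0≤p⇒∣p∣≡p 0≤p)) p≤b

-- In the product of the series at -p and p, the triangle contributes `expSum N 0ℚ`, which is 1. The
-- rest of the square is bounded by the same products at p and p, which lie in the triangle of size
-- 2N and outside that of size N.
expSum-inverse-≤ : ∀ n {p} → 0ℚ ≤ p →
  ∣ expSum (suc n) (- p) * expSum (suc n) p - 1ℚ ∣ℚ
    ≤ expSum (suc n ℕ.+ suc n) (p + p) - expSum (suc n) (p + p)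
expSum-inverse-≤ n {p} 0≤p = begin
  ∣ expSum N (- p) * expSum N p - 1ℚ ∣ℚ
    ≡⟨ cong ∣_∣ℚ (trans (cong₂ _-_ (expSum-* N N (- p) p) one) (∑<-- N _ _)) ⟩
  ∣ ∑< N (λ i → expTerm i (- p) * expSum N p - expTerm i (- p) * expSum (N ℕ.∸ i) p) ∣ℚ
    ≤⟨ ∣∑<∣≤ N _ ⟩
  ∑< N (λ i → ∣ expTerm i (- p) * expSum N p - expTerm i (- p) * expSum (N ℕ.∸ i) p ∣ℚ)
    ≤⟨ ∑<-mono N (λ i _ → term i) ⟩
  ∑< N (λ i → expTerm i p * expSum N p - expTerm i p * expSum (N ℕ.∸ i) p)
    ≡⟨ trans (cong₂ _-_ (expSum-* N N p p) (expSum-+ N p p)) (∑<-- N _ _) ⟨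
  expSum N p * expSum N p - expSum N (p + p)
    ≤⟨ +-monoˡ-≤ (- expSum N (p + p)) (expSum-*-≤ N N 0≤p 0≤p) ⟩
  expSum (N ℕ.+ N) (p + p) - expSum N (p + p) ∎
  where
  open ≤-Reasoning
  N = suc n
  one : 1ℚ ≡ ∑< N (λ i → expTerm i (- p) * expSum (N ℕ.∸ i) p)
  one = trans (sym (expSum-0 n)) (trans (cong (expSum N) (sym (+-inverseˡ p))) (expSum-+ N (- p) p))
  ∑<-- : ∀ n f g → ∑< n f - ∑< n g ≡ ∑< n (λ i → f i - g i)
  ∑<-- zero    f g = refl
  ∑<-- (suc n) f g = trans
    (solve 4 (λ a b c d → (a :+ b) :- (c :+ d) := (a :- c) :+ (b :- d)) refl (∑< n f) (f n) (∑< n g) (g n))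
    (cong (_+ (f n - g n)) (∑<-- n f g))
  term : ∀ i → ∣ expTerm i (- p) * expSum N p - expTerm i (- p) * expSum (N ℕ.∸ i) p ∣ℚ
    ≤ expTerm i p * expSum N p - expTerm i p * expSum (N ℕ.∸ i) p
  term i = subst₂ _≤_
    (trans (sym (∣p*q∣≡∣p∣*∣q∣ (expTerm i (- p)) D)) (cong ∣_∣ℚ (dist (expTerm i (- p)) (expSum N p) (expSum (N ℕ.∸ i) p))))
    (trans (cong (expTerm i p *_) (0≤p⇒∣p∣≡p 0≤D)) (dist (expTerm i p) (expSum N p) (expSum (N ℕ.∸ i) p)))
    (*-monoʳ (0≤∣p∣ D) (∣expTerm∣≤ 0≤p i (∣-∣≤ 0≤p ≤-refl)))
    where
    D = expSum N p - expSum (N ℕ.∸ i) p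
    0≤D : 0ℚ ≤ D
    0≤D = ≤⇒0≤- (expSum-monoˡ 0≤p (ℕ.m∸n≤m N i))
    dist : ∀ e a b → e * (a - b) ≡ e * a - e * b
    dist = solve 3 (λ e a b → e :* (a :- b) := e :* a :- e :* b) refl

p≤∣p∣ : ∀ p → p ≤ ∣ p ∣ℚ
p≤∣p∣ p with ≤-total 0ℚ p
... | inj₁ 0≤p = ≤-reflexive (sym (0≤p⇒∣p∣≡p 0≤p))
... | inj₂ p≤0 = ≤-trans p≤0 (0≤∣p∣ p)

module _ {b : ℚ} (0≤b : 0ℚ ≤ b) where

  expSum-close : ∀ ε → 0ℚ < ε → ∃[ N ] (∀ m n → N ℕ.≤ m → N ℕ.≤ n → ∀ q → ∣ q ∣ℚ ≤ b → ∣ expSum m q - expSum n q ∣ℚ ≤ ε)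
  expSum-close ε 0<ε =
    let (N , h) = expSum-tail-small 0≤b (½ * ε) (0<½* 0<ε)
    in N , λ m n m≥ n≥ q q≤ → ≤-trans (∣-∣-triangle (expSum m q) (expSum N q) (expSum n q))
      (≤-trans (+-mono-≤ (h m m≥ q q≤) (subst (_≤ ½ * ε) (∣-∣-sym (expSum n q) (expSum N q)) (h n n≥ q q≤)))
        (≤-reflexive (½*+½* ε)))

  expSum-inverse : ∀ ε → 0ℚ < ε →
    ∃[ N ] (∀ n → N ℕ.≤ n → ∀ p → 0ℚ ≤ p → p ≤ b → ∣ expSum n (- p) * expSum n p - 1ℚ ∣ℚ ≤ ε)
  expSum-inverse ε 0<ε =
    let (N , h) = expSum-small (0≤+ 0≤b 0≤b) (½ * ε) (0<½* 0<ε)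
    in suc N , λ { (suc n) (s≤s N≤n) p 0≤p p≤b →
      let M = suc n
          0≤2p = 0≤+ 0≤p 0≤p
          N≤M = ℕ.m≤n⇒m≤1+n N≤n
          K = M ℕ.+ M
          tail : expSum K (p + p) - expSum N (p + p) ≤ ½ * ε
          tail = ≤-trans (≤-trans (p≤∣p∣ _) (subst (λ k → ∣ expSum k (p + p) - expSum N (p + p) ∣ℚ ≤ expSum k (b + b) - expSum N (b + b))
              (ℕ.m∸n+n≡m (ℕ.≤-trans N≤M (ℕ.m≤m+n M M)))
              (expSum-tail (0≤+ 0≤b 0≤b) N (K ℕ.∸ N) (∣∣≤ 0≤2p (+-mono-≤ p≤b p≤b)))))
            (subst (λ k → expSum k (b + b) - expSum N (b + b) ≤ ½ * ε) (ℕ.m∸n+n≡m (ℕ.≤-trans N≤M (ℕ.m≤m+n M M))) (h (K ℕ.∸ N)))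
      in ≤-trans (expSum-inverse-≤ n 0≤p)
        (≤-trans (+-monoʳ-≤ (expSum K (p + p)) (neg-antimono-≤ (expSum-monoˡ 0≤2p N≤M)))
          (≤-trans tail (≤-trans (≤+ (<⇒≤ (0<½* 0<ε))) (≤-reflexive (½*+½* ε))))) }

-- exp s ≤ 1/c ≤ exp t, hence s ≤ t.
expSum-reflect : ∀ {s t c} L → 0ℚ ≤ s → 0ℚ ≤ t → 0ℚ ≤ c →
  (∀ n → expSum n s * c ≤ 1ℚ) → 1ℚ ≤ expSum L t * c → s ≤ t
expSum-reflect {s} {t} {c} L 0≤s 0≤t 0≤c upper lower = ≮⇒≥ λ t<s →
  let d  = s - t
      0<d : 0ℚ < d
      0<d = subst (_< d) (+-inverseʳ t) (+-monoˡ-< (- t) t<s)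
      -- If t < s, two further terms already give e^s ≥ e^t (1 + d), which exceeds 1/c.
      e≤ : expSum L t * (1ℚ + d) ≤ expSum (L ℕ.+ 2) s
      e≤ = ≤-trans (*-monoˡ (0≤expSum 0≤t L) (1+≤expSum (<⇒≤ 0<d) 0))
        (≤-trans (expSum-*-≤ L 2 0≤t (<⇒≤ 0<d)) (≤-reflexive (cong (expSum (L ℕ.+ 2))
          (solve 2 (λ s t → t :+ (s :- t) := s) refl s t))))
      bad : 1ℚ + d ≤ 1ℚ
      bad = ≤-trans
        (≤-trans (≤-reflexive (sym (*-identityˡ (1ℚ + d))))
          (*-monoʳ (0≤+ 0≤1 (<⇒≤ 0<d)) lower))
        (≤-trans (≤-reflexive (solve 3 (λ e c u → e :* c :* u := e :* u :* c) refl (expSum L t) c (1ℚ + d)))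
          (≤-trans (*-monoʳ 0≤c e≤) (upper (L ℕ.+ 2))))
  in <-irrefl refl (<-≤-trans (subst (_< 1ℚ + d) (+-identityʳ 1ℚ) (+-monoʳ-< 1ℚ 0<d)) bad)

∣expSum-neg∣≤ : ∀ n {p} → 0ℚ ≤ p → ∣ expSum n (- p) ∣ℚ ≤ expSum n p
∣expSum-neg∣≤ n {p} 0≤p = subst₂ _≤_ (cong ∣_∣ℚ (sym (expSum-∑< n (- p)))) (sym (expSum-∑< n p))
  (≤-trans (∣∑<∣≤ n (λ i → expTerm i (- p))) (∑<-mono n (λ i _ → ∣expTerm∣≤ 0≤p i (∣-∣≤ 0≤p ≤-refl))))

-- Logarithms of fractions from harmonic sums.

module Harmonic (B′ : ℕ) where

  lower upper : ℕ → ℚ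
  lower l = ∑< l (λ i → 1/suc (suc B′ ℕ.+ i))
  upper l = ∑< l (λ i → 1/suc (B′ ℕ.+ i))

  0≤lower : ∀ l → 0ℚ ≤ lower l
  0≤lower zero    = ≤-refl
  0≤lower (suc l) = 0≤+ (0≤lower l) (<⇒≤ (0<1/suc (suc B′ ℕ.+ l)))

  0≤upper : ∀ l → 0ℚ ≤ upper l
  0≤upper zero    = ≤-refl
  0≤upper (suc l) = 0≤+ (0≤upper l) (<⇒≤ (0<1/suc (B′ ℕ.+ l)))

  telescope : ∀ l → upper l + 1/suc (B′ ℕ.+ l) ≡ lower l + 1/suc B′
  telescope zero    = cong (λ k → 0ℚ + 1/suc k) (ℕ.+-identityʳ B′)
  telescope (suc l) = trans (cong₂ _+_ (telescope l) (cong 1/suc (ℕ.+-suc B′ l)))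
    (solve 3 (λ a b c → a :+ b :+ c := a :+ c :+ b) refl (lower l) (1/suc B′) (1/suc (suc B′ ℕ.+ l)))

  upper≤lower : ∀ l → upper l ≤ lower l + 1/suc B′
  upper≤lower l = ≤-trans (≤+ (<⇒≤ (0<1/suc (B′ ℕ.+ l)))) (≤-reflexive (telescope l))

  -- 1/(i+1) ≤ log ((i+1)/i) ≤ 1/i, summed over B ≤ i < B + l.
  exp-lower : ∀ k l → expSum k (lower l) * fromℕ (suc B′) ≤ fromℕ (suc B′ ℕ.+ l)
  exp-lower k zero = ≤-trans (*-monoʳ (0≤fromℕ (suc B′))
      (≤-trans (expSum-monoˡ ≤-refl (ℕ.n≤1+n k)) (≤-reflexive (expSum-0 k))))
    (≤-reflexive (trans (*-identityˡ _) (cong fromℕ (sym (ℕ.+-identityʳ (suc B′))))))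
  exp-lower k (suc l) = begin
    expSum k (lower l + w) * fromℕ (suc B′)         ≤⟨ *-monoʳ (0≤fromℕ (suc B′)) (expSum-+-≤ k (0≤lower l) 0≤w) ⟩
    expSum k (lower l) * expSum k w * fromℕ (suc B′) ≡⟨ solve 3 (λ a b c → a :* b :* c := a :* c :* b) refl (expSum k (lower l)) (expSum k w) (fromℕ (suc B′)) ⟩
    expSum k (lower l) * fromℕ (suc B′) * expSum k w ≤⟨ *-monoʳ (0≤expSum 0≤w k) (exp-lower k l) ⟩
    fromℕ X * expSum k w                            ≡⟨ cong (_* expSum k w) X≡ ⟩
    fromℕ (suc X) * (1ℚ - w) * expSum k w           ≡⟨ solve 3 (λ a b c → a :* b :* c := a :* (c :* b)) refl (fromℕ (suc X)) (1ℚ - w) (expSum k w) ⟩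
    fromℕ (suc X) * (expSum k w * (1ℚ - w))         ≤⟨ *-monoˡ (0≤fromℕ (suc X)) (expSum-geometric 0≤w (1/suc-anti {0} {X} z≤n) k) ⟩
    fromℕ (suc X) * 1ℚ                              ≡⟨ trans (*-identityʳ _) (cong fromℕ (sym (ℕ.+-suc (suc B′) l))) ⟩
    fromℕ (suc B′ ℕ.+ suc l)                        ∎
    where
    open ≤-Reasoning
    X = suc B′ ℕ.+ l
    w = 1/suc X
    0≤w = <⇒≤ (0<1/suc X)
    X≡ : fromℕ X ≡ fromℕ (suc X) * (1ℚ - w)
    X≡ = sym (trans (solve 2 (λ s w → s :* (con 1ℚ :- w) := s :- s :* w) refl (fromℕ (suc X)) w)
      (trans (cong₂ (λ a b → a - b) (fromℕ-suc X) (suc*1/suc X))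
        (solve 1 (λ x → con 1ℚ :+ x :- con 1ℚ := x) refl (fromℕ X))))

  -- 1 + w is the two-term truncation of e^w, so the index of the truncation grows by 2 with every
  -- factor.
  exp-upper : ∀ l → ∃[ L ] fromℕ (suc B′ ℕ.+ l) ≤ expSum L (upper l) * fromℕ (suc B′)
  exp-upper zero = 1 , ≤-reflexive (trans (cong fromℕ (ℕ.+-identityʳ (suc B′))) (sym (*-identityˡ _)))
  exp-upper (suc l) = let (L , h) = exp-upper l in L ℕ.+ 2 , (begin
    fromℕ (suc B′ ℕ.+ suc l)                         ≡⟨ trans (cong fromℕ (ℕ.+-suc (suc B′) l)) X≡ ⟩
    fromℕ X * (1ℚ + w)                               ≤⟨ *-monoʳ (0≤+ 0≤1 0≤w) h ⟩
    expSum L (upper l) * fromℕ (suc B′) * (1ℚ + w)   ≡⟨ solve 3 (λ a b c → a :* b :* c := a :* c :* b) refl (expSum L (upper l)) (fromℕ (suc B′)) (1ℚ + w) ⟩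
    expSum L (upper l) * (1ℚ + w) * fromℕ (suc B′)   ≤⟨ *-monoʳ (0≤fromℕ (suc B′)) (≤-trans (*-monoˡ (0≤expSum (0≤upper l) L) (1+≤expSum 0≤w 0)) (expSum-*-≤ L 2 (0≤upper l) 0≤w)) ⟩
    expSum (L ℕ.+ 2) (upper l + w) * fromℕ (suc B′)  ∎)
    where
    open ≤-Reasoning
    X = suc B′ ℕ.+ l
    w = 1/suc (B′ ℕ.+ l)
    0≤w = <⇒≤ (0<1/suc (B′ ℕ.+ l))
    X≡ : fromℕ (suc X) ≡ fromℕ X * (1ℚ + w)
    X≡ = sym (trans (*-distribˡ-+ (fromℕ X) 1ℚ w)
      (trans (cong₂ _+_ (*-identityʳ (fromℕ X)) (suc*1/suc (B′ ℕ.+ l)))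
        (trans (+-comm (fromℕ X) 1ℚ) (sym (fromℕ-suc X)))))

-- A sequence converging to - log p, for 0 < p ≤ 1.
record LogSeq (p : ℚ) : Set where
  field
    H       : ℕ → ℚ
    0≤H     : ∀ j → 0ℚ ≤ H j
    exp-H≤  : ∀ j k → expSum k (H j) * p ≤ 1ℚ
    exp-H≥  : ∀ j → ∃[ L ] 1ℚ ≤ expSum L (H j + 1/suc j) * p

module _ {p : ℚ} (0≤p : 0ℚ ≤ p) (log : LogSeq p) where
  open LogSeq log

  0≤H+ : ∀ j → 0ℚ ≤ H j + 1/suc j
  0≤H+ j = 0≤+ (0≤H j) (<⇒≤ (0<1/suc j))

  below-H : ∀ {s} → 0ℚ ≤ s → (∀ k → expSum k s * p ≤ 1ℚ) → ∀ j → s ≤ H j + 1/suc j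
  below-H 0≤s h j = let (L , hL) = exp-H≥ j in expSum-reflect L 0≤s (0≤H+ j) 0≤p h hL

  above-H : ∀ {t} L → 0ℚ ≤ t → 1ℚ ≤ expSum L t * p → ∀ j → H j ≤ t
  above-H L 0≤t h j = expSum-reflect L (0≤H j) 0≤t 0≤p (exp-H≤ j) h

  H-cauchy : Cauchy H
  H-cauchy ε 0<ε =
    let (N , hN) = 1/suc-small ε 0<ε
        close : ∀ i j → N ℕ.≤ j → H i - H j ≤ ε
        close i j j≥ = ≤-trans (+-monoˡ-≤ (- H j) (below-H (0≤H i) (exp-H≤ i) j))
          (≤-trans (≤-reflexive (solve 2 (λ h u → h :+ u :- h := u) refl (H j) (1/suc j))) (≤-trans (1/suc-anti j≥) hN))
    in N , λ i j i≥ j≥ → ∣∣-≤ (close i j j≥)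
      (subst (_≤ ε) (solve 2 (λ a b → b :- a := :- (a :- b)) refl (H i) (H j)) (close j i i≥))

  -- With E⁻ and E⁺ the truncations at -H and H, E⁻ - p = E⁻ (1 - E⁺ p) + p (E⁻ E⁺ - 1). The last
  -- term is small by `expSum-inverse`, the first because E⁺ p is nearly 1; `R` bounds 1/p, hence H
  -- and |E⁻| ≤ E⁺.
  exp-neg-H : ∀ R → 1ℚ ≤ fromℕ R * p → ∀ ε → 0ℚ < ε →
    ∃[ J ] (∀ j → J ℕ.≤ j → ∣ p - expSum j (- H j) ∣ℚ ≤ ε)
  exp-neg-H R 1≤Rp ε 0<ε =
    let 0<½ε = 0<½* 0<ε
        ε′ = ½ * (½ * ε * 1/suc R)
        0<ε′ = 0<½* (0<* 0<½ε (0<1/suc R))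
        (N₁ , h₁) = expSum-inverse (0≤fromℕ R) (½ * ε) 0<½ε
        (N₂ , h₂) = expSum-close (0≤fromℕ R) ε′ 0<ε′
        (N₃ , h₃) = 1/suc-small ε′ 0<ε′
        J = N₁ ℕ.⊔ (N₂ ℕ.⊔ N₃)
    in J , λ j j≥ →
      let j≥N₁ = ℕ.≤-trans (ℕ.m≤m⊔n N₁ (N₂ ℕ.⊔ N₃)) j≥
          j≥N₂ = ℕ.≤-trans (ℕ.≤-trans (ℕ.m≤m⊔n N₂ N₃) (ℕ.m≤n⊔m N₁ (N₂ ℕ.⊔ N₃))) j≥
          j≥N₃ = ℕ.≤-trans (ℕ.≤-trans (ℕ.m≤n⊔m N₂ N₃) (ℕ.m≤n⊔m N₁ (N₂ ℕ.⊔ N₃))) j≥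
          h = H j
          E⁺ = expSum j h
          E⁻ = expSum j (- h)
          u = 1/suc j
          0≤u = <⇒≤ (0<1/suc j)
          u≤ε′ = ≤-trans (1/suc-anti j≥N₃) h₃
          (L , hL) = exp-H≥ j
          -- `exp-H≥` provides a truncation L that depends on j. The estimate is made at `K` and
          -- carried over to j by `h₂`, which is uniform in the argument.
          K = L ℕ.⊔ j
          E = expSum K h
          lower : 1ℚ - u ≤ E * p
          lower = begin
            1ℚ - u                                  ≡⟨ *-identityˡ (1ℚ - u) ⟨
            1ℚ * (1ℚ - u)                           ≤⟨ *-monoʳ (≤⇒0≤- (1/suc-anti {0} {j} z≤n)) (≤-trans hL (*-monoʳ 0≤p (≤-trans (expSum-monoˡ (0≤H+ j) (ℕ.m≤m⊔n L j)) (expSum-+-≤ K (0≤H j) 0≤u)))) ⟩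
            E * expSum K u * p * (1ℚ - u)           ≡⟨ solve 4 (λ e f p v → e :* f :* p :* v := e :* p :* (f :* v)) refl E (expSum K u) p (1ℚ - u) ⟩
            E * p * (expSum K u * (1ℚ - u))         ≤⟨ *-monoˡ (0≤* (0≤expSum (0≤H j) K) 0≤p) (expSum-geometric 0≤u (1/suc-anti {0} {j} z≤n) K) ⟩
            E * p * 1ℚ                              ≡⟨ *-identityʳ _ ⟩
            E * p                                   ∎
          close : E - E⁺ ≤ ε′
          close = ≤-trans (p≤∣p∣ _) (h₂ K j (ℕ.≤-trans j≥N₂ (ℕ.m≤n⊔m L j)) j≥N₂ h (∣∣≤ (0≤H j) (H≤R j)))
          E⁺≥ : 1ℚ - E⁺ * p ≤ ½ * ε * 1/suc R
          E⁺≥ = ≤-trans (≤-cert (0≤+ (0≤+ (≤⇒0≤- lower) (≤⇒0≤- u≤ε′)) (0≤+ (≤⇒0≤- close) (0≤* (≤⇒0≤- (expSum-monoˡ (0≤H j) (ℕ.m≤n⊔m L j))) (≤⇒0≤- p≤1))))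
              (solve 5 (λ E F p u e → (e :+ e) :- (con 1ℚ :- F :* p)
                 := (E :* p :- (con 1ℚ :- u)) :+ (e :- u) :+ ((e :- (E :- F)) :+ (E :- F) :* (con 1ℚ :- p)))
                refl E E⁺ p u ε′)) (≤-reflexive (½*+½* (½ * ε * 1/suc R)))
          part₂ : ∣ E⁻ * (1ℚ - E⁺ * p) ∣ℚ ≤ ½ * ε
          part₂ = ≤-trans (≤-reflexive (∣p*q∣≡∣p∣*∣q∣ E⁻ (1ℚ - E⁺ * p)))
            (≤-trans (*-mono-≤-nonNeg (0≤∣p∣ E⁻) (∣expSum-neg∣≤ j (0≤H j)) (0≤∣p∣ (1ℚ - E⁺ * p))
                (≤-trans (≤-reflexive (0≤p⇒∣p∣≡p (≤⇒0≤- (exp-H≤ j j)))) E⁺≥))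
              (shrink R 0<½ε (0≤expSum (0≤H j) j) (≤R (0≤expSum (0≤H j) j) (exp-H≤ j j))))
          part₁ : ∣ p * (E⁻ * E⁺ - 1ℚ) ∣ℚ ≤ ½ * ε
          part₁ = ≤-trans (≤-reflexive (trans (∣p*q∣≡∣p∣*∣q∣ p (E⁻ * E⁺ - 1ℚ)) (cong (_* ∣ E⁻ * E⁺ - 1ℚ ∣ℚ) (0≤p⇒∣p∣≡p 0≤p))))
            (≤-trans (*-mono-≤-nonNeg 0≤p p≤1 (0≤∣p∣ _) (h₁ j j≥N₁ h (0≤H j) (H≤R j))) (≤-reflexive (*-identityˡ _)))
      in begin
        ∣ p - E⁻ ∣ℚ
          ≡⟨ ∣-∣-sym p E⁻ ⟩
        ∣ E⁻ - p ∣ℚ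
          ≡⟨ cong ∣_∣ℚ (solve 3 (λ p E F → E :- p := E :* (con 1ℚ :- F :* p) :+ p :* (E :* F :- con 1ℚ)) refl p E⁻ E⁺) ⟩
        ∣ E⁻ * (1ℚ - E⁺ * p) + p * (E⁻ * E⁺ - 1ℚ) ∣ℚ
          ≤⟨ ∣p+q∣≤∣p∣+∣q∣ (E⁻ * (1ℚ - E⁺ * p)) (p * (E⁻ * E⁺ - 1ℚ)) ⟩
        ∣ E⁻ * (1ℚ - E⁺ * p) ∣ℚ + ∣ p * (E⁻ * E⁺ - 1ℚ) ∣ℚ
          ≤⟨ +-mono-≤ part₂ part₁ ⟩
        ½ * ε + ½ * ε
          ≡⟨ ½*+½* ε ⟩
        ε ∎
    where
    open ≤-Reasoning
    ≤R : ∀ {x} → 0ℚ ≤ x → x * p ≤ 1ℚ → x ≤ fromℕ R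
    ≤R {x} 0≤x xp≤1 = begin
      x                   ≡⟨ *-identityʳ x ⟨
      x * 1ℚ              ≤⟨ *-monoˡ 0≤x 1≤Rp ⟩
      x * (fromℕ R * p)   ≡⟨ solve 3 (λ x r p → x :* (r :* p) := r :* (x :* p)) refl x (fromℕ R) p ⟩
      fromℕ R * (x * p)   ≤⟨ *-monoˡ (0≤fromℕ R) xp≤1 ⟩
      fromℕ R * 1ℚ        ≡⟨ *-identityʳ (fromℕ R) ⟩
      fromℕ R             ∎
    H≤R : ∀ j → H j ≤ fromℕ R
    H≤R j = ≤R (0≤H j) (≤-trans (*-monoʳ {p} {H j} 0≤p (≤-trans (≤-trans (≤+ 0≤1) (≤-reflexive (+-comm (H j) 1ℚ))) (1+≤expSum (0≤H j) 0))) (exp-H≤ j 2))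
    p≤1 : p ≤ 1ℚ
    p≤1 = ≤-trans (≤-reflexive (sym (*-identityˡ p))) (exp-H≤ 0 1)

0<fromℕ : ∀ n → 0ℚ < fromℕ (suc n)
0<fromℕ n = <-≤-trans (positive⁻¹ 1ℚ) (fromℕ-mono {1} {suc n} (s≤s z≤n))

-- For p = b/(b + d), the j-th harmonic sum runs between b(j + 1) and (b + d)(j + 1). Scaling keeps
-- the ratio of the ends and brings the gap between lower and upper sums down to at most 1/(j + 1).
logSeq : ∀ b′ d {p} → p * fromℕ (suc b′ ℕ.+ d) ≡ fromℕ (suc b′) → LogSeq p
logSeq b′ d {p} pa≡b = record
  { H      = λ j → lower (B′ j) (d ℕ.* suc j)
  ; 0≤H    = λ j → 0≤lower (B′ j) (d ℕ.* suc j)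
  ; exp-H≤ = λ j k → let E = expSum k (lower (B′ j) (d ℕ.* suc j)) in
      *-cancelʳ (0<fromℕ (b′ ℕ.+ d)) (*-cancelʳ (0<fromℕ j) (begin
        E * p * fromℕ a * fromℕ (suc j)      ≡⟨ cancel E (fromℕ (suc j)) ⟩
        E * (fromℕ (suc b′) * fromℕ (suc j)) ≡⟨ cong (E *_) (fromℕ-* (suc b′) (suc j)) ⟨
        E * fromℕ (suc (B′ j))               ≤⟨ exp-lower (B′ j) k (d ℕ.* suc j) ⟩
        fromℕ (suc (B′ j) ℕ.+ d ℕ.* suc j)   ≡⟨ total j ⟩
        1ℚ * fromℕ a * fromℕ (suc j)         ∎))
  ; exp-H≥ = λ j → let (L , h) = exp-upper (B′ j) (d ℕ.* suc j) ; E = expSum L (lower (B′ j) (d ℕ.* suc j) + 1/suc j) in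
      L , *-cancelʳ (0<fromℕ (b′ ℕ.+ d)) (*-cancelʳ (0<fromℕ j) (begin
        1ℚ * fromℕ a * fromℕ (suc j)         ≡⟨ total j ⟨
        fromℕ (suc (B′ j) ℕ.+ d ℕ.* suc j)   ≤⟨ h ⟩
        expSum L (upper (B′ j) (d ℕ.* suc j)) * fromℕ (suc (B′ j)) ≤⟨ *-monoʳ (0≤fromℕ (suc (B′ j)))
            (expSum-mono L (0≤upper (B′ j) (d ℕ.* suc j)) (≤-trans (upper≤lower (B′ j) (d ℕ.* suc j))
              (+-monoʳ-≤ (lower (B′ j) (d ℕ.* suc j)) (1/suc-anti {j} {B′ j} (ℕ.m≤m+n j (b′ ℕ.* suc j)))))) ⟩
        E * fromℕ (suc (B′ j))               ≡⟨ cong (E *_) (fromℕ-* (suc b′) (suc j)) ⟩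
        E * (fromℕ (suc b′) * fromℕ (suc j)) ≡⟨ cancel E (fromℕ (suc j)) ⟨
        E * p * fromℕ a * fromℕ (suc j)      ∎))
  }
  where
  open ≤-Reasoning
  open Harmonic
  a = suc b′ ℕ.+ d
  B′ : ℕ → ℕ
  -- `suc (B′ j)` computes to `suc b′ * suc j`.
  B′ j = j ℕ.+ b′ ℕ.* suc j
  cancel : ∀ E s → E * p * fromℕ a * s ≡ E * (fromℕ (suc b′) * s)
  cancel E s = trans (solve 4 (λ E p a s → E :* p :* a :* s := E :* (p :* a :* s)) refl E p (fromℕ a) s)
    (cong (λ z → E * (z * s)) pa≡b)
  total : ∀ j → fromℕ (suc (B′ j) ℕ.+ d ℕ.* suc j) ≡ 1ℚ * fromℕ a * fromℕ (suc j)
  total j = trans (cong fromℕ (sym (ℕ.*-distribʳ-+ (suc j) (suc b′) d)))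
    (trans (fromℕ-* a (suc j)) (cong (_* fromℕ (suc j)) (sym (*-identityˡ (fromℕ a)))))

-- Fractions of natural numbers.

inv : ℕ → ℚ
inv b = 1 ÷ℕ b

÷ℕ-inv : ∀ a b → a ÷ℕ b ≡ fromℕ a * inv b
÷ℕ-inv a       zero    = sym (*-zeroʳ (fromℕ a))
÷ℕ-inv zero    (suc b) = trans (≤-antisym (/-mono-≤ 0 0 b 0 z≤n) (/-mono-≤ 0 0 0 b z≤n)) (sym (*-zeroˡ (inv (suc b))))
÷ℕ-inv (suc a) (suc b) = trans (/-suc a b) (trans (cong (1/suc b +_) (÷ℕ-inv a (suc b)))
  (trans (solve 2 (λ i a → i :+ a :* i := (con 1ℚ :+ a) :* i) refl (1/suc b) (fromℕ a))
    (cong (_* inv (suc b)) (sym (fromℕ-suc a)))))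

fromℕ*inv : ∀ b → 1 ℕ.≤ b → fromℕ b * inv b ≡ 1ℚ
fromℕ*inv (suc b) _ = suc*1/suc b

0≤inv : ∀ b → 0ℚ ≤ inv b
0≤inv zero    = ≤-refl
0≤inv (suc b) = <⇒≤ (0<1/suc b)

0≤÷ℕ : ∀ a b → 0ℚ ≤ a ÷ℕ b
0≤÷ℕ a b = subst (0ℚ ≤_) (sym (÷ℕ-inv a b)) (0≤* (0≤fromℕ a) (0≤inv b))

0<fromℕ′ : ∀ {b} → 1 ℕ.≤ b → 0ℚ < fromℕ b
0<fromℕ′ {suc b} _ = 0<fromℕ b

inv-* : ∀ a b → 1 ℕ.≤ a → 1 ℕ.≤ b → inv (a ℕ.* b) ≡ inv a * inv b
inv-* a b a≥1 b≥1 = begin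
  inv (a ℕ.* b)                                          ≡⟨ *-identityʳ _ ⟨
  inv (a ℕ.* b) * 1ℚ                                     ≡⟨ cong (inv (a ℕ.* b) *_) (cong₂ _*_ (fromℕ*inv a a≥1) (fromℕ*inv b b≥1)) ⟨
  inv (a ℕ.* b) * (fromℕ a * inv a * (fromℕ b * inv b))  ≡⟨ solve 5 (λ i a j b k → i :* (a :* j :* (b :* k)) := (a :* b) :* i :* (j :* k)) refl (inv (a ℕ.* b)) (fromℕ a) (inv a) (fromℕ b) (inv b) ⟩
  fromℕ a * fromℕ b * inv (a ℕ.* b) * (inv a * inv b)    ≡⟨ cong (λ z → z * inv (a ℕ.* b) * (inv a * inv b)) (fromℕ-* a b) ⟨
  fromℕ (a ℕ.* b) * inv (a ℕ.* b) * (inv a * inv b)      ≡⟨ cong (_* (inv a * inv b)) (fromℕ*inv (a ℕ.* b) (ℕ.*-mono-≤ a≥1 b≥1)) ⟩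
  1ℚ * (inv a * inv b)                                   ≡⟨ *-identityˡ _ ⟩
  inv a * inv b                                          ∎
  where open ≡-Reasoning

ratio-≤ : ∀ A c X Y → 1 ℕ.≤ A → A ℕ.* X ℕ.≤ (A ℕ.+ c) ℕ.* Y → fromℕ X ≤ (1ℚ + fromℕ c * inv A) * fromℕ Y
ratio-≤ A c X Y A≥1 h = *-cancelʳ (0<fromℕ′ A≥1) (begin
  fromℕ X * fromℕ A                        ≡⟨ trans (*-comm (fromℕ X) (fromℕ A)) (sym (fromℕ-* A X)) ⟩
  fromℕ (A ℕ.* X)                          ≤⟨ fromℕ-mono h ⟩
  fromℕ ((A ℕ.+ c) ℕ.* Y)                  ≡⟨ trans (fromℕ-* (A ℕ.+ c) Y) (cong (_* fromℕ Y) (fromℕ-+ A c)) ⟩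
  (fromℕ A + fromℕ c) * fromℕ Y            ≡⟨ cong (λ z → (fromℕ A + z) * fromℕ Y) (trans (cong (fromℕ c *_) (fromℕ*inv A A≥1)) (*-identityʳ (fromℕ c))) ⟨
  (fromℕ A + fromℕ c * (fromℕ A * inv A)) * fromℕ Y ≡⟨ solve 4 (λ a c i y → (a :+ c :* (a :* i)) :* y := (con 1ℚ :+ c :* i) :* y :* a) refl (fromℕ A) (fromℕ c) (inv A) (fromℕ Y) ⟩
  (1ℚ + fromℕ c * inv A) * fromℕ Y * fromℕ A ∎)
  where open ≤-Reasoning

ratio-≥ : ∀ A c X Y → 1 ℕ.≤ A → A ℕ.* Y ℕ.+ c ℕ.* X ℕ.≤ A ℕ.* X → fromℕ Y ≤ (1ℚ - fromℕ c * inv A) * fromℕ X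
ratio-≥ A c X Y A≥1 h = *-cancelʳ (0<fromℕ′ A≥1) (begin
  fromℕ Y * fromℕ A                        ≤⟨ ≤-cert (≤⇒0≤- ineq) (solve 4 (λ a c x y → (a :* x :- c :* x) :- y :* a := a :* x :- (a :* y :+ c :* x)) refl (fromℕ A) (fromℕ c) (fromℕ X) (fromℕ Y)) ⟩
  fromℕ A * fromℕ X - fromℕ c * fromℕ X    ≡⟨ cong (λ z → fromℕ A * fromℕ X - z * fromℕ X) (trans (cong (fromℕ c *_) (fromℕ*inv A A≥1)) (*-identityʳ (fromℕ c))) ⟨
  fromℕ A * fromℕ X - fromℕ c * (fromℕ A * inv A) * fromℕ X ≡⟨ solve 4 (λ a c i x → a :* x :- c :* (a :* i) :* x := (con 1ℚ :- c :* i) :* x :* a) refl (fromℕ A) (fromℕ c) (inv A) (fromℕ X) ⟩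
  (1ℚ - fromℕ c * inv A) * fromℕ X * fromℕ A ∎)
  where
  open ≤-Reasoning
  ineq : fromℕ A * fromℕ Y + fromℕ c * fromℕ X ≤ fromℕ A * fromℕ X
  ineq = subst₂ _≤_ (trans (fromℕ-+ (A ℕ.* Y) (c ℕ.* X)) (cong₂ _+_ (fromℕ-* A Y) (fromℕ-* c X))) (fromℕ-* A X) (fromℕ-mono h)

-- From the factor of each conflict to the exponential bound.

module Chain {B : Set} (G : List B → ℕ) (P : List B → Set) (P-tail : ∀ {b F} → P (b ∷ F) → P F) {z : ℚ} (0≤z : 0ℚ ≤ z) where

  open ≤-Reasoning

  0≤jz : ∀ j → 0ℚ ≤ fromℕ j * z
  0≤jz j = 0≤* (0≤fromℕ j) 0≤z

  suc-jz : ∀ j → fromℕ (suc j) * z ≡ fromℕ j * z + z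
  suc-jz j = trans (cong (_* z) (fromℕ-suc j)) (solve 2 (λ j z → (con 1ℚ :+ j) :* z := j :* z :+ z) refl (fromℕ j) z)

  -- Each step uses e^z (1 - z) ≤ 1, so the series is never evaluated at a negative argument.
  chain-≤ : z ≤ 1ℚ → (∀ b F → P (b ∷ F) → fromℕ (G (b ∷ F)) ≤ (1ℚ - z) * fromℕ (G F)) →
    ∀ F → P F → ∀ k → expSum k (fromℕ (length F) * z) * fromℕ (G F) ≤ fromℕ (G [])
  chain-≤ z≤1 step [] _ k = ≤-trans (*-monoʳ (0≤fromℕ (G []))
      (≤-trans (≤-reflexive (cong (expSum k) (*-zeroˡ z))) (≤-trans (expSum-monoˡ ≤-refl (ℕ.n≤1+n k)) (≤-reflexive (expSum-0 k)))))
    (≤-reflexive (*-identityˡ _))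
  chain-≤ z≤1 step (b ∷ F) pF k = begin
    expSum k (fromℕ (suc j) * z) * fromℕ (G (b ∷ F))            ≡⟨ cong (λ w → expSum k w * fromℕ (G (b ∷ F))) (suc-jz j) ⟩
    expSum k (fromℕ j * z + z) * fromℕ (G (b ∷ F))              ≤⟨ *-mono-≤-nonNeg (0≤expSum (0≤+ (0≤jz j) 0≤z) k) (expSum-+-≤ k (0≤jz j) 0≤z) (0≤fromℕ (G (b ∷ F))) (step b F pF) ⟩
    expSum k (fromℕ j * z) * expSum k z * ((1ℚ - z) * fromℕ (G F)) ≡⟨ solve 4 (λ a e v g → a :* e :* (v :* g) := a :* g :* (e :* v)) refl (expSum k (fromℕ j * z)) (expSum k z) (1ℚ - z) (fromℕ (G F)) ⟩
    expSum k (fromℕ j * z) * fromℕ (G F) * (expSum k z * (1ℚ - z)) ≤⟨ *-monoˡ (0≤* (0≤expSum (0≤jz j) k) (0≤fromℕ (G F))) (expSum-geometric 0≤z z≤1 k) ⟩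
    expSum k (fromℕ j * z) * fromℕ (G F) * 1ℚ                   ≡⟨ *-identityʳ _ ⟩
    expSum k (fromℕ j * z) * fromℕ (G F)                        ≤⟨ chain-≤ z≤1 step F (P-tail pF) k ⟩
    fromℕ (G [])                                                ∎
    where j = length F

  chain-≥ : (∀ b F → P (b ∷ F) → fromℕ (G F) ≤ (1ℚ + z) * fromℕ (G (b ∷ F))) →
    ∀ F → P F → ∃[ L ] fromℕ (G []) ≤ expSum L (fromℕ (length F) * z) * fromℕ (G F)
  chain-≥ step [] _ = 1 , ≤-reflexive (sym (*-identityˡ _))
  chain-≥ step (b ∷ F) pF = let (L , h) = chain-≥ step F (P-tail pF) ; j = length F in L ℕ.+ 2 , (begin
    fromℕ (G [])                                                 ≤⟨ h ⟩
    expSum L (fromℕ j * z) * fromℕ (G F)                         ≤⟨ *-monoˡ (0≤expSum (0≤jz j) L) (step b F pF) ⟩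
    expSum L (fromℕ j * z) * ((1ℚ + z) * fromℕ (G (b ∷ F)))      ≡⟨ *-assoc (expSum L (fromℕ j * z)) (1ℚ + z) (fromℕ (G (b ∷ F))) ⟨
    expSum L (fromℕ j * z) * (1ℚ + z) * fromℕ (G (b ∷ F))        ≤⟨ *-monoʳ (0≤fromℕ (G (b ∷ F))) (≤-trans (*-monoˡ (0≤expSum (0≤jz j) L) (1+≤expSum 0≤z 0)) (expSum-*-≤ L 2 (0≤jz j) 0≤z)) ⟩
    expSum (L ℕ.+ 2) (fromℕ j * z + z) * fromℕ (G (b ∷ F))       ≡⟨ cong (λ w → expSum (L ℕ.+ 2) w * fromℕ (G (b ∷ F))) (suc-jz j) ⟨
    expSum (L ℕ.+ 2) (fromℕ (suc j) * z) * fromℕ (G (b ∷ F))     ∎)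

-- As 3/D ≤ 1/2, the bound a ≤ 3(G + a)/D gives a ≤ 6G/D. This 6 becomes c₂ in (1).
coarse-arith : ∀ D a G → 6 ℕ.≤ D → D ℕ.* a ℕ.≤ 3 ℕ.* (G ℕ.+ a) → D ℕ.* (G ℕ.+ a) ℕ.≤ (D ℕ.+ 6) ℕ.* G
coarse-arith D a G 6≤D h = begin
  D ℕ.* (G ℕ.+ a)            ≡⟨ ℕ.*-distribˡ-+ D G a ⟩
  D ℕ.* G ℕ.+ D ℕ.* a        ≤⟨ ℕ.+-monoʳ-≤ (D ℕ.* G) Da≤6G ⟩
  D ℕ.* G ℕ.+ 6 ℕ.* G        ≡⟨ ℕ.*-distribʳ-+ G D 6 ⟨
  (D ℕ.+ 6) ℕ.* G            ∎
  where
  open ℕ.≤-Reasoning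
  e₁ : ∀ D a → D ℕ.* a ℕ.+ D ℕ.* a ≡ 2 ℕ.* (D ℕ.* a)
  e₁ = solve-∀
  e₂ : ∀ a G → 2 ℕ.* (3 ℕ.* (G ℕ.+ a)) ≡ 6 ℕ.* G ℕ.+ 6 ℕ.* a
  e₂ = solve-∀
  Da≤6G : D ℕ.* a ℕ.≤ 6 ℕ.* G
  Da≤6G = ℕ.+-cancelʳ-≤ (D ℕ.* a) _ _ (begin
    D ℕ.* a ℕ.+ D ℕ.* a        ≡⟨ e₁ D a ⟩
    2 ℕ.* (D ℕ.* a)            ≤⟨ ℕ.*-monoʳ-≤ 2 h ⟩
    2 ℕ.* (3 ℕ.* (G ℕ.+ a))    ≡⟨ e₂ a G ⟩
    6 ℕ.* G ℕ.+ 6 ℕ.* a        ≤⟨ ℕ.+-monoʳ-≤ (6 ℕ.* G) (ℕ.*-monoˡ-≤ a 6≤D) ⟩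
    6 ℕ.* G ℕ.+ D ℕ.* a        ∎)

-- Turns a probability, a relative to G + a, into odds, a relative to G. Inverting 1 - 24s/n and
-- absorbing the term n/D raise 24 to 50. In terms of c = n - 24s, `key` comes down to 576s² ≤ 22cs,
-- where 76s ≤ c leaves plenty of room.
sharp-arith : ∀ n s D a G → 1 ℕ.≤ s → 100 ℕ.* s ℕ.≤ n → n ℕ.* n ℕ.≤ 2 ℕ.* D →
  (n ℕ.∸ 24 ℕ.* s) ℕ.* (D ℕ.* a) ℕ.≤ n ℕ.* (G ℕ.+ a) → n ℕ.* (D ℕ.* a) ℕ.≤ (n ℕ.+ 50 ℕ.* s) ℕ.* G
sharp-arith n s D a G 1≤s 100s≤n n²≤2D h =
  ℕ.*-cancelˡ-≤ n {{ℕ.>-nonZero n≥1}} (ℕ.+-cancelʳ-≤ ((n ℕ.+ 50 ℕ.* s) ℕ.* n ℕ.* a) _ _ (begin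
    n ℕ.* (n ℕ.* (D ℕ.* a)) ℕ.+ (n ℕ.+ 50 ℕ.* s) ℕ.* n ℕ.* a    ≡⟨ e₁ n D a ((n ℕ.+ 50 ℕ.* s) ℕ.* n) ⟩
    (n ℕ.* n ℕ.* D ℕ.+ (n ℕ.+ 50 ℕ.* s) ℕ.* n) ℕ.* a            ≤⟨ ℕ.*-monoˡ-≤ a key ⟩
    (n ℕ.+ 50 ℕ.* s) ℕ.* c ℕ.* D ℕ.* a                          ≡⟨ e₂ (n ℕ.+ 50 ℕ.* s) c D a ⟩
    (n ℕ.+ 50 ℕ.* s) ℕ.* (c ℕ.* (D ℕ.* a))                      ≤⟨ ℕ.*-monoʳ-≤ (n ℕ.+ 50 ℕ.* s) h ⟩
    (n ℕ.+ 50 ℕ.* s) ℕ.* (n ℕ.* (G ℕ.+ a))                      ≡⟨ e₃ (n ℕ.+ 50 ℕ.* s) n G a ⟩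
    n ℕ.* ((n ℕ.+ 50 ℕ.* s) ℕ.* G) ℕ.+ (n ℕ.+ 50 ℕ.* s) ℕ.* n ℕ.* a ∎))
  where
  open ℕ.≤-Reasoning
  c = n ℕ.∸ 24 ℕ.* s
  n≥1 : 1 ℕ.≤ n
  n≥1 = ℕ.≤-trans (ℕ.≤-trans 1≤s (ℕ.m≤m+n s (99 ℕ.* s))) 100s≤n
  c+24s≡n : c ℕ.+ 24 ℕ.* s ≡ n
  c+24s≡n = ℕ.m∸n+n≡m (ℕ.≤-trans (ℕ.*-monoˡ-≤ s (ℕ.m≤m+n 24 76)) 100s≤n)
  e₁ : ∀ n D a X → n ℕ.* (n ℕ.* (D ℕ.* a)) ℕ.+ X ℕ.* a ≡ (n ℕ.* n ℕ.* D ℕ.+ X) ℕ.* a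
  e₁ = solve-∀
  e₂ : ∀ x c D a → x ℕ.* c ℕ.* D ℕ.* a ≡ x ℕ.* (c ℕ.* (D ℕ.* a))
  e₂ = solve-∀
  e₃ : ∀ x n G a → x ℕ.* (n ℕ.* (G ℕ.+ a)) ≡ n ℕ.* (x ℕ.* G) ℕ.+ x ℕ.* n ℕ.* a
  e₃ = solve-∀
  76s≤c : 76 ℕ.* s ℕ.≤ c
  76s≤c = ℕ.m+n≤o⇒m≤o∸n (76 ℕ.* s) (ℕ.≤-trans (ℕ.≤-reflexive (sym (ℕ.*-distribʳ-+ s 76 24))) 100s≤n)
  1≤c : 1 ℕ.≤ c
  1≤c = ℕ.≤-trans (ℕ.≤-trans 1≤s (ℕ.m≤m+n s (75 ℕ.* s))) 76s≤c
  square : (n ℕ.+ 50 ℕ.* s) ℕ.* n ℕ.≤ 4 ℕ.* c ℕ.* s ℕ.* D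
  square = begin
    (n ℕ.+ 50 ℕ.* s) ℕ.* n    ≤⟨ ℕ.*-monoˡ-≤ n (ℕ.+-monoʳ-≤ n (ℕ.≤-trans (ℕ.*-monoˡ-≤ s (ℕ.m≤m+n 50 50)) 100s≤n)) ⟩
    (n ℕ.+ n) ℕ.* n           ≡⟨ q₁ n ⟩
    2 ℕ.* (n ℕ.* n)           ≤⟨ ℕ.*-monoʳ-≤ 2 n²≤2D ⟩
    2 ℕ.* (2 ℕ.* D)           ≡⟨ q₂ D ⟩
    4 ℕ.* 1 ℕ.* 1 ℕ.* D       ≤⟨ ℕ.*-monoˡ-≤ D (ℕ.*-mono-≤ (ℕ.*-monoʳ-≤ 4 1≤c) 1≤s) ⟩
    4 ℕ.* c ℕ.* s ℕ.* D       ∎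
    where
    q₁ : ∀ n → (n ℕ.+ n) ℕ.* n ≡ 2 ℕ.* (n ℕ.* n)
    q₁ = solve-∀
    q₂ : ∀ D → 2 ℕ.* (2 ℕ.* D) ≡ 4 ℕ.* 1 ℕ.* 1 ℕ.* D
    q₂ = solve-∀
  key : n ℕ.* n ℕ.* D ℕ.+ (n ℕ.+ 50 ℕ.* s) ℕ.* n ℕ.≤ (n ℕ.+ 50 ℕ.* s) ℕ.* c ℕ.* D
  key = begin
    n ℕ.* n ℕ.* D ℕ.+ (n ℕ.+ 50 ℕ.* s) ℕ.* n
      ≤⟨ ℕ.+-monoʳ-≤ (n ℕ.* n ℕ.* D) square ⟩
    n ℕ.* n ℕ.* D ℕ.+ 4 ℕ.* c ℕ.* s ℕ.* D
      ≡⟨ subst (λ z → z ℕ.* z ℕ.* D ℕ.+ 4 ℕ.* c ℕ.* s ℕ.* D ≡ (c ℕ.* c ℕ.+ 52 ℕ.* c ℕ.* s) ℕ.* D ℕ.+ 576 ℕ.* s ℕ.* s ℕ.* D) c+24s≡n (q₁ c s D) ⟩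
    (c ℕ.* c ℕ.+ 52 ℕ.* c ℕ.* s) ℕ.* D ℕ.+ 576 ℕ.* s ℕ.* s ℕ.* D
      ≤⟨ ℕ.+-monoʳ-≤ ((c ℕ.* c ℕ.+ 52 ℕ.* c ℕ.* s) ℕ.* D) (ℕ.*-monoˡ-≤ D (ℕ.*-monoˡ-≤ s
          (ℕ.≤-trans (ℕ.*-monoˡ-≤ s (ℕ.m≤m+n 576 1096)) (ℕ.≤-trans (ℕ.≤-reflexive (ℕ.*-assoc 22 76 s)) (ℕ.*-monoʳ-≤ 22 76s≤c))))) ⟩
    (c ℕ.* c ℕ.+ 52 ℕ.* c ℕ.* s) ℕ.* D ℕ.+ 22 ℕ.* c ℕ.* s ℕ.* D
      ≡⟨ subst (λ z → (c ℕ.* c ℕ.+ 52 ℕ.* c ℕ.* s) ℕ.* D ℕ.+ 22 ℕ.* c ℕ.* s ℕ.* D ≡ (z ℕ.+ 50 ℕ.* s) ℕ.* c ℕ.* D) c+24s≡n (q₂ c s D) ⟩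
    (n ℕ.+ 50 ℕ.* s) ℕ.* c ℕ.* D ∎
    where
    q₁ : ∀ c s D → (c ℕ.+ 24 ℕ.* s) ℕ.* (c ℕ.+ 24 ℕ.* s) ℕ.* D ℕ.+ 4 ℕ.* c ℕ.* s ℕ.* D ≡ (c ℕ.* c ℕ.+ 52 ℕ.* c ℕ.* s) ℕ.* D ℕ.+ 576 ℕ.* s ℕ.* s ℕ.* D
    q₁ = solve-∀
    q₂ : ∀ c s D → (c ℕ.* c ℕ.+ 52 ℕ.* c ℕ.* s) ℕ.* D ℕ.+ 22 ℕ.* c ℕ.* s ℕ.* D ≡ (c ℕ.+ 24 ℕ.* s ℕ.+ 50 ℕ.* s) ℕ.* c ℕ.* D
    q₂ = solve-∀

-- Bounds for the rainbow probability p in terms of q = μ.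

module Estimates (n : ℕ) (χ : Colouring n) where

  open Matchings n
  open Colour χ

  p q : ℚ
  p = length (filter (rainbow? χ) Ω) ÷ℕ m
  q = length F ÷ℕ D

  p≡ : p ≡ fromℕ (N [] F) * inv m
  p≡ = trans (cong (_÷ℕ m) rainbow-count) (÷ℕ-inv (N [] F) m)

  p*m : p * fromℕ m ≡ fromℕ (N [] F)
  p*m = trans (cong (_* fromℕ m) p≡) (trans (solve 3 (λ g i m → g :* i :* m := g :* (m :* i)) refl (fromℕ (N [] F)) (inv m) (fromℕ m))
    (trans (cong (fromℕ (N [] F) *_) (fromℕ*inv m m-pos)) (*-identityʳ _)))

  to-p-≤ : ∀ E → E * fromℕ (N [] F) ≤ fromℕ (N [] []) → E * p ≤ 1ℚ
  to-p-≤ E h = *-cancelʳ (0<fromℕ′ m-pos) (≤-trans (≤-reflexive (trans (*-assoc E p (fromℕ m)) (cong (E *_) p*m)))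
    (≤-trans h (≤-reflexive (trans (cong fromℕ N-empty) (sym (*-identityˡ _))))))

  to-p-≥ : ∀ E → fromℕ (N [] []) ≤ E * fromℕ (N [] F) → 1ℚ ≤ E * p
  to-p-≥ E h = *-cancelʳ (0<fromℕ′ m-pos) (≤-trans (≤-reflexive (trans (*-identityˡ _) (sym (cong fromℕ N-empty))))
    (≤-trans h (≤-reflexive (sym (trans (*-assoc E p (fromℕ m)) (cong (E *_) p*m))))))

  0≤p : 0ℚ ≤ p
  0≤p = 0≤÷ℕ (length (filter (rainbow? χ) Ω)) m

  0≤q : 0ℚ ≤ q
  0≤q = 0≤÷ℕ (length F) D

  p≤1 : p ≤ 1ℚ
  p≤1 = subst (_≤ 1ℚ) (*-identityˡ p) (to-p-≤ 1ℚ (≤-trans (≤-reflexive (*-identityˡ _))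
    (fromℕ-mono (N-mono {[]} {F} {[]} {[]} (λ _ _ → [] , [])))))

  Good : ℕ → List Pair → Set
  Good t F = Sparse t F × Indep F × AllPairs DistinctPairs F

  Good-tail : ∀ {t B F} → Good t (B ∷ F) → Good t F
  Good-tail (sp , _ ∷ ind , _ ∷ dis) = sparse-tail sp , ind , dis

  coarse : ∀ t → (∀ c → colourCount χ c ℕ.≤ suc t) → 12 ℕ.* suc t ℕ.≤ n → ∃[ L ] 1ℚ ≤ expSum L (fromℕ 6 * q) * p
  coarse t few 12s≤n =
    let (L , h) = chain-≥ step F (F-sparse t few , F-indep , F-distinct)
    in L , to-p-≥ (expSum L (fromℕ 6 * q)) (≤-trans h (≤-reflexive (cong (λ z → expSum L z * fromℕ (N [] F)) arg)))
    where
    open LocalLemma t 12s≤n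
    6≤D : 6 ℕ.≤ D
    6≤D = ℕ.≤-trans (ℕ.m≤m+n 6 15) 21≤D
    1≤D : 1 ℕ.≤ D
    1≤D = ℕ.≤-trans (ℕ.m≤m+n 1 5) 6≤D
    open Chain (N []) (Good t) Good-tail (0≤* (0≤fromℕ 6) (0≤inv D))
    step : ∀ B F → Good t (B ∷ F) → fromℕ (N [] F) ≤ (1ℚ + fromℕ 6 * inv D) * fromℕ (N [] (B ∷ F))
    step (e , f) F (sp , ef ∷ ind , _) = ratio-≤ D 6 (N [] F) (N [] ((e , f) ∷ F)) 1≤D
      (subst (λ z → D ℕ.* z ℕ.≤ (D ℕ.+ 6) ℕ.* N [] ((e , f) ∷ F)) (sym (N-cons [] e f F))
        (coarse-arith D (N (e ∷ f ∷ []) F) (N [] ((e , f) ∷ F)) 6≤D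
          (subst (λ z → D ℕ.* N (e ∷ f ∷ []) F ℕ.≤ 3 ℕ.* z) (N-cons [] e f F) (pair-≤ F (sparse-tail sp) ind e f ef))))
    arg : fromℕ (length F) * (fromℕ 6 * inv D) ≡ fromℕ 6 * q
    arg = trans (solve 3 (λ l s i → l :* (s :* i) := s :* (l :* i)) refl (fromℕ (length F)) (fromℕ 6) (inv D))
      (cong (fromℕ 6 *_) (sym (÷ℕ-inv (length F) D)))

  module Fine (t : ℕ) (few : ∀ c → colourCount χ c ℕ.≤ suc t) (100s≤n : 100 ℕ.* suc t ℕ.≤ n) where

    open Sharp t 100s≤n

    s : ℕ
    s = suc t

    1≤n : 1 ℕ.≤ n
    1≤n = ℕ.≤-trans (ℕ.m≤m+n 1 99) n≥100

    n²≤2D : n ℕ.* n ℕ.≤ 2 ℕ.* D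
    n²≤2D = ℕ.≤-trans (ℕ.*-monoʳ-≤ n n≤2n′) (ℕ.≤-reflexive (comm n (n ℕ.∸ 1)))
      where
      comm : ∀ a b → a ℕ.* (2 ℕ.* b) ≡ 2 ℕ.* (a ℕ.* b)
      comm = solve-∀
      n≤2n′ : n ℕ.≤ 2 ℕ.* (n ℕ.∸ 1)
      n≤2n′ = ℕ.≤-trans (ℕ.≤-reflexive (sym (ℕ.m+[n∸m]≡n 1≤n)))
        (ℕ.≤-trans (ℕ.+-monoˡ-≤ (n ℕ.∸ 1) (ℕ.≤-trans (ℕ.m≤m+n 1 98) (ℕ.∸-monoˡ-≤ 1 n≥100)))
          (ℕ.≤-reflexive (cong (n ℕ.∸ 1 ℕ.+_) (sym (ℕ.+-identityʳ _)))))

    1≤D : 1 ℕ.≤ D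
    1≤D = ℕ.*-mono-≤ 1≤n (ℕ.≤-trans (ℕ.m≤m+n 1 98) (ℕ.∸-monoˡ-≤ 1 n≥100))

    η : ℚ
    η = fromℕ (50 ℕ.* s) * inv n

    0≤η : 0ℚ ≤ η
    0≤η = 0≤* (0≤fromℕ (50 ℕ.* s)) (0≤inv n)

    50s≤n : 50 ℕ.* s ℕ.≤ n
    50s≤n = ℕ.≤-trans (ℕ.*-monoˡ-≤ s (ℕ.m≤m+n 50 50)) 100s≤n

    goodF : Good t F
    goodF = F-sparse t few , F-indep , F-distinct

    arg : ∀ c → fromℕ (length F) * (fromℕ c * inv (n ℕ.* D)) ≡ fromℕ c * inv n * q
    arg c = trans (cong (λ z → fromℕ (length F) * (fromℕ c * z)) (inv-* n D 1≤n 1≤D))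
      (trans (solve 4 (λ l c i d → l :* (c :* (i :* d)) := c :* i :* (l :* d)) refl (fromℕ (length F)) (fromℕ c) (inv n) (inv D))
        (cong (fromℕ c * inv n *_) (sym (÷ℕ-inv (length F) D))))

    1+η : fromℕ (n ℕ.+ 50 ℕ.* s) * inv n ≡ 1ℚ + η
    1+η = trans (cong (_* inv n) (fromℕ-+ n (50 ℕ.* s))) (trans (*-distribʳ-+ (inv n) (fromℕ n) (fromℕ (50 ℕ.* s)))
      (cong (_+ η) (fromℕ*inv n 1≤n)))

    1-η : fromℕ (n ℕ.∸ 50 ℕ.* s) * inv n ≡ 1ℚ - η
    1-η = trans (solve 2 (λ x y → x := x :+ y :- y) refl _ η) (cong (_- η)
      (trans (sym (*-distribʳ-+ (inv n) (fromℕ (n ℕ.∸ 50 ℕ.* s)) (fromℕ (50 ℕ.* s))))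
        (trans (cong (_* inv n) (trans (sym (fromℕ-+ (n ℕ.∸ 50 ℕ.* s) (50 ℕ.* s))) (cong fromℕ (ℕ.m∸n+n≡m 50s≤n)))) (fromℕ*inv n 1≤n))))

    fine-≥ : ∃[ L ] 1ℚ ≤ expSum L ((1ℚ + η) * q) * p
    fine-≥ =
      let (L , h) = chain-≥ step F goodF
      in L , to-p-≥ (expSum L ((1ℚ + η) * q)) (≤-trans h (≤-reflexive (cong (λ z → expSum L z * fromℕ (N [] F)) (trans (arg (n ℕ.+ 50 ℕ.* s)) (cong (_* q) 1+η)))))
      where
      open Chain (N []) (Good t) Good-tail (0≤* (0≤fromℕ (n ℕ.+ 50 ℕ.* s)) (0≤inv (n ℕ.* D)))
      step : ∀ B F → Good t (B ∷ F) → fromℕ (N [] F) ≤ (1ℚ + fromℕ (n ℕ.+ 50 ℕ.* s) * inv (n ℕ.* D)) * fromℕ (N [] (B ∷ F))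
      step (e , f) F (sp , ef ∷ ind , _) = ratio-≤ (n ℕ.* D) (n ℕ.+ 50 ℕ.* s) (N [] F) G (ℕ.*-mono-≤ 1≤n 1≤D)
        (subst (λ z → n ℕ.* D ℕ.* z ℕ.≤ (n ℕ.* D ℕ.+ (n ℕ.+ 50 ℕ.* s)) ℕ.* G) (sym (N-cons [] e f F)) (begin
          n ℕ.* D ℕ.* (G ℕ.+ a)                      ≡⟨ e₁ n D G a ⟩
          n ℕ.* D ℕ.* G ℕ.+ n ℕ.* (D ℕ.* a)          ≤⟨ ℕ.+-monoʳ-≤ (n ℕ.* D ℕ.* G) (sharp-arith n s D a G (s≤s z≤n) 100s≤n n²≤2D upper) ⟩
          n ℕ.* D ℕ.* G ℕ.+ (n ℕ.+ 50 ℕ.* s) ℕ.* G   ≡⟨ ℕ.*-distribʳ-+ G (n ℕ.* D) (n ℕ.+ 50 ℕ.* s) ⟨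
          (n ℕ.* D ℕ.+ (n ℕ.+ 50 ℕ.* s)) ℕ.* G       ∎))
        where
        open ℕ.≤-Reasoning
        a = N (e ∷ f ∷ []) F
        G = N [] ((e , f) ∷ F)
        e₁ : ∀ n D G a → n ℕ.* D ℕ.* (G ℕ.+ a) ≡ n ℕ.* D ℕ.* G ℕ.+ n ℕ.* (D ℕ.* a)
        e₁ = solve-∀
        upper : (n ℕ.∸ 24 ℕ.* s) ℕ.* (D ℕ.* a) ℕ.≤ n ℕ.* (G ℕ.+ a)
        upper = ℕ.≤-trans (ℕ.*-monoˡ-≤ (D ℕ.* a) (ℕ.∸-monoʳ-≤ n (ℕ.*-monoʳ-≤ 24 (ℕ.n≤1+n t))))
          (subst (λ z → (n ℕ.∸ 24 ℕ.* t) ℕ.* (D ℕ.* a) ℕ.≤ n ℕ.* z) (N-cons [] e f F)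
            (Pairs.pair-≤-sharp e f ef F (sparse-tail sp) ind))

    -- Rests on `pair-≥`, and so on the fact that no conflict recurs later in the list.
    fine-≤ : ∀ k → expSum k ((1ℚ - η) * q) * p ≤ 1ℚ
    fine-≤ k = to-p-≤ (expSum k ((1ℚ - η) * q)) (≤-trans (≤-reflexive (cong (λ z → expSum k z * fromℕ (N [] F)) (sym (trans (arg (n ℕ.∸ 50 ℕ.* s)) (cong (_* q) 1-η)))))
        (chain-≤ z≤1 step F goodF k))
      where
      c = n ℕ.∸ 50 ℕ.* s
      A = n ℕ.* D
      1≤A : 1 ℕ.≤ A
      1≤A = ℕ.*-mono-≤ 1≤n 1≤D
      open Chain (N []) (Good t) Good-tail (0≤* (0≤fromℕ c) (0≤inv A))
      z≤1 : fromℕ c * inv A ≤ 1ℚ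
      z≤1 = ≤-trans (*-monoʳ (0≤inv A) (fromℕ-mono (ℕ.≤-trans (ℕ.m∸n≤m n (50 ℕ.* s)) (ℕ.m≤m*n n D {{ℕ.>-nonZero 1≤D}}))))
        (≤-reflexive (fromℕ*inv A 1≤A))
      step : ∀ B F → Good t (B ∷ F) → fromℕ (N [] (B ∷ F)) ≤ (1ℚ - fromℕ c * inv A) * fromℕ (N [] F)
      step (e , f) F (sp , ef ∷ ind , fresh ∷ _) = ratio-≥ A c (N [] F) G 1≤A (begin
          A ℕ.* G ℕ.+ c ℕ.* N [] F                   ≤⟨ ℕ.+-monoʳ-≤ (A ℕ.* G) (ℕ.≤-trans (ℕ.*-monoˡ-≤ (N [] F) (ℕ.∸-monoʳ-≤ n (ℕ.≤-trans (ℕ.*-monoʳ-≤ 24 (ℕ.n≤1+n t)) (ℕ.*-monoˡ-≤ s (ℕ.m≤m+n 24 26)))))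
              (Pairs.pair-≥ e f ef F (sparse-tail sp) ind fresh)) ⟩
          A ℕ.* G ℕ.+ n ℕ.* (D ℕ.* a)                ≡⟨ e₁ n D G a ⟩
          A ℕ.* (G ℕ.+ a)                            ≡⟨ cong (A ℕ.*_) (N-cons [] e f F) ⟨
          A ℕ.* N [] F                               ∎)
        where
        open ℕ.≤-Reasoning
        a = N (e ∷ f ∷ []) F
        G = N [] ((e , f) ∷ F)
        e₁ : ∀ n D G a → n ℕ.* D ℕ.* G ℕ.+ n ℕ.* (D ℕ.* a) ≡ n ℕ.* D ℕ.* (G ℕ.+ a)
        e₁ = solve-∀

    -- At most tn²/2 conflicts against D ≥ n²/2. In (3) this turns the error ηq into 50s²/n.
    q≤s : q ≤ fromℕ s
    q≤s = begin
      q                                ≡⟨ ÷ℕ-inv (length F) D ⟩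
      fromℕ (length F) * inv D         ≤⟨ *-monoʳ (0≤inv D) (fromℕ-mono F≤) ⟩
      fromℕ (s ℕ.* D) * inv D          ≡⟨ cong (_* inv D) (fromℕ-* s D) ⟩
      fromℕ s * fromℕ D * inv D        ≡⟨ *-assoc (fromℕ s) (fromℕ D) (inv D) ⟩
      fromℕ s * (fromℕ D * inv D)      ≡⟨ trans (cong (fromℕ s *_) (fromℕ*inv D 1≤D)) (*-identityʳ _) ⟩
      fromℕ s                          ∎
      where
      open ≤-Reasoning
      comm : ∀ s D → s ℕ.* (2 ℕ.* D) ≡ s ℕ.* D ℕ.* 2
      comm = solve-∀
      F≤ : length F ℕ.≤ s ℕ.* D
      F≤ = ℕ.*-cancelʳ-≤ (length F) (s ℕ.* D) 2 (ℕ.≤-trans (ℕ.≤-reflexive (sym (∑∈-const F 2)))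
        (ℕ.≤-trans (Sparse.weight-≤ (F-sparse t few) (λ _ → 1)) (ℕ.≤-trans (ℕ.≤-reflexive (cong (t ℕ.*_) ∑ₑ-1))
          (ℕ.≤-trans (ℕ.*-mono-≤ (ℕ.n≤1+n t) n²≤2D) (ℕ.≤-reflexive (comm s D))))))

-- From real bounds on k to integer bounds on colour classes.

<⇒≱ : ∀ {x y : ℚ} → x < y → ¬ y ≤ x
<⇒≱ x<y y≤x = <-irrefl refl (<-≤-trans x<y y≤x)

-- Integers do not see an error below 1. Thus real inequalities, known only up to ε, become exact
-- ones.
fromℕ-cancel : ∀ a b {x} → x < 1ℚ → fromℕ a ≤ fromℕ b + x → a ℕ.≤ b
fromℕ-cancel a b {x} x<1 h with a ℕ.≤? b
... | yes a≤b = a≤b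
... | no  a≰b = contradiction
  (≤-trans (≤-reflexive (trans (+-comm (fromℕ b) 1ℚ) (sym (fromℕ-suc b)))) (fromℕ-mono (ℕ.≰⇒> a≰b)))
  (<⇒≱ (≤-<-trans h (+-monoʳ-< (fromℕ b) x<1)))

¾<1 : ½ + ½ * ½ < 1ℚ
¾<1 = toWitness {a? = (½ + ½ * ½) <? 1ℚ} _

0<½ : 0ℚ < ½
0<½ = positive⁻¹ ½

scale-≤ : ∀ (x k : ℝ) c n → x ≤ᵣ k → k *ᵣ fromℕᵣ c ≤ᵣ fromℕᵣ n →
  ∃[ N ] (∀ j → N ℕ.≤ j → seq x j * fromℕ c ≤ fromℕ n + (½ + ½ * ½))
scale-≤ x k c n x≤k kc≤n =
  -- This error gets multiplied by c; it and the second one then add up to at most ¾.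
  let ε = ½ * 1/suc c
      (N₁ , h₁) = x≤k ε (0<½* (0<1/suc c))
      (N₂ , h₂) = kc≤n (½ * ½) (0<½* 0<½)
  in N₁ ℕ.⊔ N₂ , λ j j≥ → begin
    seq x j * fromℕ c                   ≤⟨ *-monoʳ (0≤fromℕ c) (h₁ j (ℕ.≤-trans (ℕ.m≤m⊔n N₁ N₂) j≥)) ⟩
    (seq k j + ε) * fromℕ c             ≡⟨ *-distribʳ-+ (fromℕ c) (seq k j) ε ⟩
    seq k j * fromℕ c + ε * fromℕ c     ≤⟨ +-mono-≤ (h₂ j (ℕ.≤-trans (ℕ.m≤n⊔m N₁ N₂) j≥)) (≤-trans (≤-reflexive (*-comm ε (fromℕ c))) (shrink c 0<½ (0≤fromℕ c) ≤-refl)) ⟩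
    fromℕ n + ½ * ½ + ½                 ≡⟨ solve 3 (λ n a b → n :+ a :+ b := n :+ (b :+ a)) refl (fromℕ n) (½ * ½) ½ ⟩
    fromℕ n + (½ + ½ * ½)               ∎
  where open ≤-Reasoning

scale-ℕ : ∀ (k : ℝ) K c n → fromℕᵣ K ≤ᵣ k → k *ᵣ fromℕᵣ c ≤ᵣ fromℕᵣ n → K ℕ.* c ℕ.≤ n
scale-ℕ k K c n K≤k kc≤n = let (N , h) = scale-≤ (fromℕᵣ K) k c n K≤k kc≤n in
  fromℕ-cancel (K ℕ.* c) n ¾<1 (subst (_≤ fromℕ n + (½ + ½ * ½)) (sym (fromℕ-* K c)) (h N ℕ.≤-refl))

-- The 2 in front of K is slack for rounding. If X = Kc had X² > n, an approximation s/M of √n with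
-- M ≥ 2X would give 2nM < 2Xs + 2X ≤ (n + 2)M and so n < 2.
scale-√ : ∀ (k : ℝ) K c n → 2 ℕ.≤ n → fromℕᵣ (2 ℕ.* K) *ᵣ √ n ≤ᵣ k → k *ᵣ fromℕᵣ c ≤ᵣ fromℕᵣ n →
  (K ℕ.* c) ℕ.* (K ℕ.* c) ℕ.≤ n
scale-√ k K c n 2≤n K√n≤k kc≤n with (K ℕ.* c) ℕ.* (K ℕ.* c) ℕ.≤? n
... | yes h = h
... | no ¬h = contradiction 2≤n (ℕ.<⇒≱ n<2)
  where
  X = K ℕ.* c
  bound = scale-≤ (fromℕᵣ (2 ℕ.* K) *ᵣ √ n) k c n K√n≤k kc≤n
  j = proj₁ bound ℕ.⊔ (2 ℕ.* X)
  M = suc j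
  s = ⌊√ n ℕ.* (M ℕ.* M) ⌋
  h : fromℕ (2 ℕ.* K) * √approx n j * fromℕ c ≤ fromℕ n + (½ + ½ * ½)
  h = proj₂ bound j (ℕ.m≤m⊔n (proj₁ bound) (2 ℕ.* X))
  2X≤M : 2 ℕ.* X ℕ.≤ M
  2X≤M = ℕ.≤-trans (ℕ.m≤n⊔m (proj₁ bound) (2 ℕ.* X)) (ℕ.n≤1+n j)
  2Xs≤ : 2 ℕ.* X ℕ.* s ℕ.≤ suc n ℕ.* M
  2Xs≤ = fromℕ-cancel (2 ℕ.* X ℕ.* s) (suc n ℕ.* M) (positive⁻¹ 1ℚ) (begin
    fromℕ (2 ℕ.* X ℕ.* s)                            ≡⟨ cong fromℕ (eq K c s) ⟩
    fromℕ (2 ℕ.* K ℕ.* s ℕ.* c)                      ≡⟨ trans (fromℕ-* (2 ℕ.* K ℕ.* s) c) (cong (_* fromℕ c) (fromℕ-* (2 ℕ.* K) s)) ⟩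
    fromℕ (2 ℕ.* K) * fromℕ s * fromℕ c              ≡⟨ cong (λ z → fromℕ (2 ℕ.* K) * z * fromℕ c) s≡ ⟩
    fromℕ (2 ℕ.* K) * (√approx n j * fromℕ M) * fromℕ c ≡⟨ solve 4 (λ k a m c → k :* (a :* m) :* c := k :* a :* c :* m) refl (fromℕ (2 ℕ.* K)) (√approx n j) (fromℕ M) (fromℕ c) ⟩
    fromℕ (2 ℕ.* K) * √approx n j * fromℕ c * fromℕ M ≤⟨ *-monoʳ (0≤fromℕ M) (≤-trans h (+-monoʳ-≤ (fromℕ n) (<⇒≤ ¾<1))) ⟩
    (fromℕ n + 1ℚ) * fromℕ M                         ≡⟨ cong (_* fromℕ M) (trans (+-comm (fromℕ n) 1ℚ) (sym (fromℕ-suc n))) ⟩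
    fromℕ (suc n) * fromℕ M                          ≡⟨ trans (sym (fromℕ-* (suc n) M)) (sym (+-identityʳ _)) ⟩
    fromℕ (suc n ℕ.* M) + 0ℚ                         ∎)
    where
    open ≤-Reasoning
    eq : ∀ K c s → 2 ℕ.* (K ℕ.* c) ℕ.* s ≡ 2 ℕ.* K ℕ.* s ℕ.* c
    eq = solve-∀
    s≡ : fromℕ s ≡ √approx n j * fromℕ M
    s≡ = sym (trans (cong (_* fromℕ M) (÷ℕ-inv s M)) (trans (*-assoc (fromℕ s) (inv M) (fromℕ M))
      (trans (cong (fromℕ s *_) (trans (*-comm (inv M) (fromℕ M)) (fromℕ*inv M (s≤s z≤n)))) (*-identityʳ (fromℕ s)))))
  open ℕ.≤-Reasoning
  nM<Xs : n ℕ.* M ℕ.< X ℕ.* suc s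
  nM<Xs = square-cancel-< (n ℕ.* M) (X ℕ.* suc s) (begin-strict
    n ℕ.* M ℕ.* (n ℕ.* M)               ≡⟨ eq n M ⟩
    n ℕ.* (n ℕ.* (M ℕ.* M))             ≤⟨ ℕ.*-monoˡ-≤ (n ℕ.* (M ℕ.* M)) (ℕ.<⇒≤ (ℕ.≰⇒> ¬h)) ⟩
    X ℕ.* X ℕ.* (n ℕ.* (M ℕ.* M))       <⟨ ℕ.*-monoʳ-< (X ℕ.* X) {{ℕ.>-nonZero (ℕ.≤-trans (s≤s z≤n) (ℕ.≰⇒> ¬h))}} (⌊√⌋-upper (n ℕ.* (M ℕ.* M))) ⟩
    X ℕ.* X ℕ.* (suc s ℕ.* suc s)       ≡⟨ *-square X (suc s) ⟨
    X ℕ.* suc s ℕ.* (X ℕ.* suc s)       ∎)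
    where
    eq : ∀ n M → n ℕ.* M ℕ.* (n ℕ.* M) ≡ n ℕ.* (n ℕ.* (M ℕ.* M))
    eq = solve-∀
  n<2 : n ℕ.< 2
  n<2 = ℕ.+-cancelˡ-< n n 2 (ℕ.*-cancelʳ-< M (n ℕ.+ n) (n ℕ.+ 2) (begin-strict
    (n ℕ.+ n) ℕ.* M                  ≡⟨ e₁ n M ⟩
    2 ℕ.* (n ℕ.* M)                  <⟨ ℕ.*-monoʳ-< 2 nM<Xs ⟩
    2 ℕ.* (X ℕ.* suc s)              ≡⟨ e₂ X s ⟩
    2 ℕ.* X ℕ.* s ℕ.+ 2 ℕ.* X        ≤⟨ ℕ.+-mono-≤ 2Xs≤ 2X≤M ⟩
    suc n ℕ.* M ℕ.+ M                ≡⟨ e₃ n M ⟩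
    (n ℕ.+ 2) ℕ.* M                  ∎))
    where
    e₁ : ∀ n M → (n ℕ.+ n) ℕ.* M ≡ 2 ℕ.* (n ℕ.* M)
    e₁ = solve-∀
    e₂ : ∀ X s → 2 ℕ.* (X ℕ.* (1 ℕ.+ s)) ≡ 2 ℕ.* X ℕ.* s ℕ.+ 2 ℕ.* X
    e₂ = solve-∀
    e₃ : ∀ n M → (1 ℕ.+ n) ℕ.* M ℕ.+ M ≡ (n ℕ.+ 2) ℕ.* M
    e₃ = solve-∀

-- As n ≥ 1, there is an edge, and its colour forces r / K ≥ 1; the quotient can therefore be
-- written `suc t`.
threshold : ∀ {n} (χ : Colouring n) K r → 1 ℕ.≤ K → 1 ℕ.≤ n → (∀ c → K ℕ.* colourCount χ c ℕ.≤ r) →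
  ∃[ t ] ((∀ c → colourCount χ c ℕ.≤ suc t) × K ℕ.* suc t ℕ.≤ r)
threshold {suc n′} χ K@(suc _) r _ _ h = go (r ℕ./ K) count≤ (ℕ.m/n*n≤m r K)
  where
  count≤ : ∀ c → colourCount χ c ℕ.≤ r ℕ./ K
  count≤ c = subst (ℕ._≤ r ℕ./ K) (trans (cong (ℕ._/ K) (ℕ.*-comm K (colourCount χ c))) (ℕ.m*n/n≡m (colourCount χ c) K))
    (ℕ./-monoˡ-≤ K (h c))
  e : Edge (suc n′)
  e = zero , zero
  1≤count : 1 ℕ.≤ colourCount χ (χ e)
  1≤count = ∈-length (∈-filter⁺ (λ x → χ x ℕ.≟ χ e) (Matchings.∈-edges _ e) refl)
  go : ∀ s → (∀ c → colourCount χ c ℕ.≤ s) → s ℕ.* K ℕ.≤ r →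
    ∃[ t ] ((∀ c → colourCount χ c ℕ.≤ suc t) × K ℕ.* suc t ℕ.≤ r)
  go zero    few _    = contradiction (few (χ e)) (ℕ.<⇒≱ 1≤count)
  go (suc t) few sK≤r = t , few , ℕ.≤-trans (ℕ.≤-reflexive (ℕ.*-comm K (suc t))) sK≤r

-- The error terms and their convergence.

exp-neg-≤ : ∀ {p y} L → 0ℚ ≤ p → p ≤ 1ℚ → 0ℚ ≤ y → 1ℚ ≤ expSum L y * p →
  ∀ ε → 0ℚ < ε → ∃[ N ] (∀ j → N ℕ.≤ j → expSum j (- y) ≤ p + ε)
exp-neg-≤ {p} {y} L 0≤p p≤1 0≤y h ε 0<ε =
  let (R , y≤R) = archimedean y
      (N , hN) = expSum-inverse (0≤fromℕ R) ε 0<ε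
  in N ℕ.⊔ L , λ j j≥ → case j (ℕ.≤-trans (ℕ.m≤n⊔m N L) j≥) (hN j (ℕ.≤-trans (ℕ.m≤m⊔n N L) j≥) y 0≤y y≤R)
  where
  open ≤-Reasoning
  case : ∀ j → L ℕ.≤ j → ∣ expSum j (- y) * expSum j y - 1ℚ ∣ℚ ≤ ε → expSum j (- y) ≤ p + ε
  case j L≤j close with ≤-total (expSum j (- y)) 0ℚ
  -- A truncation at a negative argument may be negative; then p ≥ 0 suffices.
  ... | inj₁ E≤0 = ≤-trans E≤0 (0≤+ 0≤p (<⇒≤ 0<ε))
  ... | inj₂ 0≤E = begin
    E                        ≡⟨ *-identityʳ E ⟨
    E * 1ℚ                   ≤⟨ *-monoˡ 0≤E (≤-trans h (*-monoʳ 0≤p (expSum-monoˡ 0≤y L≤j))) ⟩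
    E * (E⁺ * p)             ≡⟨ solve 3 (λ e f p → e :* (f :* p) := p :+ p :* (e :* f :- con 1ℚ)) refl E E⁺ p ⟩
    p + p * (E * E⁺ - 1ℚ)    ≤⟨ +-monoʳ-≤ p (≤-trans (*-monoˡ 0≤p (≤-trans (p≤∣p∣ _) close)) (≤-trans (*-monoʳ (<⇒≤ 0<ε) p≤1) (≤-reflexive (*-identityˡ ε)))) ⟩
    p + ε                    ∎
    where
    E  = expSum j (- y)
    E⁺ = expSum j y

-- A positive real is eventually at least some positive rational ε₀, so rational tolerances suffice.
o[1]-intro : ∀ (δ : ℕ → ℝ) →
  (∀ ε → 0ℚ < ε → Eventually λ n → Eventually λ j → seq (δ n) j ≤ ε × - ε ≤ seq (δ n) j) → δ ∈o[1]
o[1]-intro δ h ε (ε₀ , 0<ε₀ , N₀ , ε≥) =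
  let (N , hN) = h ε₀ 0<ε₀
      ε₀≤ : ∀ j → N₀ ℕ.≤ j → ε₀ ≤ seq ε j
      ε₀≤ j j≥ = ≤-trans (≤-reflexive (sym (+-identityˡ ε₀))) (ε≥ j j≥)
  in N , λ n n≥ → let (J , hJ) = hN n n≥ in
    (λ ε′ 0<ε′ → J ℕ.⊔ N₀ , λ j j≥ → ≤-trans (neg-antimono-≤ (ε₀≤ j (ℕ.≤-trans (ℕ.m≤n⊔m J N₀) j≥)))
      (≤-trans (proj₂ (hJ j (ℕ.≤-trans (ℕ.m≤m⊔n J N₀) j≥))) (≤+ (<⇒≤ 0<ε′)))) ,
    (λ ε′ 0<ε′ → J ℕ.⊔ N₀ , λ j j≥ → ≤-trans (proj₁ (hJ j (ℕ.≤-trans (ℕ.m≤m⊔n J N₀) j≥)))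
      (≤-trans (ε₀≤ j (ℕ.≤-trans (ℕ.m≤n⊔m J N₀) j≥)) (≤+ (<⇒≤ 0<ε′))))

ratioLog : ∀ b′ a → suc b′ ℕ.≤ a → LogSeq (suc b′ ÷ℕ a)
ratioLog b′ a b≤a = logSeq b′ (a ℕ.∸ suc b′) (begin
  (suc b′ ÷ℕ a) * fromℕ (suc b′ ℕ.+ (a ℕ.∸ suc b′)) ≡⟨ cong₂ _*_ (÷ℕ-inv (suc b′) a) (cong fromℕ (ℕ.m+[n∸m]≡n b≤a)) ⟩
  fromℕ (suc b′) * inv a * fromℕ a                  ≡⟨ solve 3 (λ b i a → b :* i :* a := b :* (a :* i)) refl (fromℕ (suc b′)) (inv a) (fromℕ a) ⟩
  fromℕ (suc b′) * (fromℕ a * inv a)                ≡⟨ cong (fromℕ (suc b′) *_) (fromℕ*inv a (ℕ.≤-trans (s≤s z≤n) b≤a)) ⟩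
  fromℕ (suc b′) * 1ℚ                               ≡⟨ *-identityʳ _ ⟩
  fromℕ (suc b′)                                    ∎)
  where open ≡-Reasoning

-- - log p / q - 1 for p = b / a and q = f / d; the junk value 0 when p or q vanishes
-- is the right one for q = 0, as then p = 1.
logError : ∀ (f d b a : ℕ) → b ℕ.≤ a → ℝ
logError zero     d b        a b≤a = 0ᵣ
logError (suc f′) d zero     a b≤a = 0ᵣ
logError (suc f′) d (suc b′) a b≤a =
  mkℝ (LogSeq.H log) (H-cauchy (0≤÷ℕ (suc b′) a) log) *ᵣ fromℚ (d ÷ℕ suc f′) +ᵣ -ᵣ 1ᵣ
  where log = ratioLog b′ a b≤a

module LogError (d a : ℕ) (1≤d : 1 ℕ.≤ d) (η : ℚ) (0≤η : 0ℚ ≤ η) (η≤1 : η ≤ 1ℚ) where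

  Upper Lower : ℕ → ℕ → Set
  Upper f b = ∀ k → expSum k ((1ℚ - η) * (f ÷ℕ d)) * (b ÷ℕ a) ≤ 1ℚ
  Lower f b = ∃[ L ] 1ℚ ≤ expSum L ((1ℚ + η) * (f ÷ℕ d)) * (b ÷ℕ a)

  -- `Upper` and `Lower` place -log p between (1 - η)q and (1 + η)q; dividing by q bounds δ by η.
  logError-correct : ∀ f b (h : b ℕ.≤ a) → Upper f b → Lower f b →
    (∀ ε → 0ℚ < ε → Eventually λ j → seq (logError f d b a h) j ≤ η + ε × - (η + ε) ≤ seq (logError f d b a h) j)
    × fromℚ (b ÷ℕ a) ≈ᵣ exp (-ᵣ ((1ᵣ +ᵣ logError f d b a h) *ᵣ fromℚ (f ÷ℕ d)))
  logError-correct zero b h up (L , low) =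
    (λ ε 0<ε → 0 , λ _ _ → 0≤+ 0≤η (<⇒≤ 0<ε) , neg-antimono-≤ (0≤+ 0≤η (<⇒≤ 0<ε))) ,
    λ ε 0<ε → 1 , λ { (suc j) _ → ≤-trans (≤-reflexive (trans
      (cong₂ (λ x y → ∣ x - expSum (suc j) (- ((1ℚ + 0ℚ) * y)) ∣ℚ) p≡1 q≡0)
      (trans (cong (λ z → ∣ 1ℚ - expSum (suc j) (- z) ∣ℚ) (*-zeroʳ (1ℚ + 0ℚ))) (cong (λ z → ∣ 1ℚ - z ∣ℚ) (expSum-0 j))))) (<⇒≤ 0<ε) }
    where
    q≡0 : zero ÷ℕ d ≡ 0ℚ
    q≡0 = trans (÷ℕ-inv zero d) (*-zeroˡ (inv d))
    p≡1 : b ÷ℕ a ≡ 1ℚ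
    p≡1 = ≤-antisym
      (≤-trans (≤-reflexive (sym (*-identityˡ (b ÷ℕ a)))) (up 1))
      (≤-trans low (≤-trans (*-monoʳ (0≤÷ℕ b a) (≤-trans (≤-reflexive (cong (expSum L) (trans (cong ((1ℚ + η) *_) q≡0) (*-zeroʳ (1ℚ + η)))))
        (≤-trans (expSum-monoˡ ≤-refl (ℕ.n≤1+n L)) (≤-reflexive (expSum-0 L))))) (≤-reflexive (*-identityˡ (b ÷ℕ a)))))
  -- p = 0 contradicts 1 ≤ e^t p, so this default value never counts.
  logError-correct (suc f′) zero h up (L , low) = contradiction
    (≤-trans low (≤-reflexive (trans (cong (expSum L _ *_) (trans (÷ℕ-inv zero a) (*-zeroˡ (inv a)))) (*-zeroʳ (expSum L _)))))
    (<⇒≱ (positive⁻¹ 1ℚ))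
  logError-correct (suc f′) (suc b′) h up (L , low) = small , equal
    where
    open ≤-Reasoning
    f = suc f′
    p = suc b′ ÷ℕ a
    q = f ÷ℕ d
    i = d ÷ℕ f
    log : LogSeq p
    log = ratioLog b′ a h
    open LogSeq log using (H; exp-H≤)
    0≤p = 0≤÷ℕ (suc b′) a
    0≤i = 0≤÷ℕ d f
    0≤q = 0≤÷ℕ f d
    qi≡1 : q * i ≡ 1ℚ
    qi≡1 = trans (cong₂ _*_ (÷ℕ-inv f d) (÷ℕ-inv d f))
      (trans (solve 4 (λ f x d y → f :* x :* (d :* y) := (f :* y) :* (d :* x)) refl (fromℕ f) (inv d) (fromℕ d) (inv f))
        (cong₂ _*_ (fromℕ*inv f (s≤s z≤n)) (fromℕ*inv d 1≤d)))
    equal : fromℚ p ≈ᵣ exp (-ᵣ ((1ᵣ +ᵣ logError f d (suc b′) a h) *ᵣ fromℚ q))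
    equal ε 0<ε =
      let (J , hJ) = exp-neg-H 0≤p log a 1≤ap ε 0<ε
      in J , λ j j≥ → subst (λ z → ∣ p - expSum j (- z) ∣ℚ ≤ ε)
        (sym (trans (solve 3 (λ H i q → (con 1ℚ :+ (H :* i :+ (:- con 1ℚ))) :* q := H :* (q :* i)) refl (H j) i q)
          (trans (cong (H j *_) qi≡1) (*-identityʳ (H j))))) (hJ j j≥)
      where
      1≤ap : 1ℚ ≤ fromℕ a * p
      1≤ap = ≤-trans (fromℕ-mono {1} {suc b′} (s≤s z≤n)) (≤-reflexive (sym (trans (cong (fromℕ a *_) (÷ℕ-inv (suc b′) a))
        (trans (solve 3 (λ a b i → a :* (b :* i) := b :* (a :* i)) refl (fromℕ a) (fromℕ (suc b′)) (inv a))
          (trans (cong (fromℕ (suc b′) *_) (fromℕ*inv a (ℕ.≤-trans (s≤s z≤n) h))) (*-identityʳ _))))))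
    small : ∀ ε → 0ℚ < ε → Eventually λ j → seq (logError f d (suc b′) a h) j ≤ η + ε × - (η + ε) ≤ seq (logError f d (suc b′) a h) j
    small ε 0<ε =
      let (R , i≤R) = archimedean i
          (J , hJ) = 1/suc-small (ε * 1/suc R) (0<* 0<ε (0<1/suc R))
          0≤1-η = ≤⇒0≤- η≤1
      in J , λ j j≥ →
        let h₁ : H j ≤ (1ℚ + η) * q
            h₁ = above-H 0≤p log L (0≤* (0≤+ 0≤1 0≤η) 0≤q) low j
            h₂ : (1ℚ - η) * q ≤ H j + 1/suc j
            h₂ = below-H 0≤p log (0≤* 0≤1-η 0≤q) up j
            iu≤ε : i * 1/suc j ≤ ε
            iu≤ε = ≤-trans (*-monoˡ 0≤i (≤-trans (1/suc-anti j≥) hJ)) (shrink R 0<ε 0≤i i≤R)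
        in (begin
            H j * i + - 1ℚ                      ≤⟨ +-monoˡ-≤ (- 1ℚ) (*-monoʳ 0≤i h₁) ⟩
            (1ℚ + η) * q * i + - 1ℚ             ≡⟨ cong (_+ - 1ℚ) (trans (*-assoc (1ℚ + η) q i) (trans (cong ((1ℚ + η) *_) qi≡1) (*-identityʳ (1ℚ + η)))) ⟩
            1ℚ + η + - 1ℚ                       ≡⟨ solve 1 (λ e → con 1ℚ :+ e :+ (:- con 1ℚ) := e) refl η ⟩
            η                                   ≤⟨ ≤+ (<⇒≤ 0<ε) ⟩
            η + ε                               ∎) ,
          (begin
            - (η + ε)                           ≤⟨ neg-antimono-≤ (+-monoʳ-≤ η iu≤ε) ⟩
            - (η + i * 1/suc j)                 ≡⟨ solve 2 (λ e w → :- (e :+ w) := (con 1ℚ :- e) :- w :+ (:- con 1ℚ)) refl η (i * 1/suc j) ⟩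
            (1ℚ - η) - i * 1/suc j + - 1ℚ       ≡⟨ cong (λ z → z - i * 1/suc j + - 1ℚ) (trans (*-assoc (1ℚ - η) q i) (trans (cong ((1ℚ - η) *_) qi≡1) (*-identityʳ (1ℚ - η)))) ⟨
            (1ℚ - η) * q * i - i * 1/suc j + - 1ℚ ≤⟨ +-monoˡ-≤ (- 1ℚ) (+-monoˡ-≤ (- (i * 1/suc j)) (*-monoʳ 0≤i h₂)) ⟩
            (H j + 1/suc j) * i - i * 1/suc j + - 1ℚ ≡⟨ cong (_+ - 1ℚ) (solve 3 (λ H u i → (H :+ u) :* i :- i :* u := H :* i) refl (H j) (1/suc j) i) ⟩
            H j * i + - 1ℚ                      ∎)

-- In (3) the equation p = e^(-μ)(1 + δ) is solved for δ directly, without a logarithm.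
expError : ℚ → ℚ → ℝ
expError p q = fromℚ p *ᵣ exp (fromℚ q) +ᵣ -ᵣ 1ᵣ

expError-equal : ∀ {p q} → 0ℚ ≤ p → p ≤ 1ℚ → 0ℚ ≤ q → fromℚ p ≈ᵣ exp (-ᵣ fromℚ q) *ᵣ (1ᵣ +ᵣ expError p q)
expError-equal {p} {q} 0≤p p≤1 0≤q ε 0<ε =
  let (R , q≤R) = archimedean q
      (N , hN) = expSum-inverse (0≤fromℕ R) ε 0<ε
  in N , λ j j≥ → let E = expSum j (- q) ; E⁺ = expSum j q in begin
    ∣ p - E * (1ℚ + (p * E⁺ + - 1ℚ)) ∣ℚ   ≡⟨ cong ∣_∣ℚ (solve 3 (λ p e f → p :- e :* (con 1ℚ :+ (p :* f :+ (:- con 1ℚ))) := p :* (:- (e :* f :- con 1ℚ))) refl p E E⁺) ⟩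
    ∣ p * (- (E * E⁺ - 1ℚ)) ∣ℚ            ≡⟨ trans (∣p*q∣≡∣p∣*∣q∣ p (- (E * E⁺ - 1ℚ))) (cong₂ _*_ (0≤p⇒∣p∣≡p 0≤p) (∣-p∣≡∣p∣ (E * E⁺ - 1ℚ))) ⟩
    p * ∣ E * E⁺ - 1ℚ ∣ℚ                  ≤⟨ *-mono-≤-nonNeg 0≤p p≤1 (0≤∣p∣ _) (hN j j≥ q 0≤q q≤R) ⟩
    1ℚ * ε                                ≡⟨ *-identityˡ ε ⟩
    ε                                     ∎
  where open ≤-Reasoning

-- p e^q lies between e^(-w) and e^w for w = ηq, and if w ≤ ½ both are within 2w of 1.
expError-small : ∀ {p q η} → 0ℚ ≤ p → 0ℚ ≤ q → 0ℚ ≤ η → η ≤ 1ℚ → η * q ≤ ½ →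
  (∀ k → expSum k ((1ℚ - η) * q) * p ≤ 1ℚ) → ∃[ L ] 1ℚ ≤ expSum L ((1ℚ + η) * q) * p →
  Eventually λ j → seq (expError p q) j ≤ η * q + η * q × - (η * q + η * q) ≤ seq (expError p q) j
expError-small {p} {q} {η} 0≤p 0≤q 0≤η η≤1 w≤½ up (L , low) = L , λ j j≥ →
  let E  = expSum j q
      Ew = expSum j w
      Ew≤ : Ew ≤ 1ℚ + (w + w)
      Ew≤ = begin
        Ew                                ≤⟨ ≤-cert (0≤* (0≤expSum 0≤w j) (0≤* 0≤w 0≤1-2w)) (solve 2 (λ e w → e :* (con 1ℚ :- w) :* (con 1ℚ :+ (w :+ w)) :- e := e :* (w :* (con 1ℚ :- (w :+ w)))) refl Ew w) ⟩
        Ew * (1ℚ - w) * (1ℚ + (w + w))    ≤⟨ *-monoʳ (0≤+ 0≤1 0≤2w) (expSum-geometric 0≤w w≤1 j) ⟩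
        1ℚ * (1ℚ + (w + w))               ≡⟨ *-identityˡ _ ⟩
        1ℚ + (w + w)                      ∎
      upper : p * E ≤ 1ℚ + (w + w)
      upper = begin
        p * E                             ≡⟨ cong (λ z → p * expSum j z) (solve 2 (λ e q → q := (con 1ℚ :- e) :* q :+ e :* q) refl η q) ⟩
        p * expSum j ((1ℚ - η) * q + w)   ≤⟨ *-monoˡ 0≤p (expSum-+-≤ j 0≤v 0≤w) ⟩
        p * (expSum j ((1ℚ - η) * q) * Ew) ≡⟨ solve 3 (λ p a b → p :* (a :* b) := a :* p :* b) refl p (expSum j ((1ℚ - η) * q)) Ew ⟩
        expSum j ((1ℚ - η) * q) * p * Ew  ≤⟨ *-monoʳ (0≤expSum 0≤w j) (up j) ⟩
        1ℚ * Ew                           ≡⟨ *-identityˡ Ew ⟩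
        Ew                                ≤⟨ Ew≤ ⟩
        1ℚ + (w + w)                      ∎
      lower : 1ℚ - w ≤ p * E
      lower = begin
        1ℚ - w                                    ≡⟨ *-identityˡ (1ℚ - w) ⟨
        1ℚ * (1ℚ - w)                             ≤⟨ *-monoʳ (≤⇒0≤- w≤1) low ⟩
        expSum L ((1ℚ + η) * q) * p * (1ℚ - w)    ≤⟨ *-monoʳ (≤⇒0≤- w≤1) (*-monoʳ 0≤p (≤-trans (expSum-monoˡ (0≤* (0≤+ 0≤1 0≤η) 0≤q) j≥)
              (≤-trans (≤-reflexive (cong (expSum j) (solve 2 (λ e q → (con 1ℚ :+ e) :* q := q :+ e :* q) refl η q))) (expSum-+-≤ j 0≤q 0≤w)))) ⟩
        E * Ew * p * (1ℚ - w)                     ≡⟨ solve 4 (λ e f p v → e :* f :* p :* v := p :* e :* (f :* v)) refl E Ew p (1ℚ - w) ⟩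
        p * E * (Ew * (1ℚ - w))                   ≤⟨ *-monoˡ (0≤* 0≤p (0≤expSum 0≤q j)) (expSum-geometric 0≤w w≤1 j) ⟩
        p * E * 1ℚ                                ≡⟨ *-identityʳ _ ⟩
        p * E                                     ∎
  in ≤-trans (+-monoˡ-≤ (- 1ℚ) upper) (≤-reflexive (solve 1 (λ w → con 1ℚ :+ w :+ (:- con 1ℚ) := w) refl (w + w))) ,
     ≤-trans (≤-cert 0≤w (solve 1 (λ w → (con 1ℚ :- w :+ (:- con 1ℚ)) :- (:- (w :+ w)) := w) refl w)) (+-monoˡ-≤ (- 1ℚ) lower)
  where
  open ≤-Reasoning
  w = η * q
  0≤w = 0≤* 0≤η 0≤q
  0≤2w = 0≤+ 0≤w 0≤w
  0≤v = 0≤* (≤⇒0≤- η≤1) 0≤q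
  0≤1-2w : 0ℚ ≤ 1ℚ - (w + w)
  0≤1-2w = ≤⇒0≤- (+-mono-≤ w≤½ w≤½)
  w≤1 : w ≤ 1ℚ
  w≤1 = ≤-trans (≤+ 0≤w) (+-mono-≤ w≤½ w≤½)

frac-≤ : ∀ a b {c d} → 1 ℕ.≤ c → 1 ℕ.≤ d → a ℕ.* d ℕ.≤ b ℕ.* c → fromℕ a * inv c ≤ fromℕ b * inv d
frac-≤ a b {suc c} {suc d} _ _ h = subst₂ _≤_ (÷ℕ-inv a (suc c)) (÷ℕ-inv b (suc d)) (/-mono-≤ a b c d h)

small-50/K : ∀ ε → 0ℚ < ε → ∃[ K ] (100 ℕ.≤ K × fromℕ 50 * inv K ≤ ε)
small-50/K ε 0<ε =
  let (N , hN) = 1/suc-small (ε * 1/suc 50) (0<* 0<ε (0<1/suc 50))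
  in 100 ℕ.+ N , ℕ.m≤m+n 100 N ,
    ≤-trans (*-monoˡ (0≤fromℕ 50) (≤-trans (1/suc-anti (ℕ.m≤n+m N 99)) hN)) (shrink 50 0<ε (0≤fromℕ 50) ≤-refl)

50/K≤½ : ∀ K → 100 ℕ.≤ K → fromℕ 50 * inv K ≤ ½
50/K≤½ (suc K) (s≤s 99≤K) = ≤-trans (*-monoˡ (0≤fromℕ 50) (1/suc-anti 99≤K)) (toWitness {a? = (fromℕ 50 * 1/suc 99) ≤? ½} _)

coarse-≥ : ∀ n (χ : Colouring n) → (∀ c → 12 ℕ.* colourCount χ c ℕ.≤ n) →
  ∃[ L ] 1ℚ ≤ expSum L (fromℕ 6 * Estimates.q n χ) * Estimates.p n χ
-- For n = 0 there is no edge to feed `threshold`, but no conflict either.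
coarse-≥ zero    χ h = 1 , Estimates.to-p-≥ 0 χ 1ℚ (≤-reflexive (sym (*-identityˡ _)))
coarse-≥ (suc n) χ h =
  let (t , few , 12s≤n) = threshold χ 12 (suc n) (s≤s z≤n) (s≤s z≤n) h
  in Estimates.coarse (suc n) χ t few 12s≤n

-- The three ranges of k.

part₁ : ∀ (k : ℝ) → fromℕᵣ 12 ≤ᵣ k →
  ∃[ c₁ ] ∃[ c₂ ] (c₁ <ᵣ 1ᵣ × 1ᵣ <ᵣ c₂ ×
    (∀ (n : ℕ) (χ : Colouring n) → Bounded k χ →
      exp (-ᵣ (c₂ *ᵣ μ χ)) ≤ᵣ Pr[rainbow] χ ×
      Pr[rainbow] χ ≤ᵣ exp (-ᵣ (c₁ *ᵣ μ χ))))
-- The 6 is that of `coarse-arith`; with 0 as c₁ the upper bound reads p ≤ 1.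
part₁ k 12≤k = 0ᵣ , fromℕᵣ 6 ,
  (½ , 0<½ , 0 , λ _ _ → toWitness {a? = (0ℚ + ½) ≤? 1ℚ} _) ,
  (1ℚ , positive⁻¹ 1ℚ , 0 , λ _ _ → toWitness {a? = (1ℚ + 1ℚ) ≤? fromℕ 6} _) ,
  λ n χ bounded → let open Estimates n χ ; (L , h) = coarse-≥ n χ (λ c → scale-ℕ k 12 (colourCount χ c) n 12≤k (bounded c)) in
    exp-neg-≤ L 0≤p p≤1 (0≤* (0≤fromℕ 6) 0≤q) h ,
    λ ε 0<ε → 1 , λ { (suc j) _ → ≤-trans p≤1 (≤-trans (≤-reflexive (sym (trans
      (cong (λ z → expSum (suc j) (- z)) (*-zeroˡ q)) (expSum-0 j)))) (≤+ (<⇒≤ 0<ε))) }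

module _ (k : ℕ → ℝ) (χ : ∀ n → Colouring n) (bounded : ∀ n → Bounded (k n) (χ n)) where

  part₂ : k ∈ω[ (λ _ → 1ᵣ) ] →
    ∃[ δ ] (δ ∈o[1] × Eventually λ n → Pr[rainbow] (χ n) ≈ᵣ exp (-ᵣ ((1ᵣ +ᵣ δ n) *ᵣ μ (χ n))))
  part₂ kω = δ , o[1]-intro δ small , equal
    where
    rainbows : ∀ n → List (List (Edge n))
    rainbows n = filter (rainbow? (χ n)) (perfectMatchings n)
    δ : ℕ → ℝ
    δ n = logError (length (conflicts (χ n))) (n ℕ.* (n ℕ.∸ 1)) (length (rainbows n)) (length (perfectMatchings n))
      (length-filter (rainbow? (χ n)) (perfectMatchings n))
    counts : ∀ K → Eventually λ n → 1 ℕ.≤ n × (∀ c → K ℕ.* colourCount (χ n) c ℕ.≤ n)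
    counts K = let (N , h) = kω (fromℕᵣ K) in suc N , λ n n≥ → ℕ.≤-trans (s≤s z≤n) n≥ , λ c →
      scale-ℕ (k n) K (colourCount (χ n) c) n
        (λ ε 0<ε → let (J , hJ) = h n (ℕ.≤-trans (ℕ.n≤1+n N) n≥) ε 0<ε in
          J , λ j j≥ → subst (_≤ seq (k n) j + ε) (*-identityʳ (fromℕ K)) (hJ j j≥))
        (bounded n c)
    -- Once k ≥ K, colour classes have at most n/K edges, so η ≤ 50/K. Large K gives δ → 0, and K =
    -- 100 gives the identity.
    estimate : ∀ K → 100 ℕ.≤ K → Eventually λ n → ∃[ η ] (η ≤ fromℕ 50 * inv K ×
      (∀ ε → 0ℚ < ε → Eventually λ j → seq (δ n) j ≤ η + ε × - (η + ε) ≤ seq (δ n) j) ×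
      Pr[rainbow] (χ n) ≈ᵣ exp (-ᵣ ((1ᵣ +ᵣ δ n) *ᵣ μ (χ n))))
    estimate K K≥100 = let (N , h) = counts K in N , λ n n≥ →
      let (1≤n , few′) = h n n≥
          1≤K = ℕ.≤-trans (ℕ.m≤m+n 1 99) K≥100
          (t , few , Ks≤n) = threshold (χ n) K n 1≤K 1≤n few′
          open Estimates n (χ n) using (p; q; 0≤p; 0≤q; p≤1; module Fine)
          open Fine t few (ℕ.≤-trans (ℕ.*-monoˡ-≤ (suc t) K≥100) Ks≤n) using (η; 0≤η; 1≤D; fine-≤; fine-≥)
          η≤ : η ≤ fromℕ 50 * inv K
          η≤ = frac-≤ (50 ℕ.* suc t) 50 1≤n 1≤K (ℕ.≤-trans (ℕ.≤-reflexive (comm (suc t) K)) (ℕ.*-monoʳ-≤ 50 Ks≤n))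
          η≤1 : η ≤ 1ℚ
          η≤1 = ≤-trans η≤ (≤-trans (50/K≤½ K K≥100) (toWitness {a? = ½ ≤? 1ℚ} _))
          open LogError (n ℕ.* (n ℕ.∸ 1)) (length (perfectMatchings n)) 1≤D η 0≤η η≤1
          (small , equal) = logError-correct (length (conflicts (χ n))) (length (rainbows n)) _ fine-≤ fine-≥
      in η , η≤ , small , equal
      where
      comm : ∀ s K → 50 ℕ.* s ℕ.* K ≡ 50 ℕ.* (K ℕ.* s)
      comm = solve-∀
    small : ∀ ε → 0ℚ < ε → Eventually λ n → Eventually λ j → seq (δ n) j ≤ ε × - ε ≤ seq (δ n) j
    small ε 0<ε =
      let (K , K≥100 , 50/K≤) = small-50/K (½ * ε) (0<½* 0<ε)
          (N , h) = estimate K K≥100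
      in N , λ n n≥ →
        let (η , η≤ , bound , _) = h n n≥
            (J , hJ) = bound (½ * ε) (0<½* 0<ε)
            total : η + ½ * ε ≤ ε
            total = ≤-trans (+-monoˡ-≤ (½ * ε) (≤-trans η≤ 50/K≤)) (≤-reflexive (½*+½* ε))
        in J , λ j j≥ → let (up , low) = hJ j j≥ in
          ≤-trans up total , ≤-trans (neg-antimono-≤ total) low
    equal : Eventually λ n → Pr[rainbow] (χ n) ≈ᵣ exp (-ᵣ ((1ᵣ +ᵣ δ n) *ᵣ μ (χ n)))
    equal = let (N , h) = estimate 100 ℕ.≤-refl in N , λ n n≥ → let (_ , _ , _ , eq) = h n n≥ in eq

  part₃ : k ∈ω[ √ ] →
    ∃[ δ ] (δ ∈o[1] × Eventually λ n → Pr[rainbow] (χ n) ≈ᵣ exp (-ᵣ μ (χ n)) *ᵣ (1ᵣ +ᵣ δ n))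
  part₃ kω = δ , o[1]-intro δ small ,
    0 , λ n _ → let open Estimates n (χ n) in expError-equal 0≤p p≤1 0≤q
    where
    δ : ℕ → ℝ
    δ n = expError (Estimates.p n (χ n)) (Estimates.q n (χ n))
    -- From k ≥ 2K√n follows (Kc)² ≤ n for the size c of a colour class. It is recorded as Kc ≤
    -- ⌊√n⌋, the form that `threshold` accepts.
    counts : ∀ K → Eventually λ n → 2 ℕ.≤ n × (∀ c → K ℕ.* colourCount (χ n) c ℕ.≤ ⌊√ n ⌋)
    counts K = let (N , h) = kω (fromℕᵣ (2 ℕ.* K)) in 2 ℕ.+ N , λ n n≥ →
      let 2≤n = ℕ.≤-trans (ℕ.m≤m+n 2 N) n≥ in 2≤n , λ c →
        ℕ.≤-pred (square-cancel-< (K ℕ.* colourCount (χ n) c) (suc ⌊√ n ⌋)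
          (ℕ.≤-<-trans (scale-√ (k n) K (colourCount (χ n) c) n 2≤n (h n (ℕ.≤-trans (ℕ.m≤n+m N 2) n≥)) (bounded n c))
            (⌊√⌋-upper n)))
    small : ∀ ε → 0ℚ < ε → Eventually λ n → Eventually λ j → seq (δ n) j ≤ ε × - ε ≤ seq (δ n) j
    small ε 0<ε =
      let (K , K≥100 , 50/K≤) = small-50/K (½ * ε) (0<½* 0<ε)
          (N , h) = counts K
      in N , λ n n≥ →
        let (2≤n , few′) = h n n≥
            1≤n = ℕ.≤-trans (s≤s z≤n) 2≤n
            1≤K = ℕ.≤-trans (ℕ.m≤m+n 1 99) K≥100
            (t , few , Ks≤√n) = threshold (χ n) K ⌊√ n ⌋ 1≤K 1≤n few′
            s = suc t
            [Ks]²≤n : (K ℕ.* s) ℕ.* (K ℕ.* s) ℕ.≤ n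
            [Ks]²≤n = ℕ.≤-trans (ℕ.*-mono-≤ Ks≤√n Ks≤√n) (⌊√⌋-lower n)
            1≤Ks : 1 ℕ.≤ K ℕ.* s
            1≤Ks = ℕ.*-mono-≤ 1≤K (s≤s (z≤n {t}))
            Ks≤n : K ℕ.* s ℕ.≤ n
            Ks≤n = ℕ.≤-trans (ℕ.m≤m*n (K ℕ.* s) (K ℕ.* s) {{ℕ.>-nonZero 1≤Ks}}) [Ks]²≤n
            open Estimates n (χ n) using (p; q; 0≤p; 0≤q; p≤1; module Fine)
            open Fine t few (ℕ.≤-trans (ℕ.*-monoˡ-≤ s K≥100) Ks≤n) using (η; 0≤η; q≤s; fine-≤; fine-≥)
            η≤1 : η ≤ 1ℚ
            η≤1 = ≤-trans (frac-≤ (50 ℕ.* s) 50 1≤n 1≤K (ℕ.≤-trans (ℕ.≤-reflexive (comm s K)) (ℕ.*-monoʳ-≤ 50 Ks≤n)))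
              (≤-trans (50/K≤½ K K≥100) (toWitness {a? = ½ ≤? 1ℚ} _))
            -- ηq ≤ 50s²/n, and (Ks)² ≤ n.
            ηq≤ : η * q ≤ fromℕ 50 * inv K
            ηq≤ = ≤-trans (*-monoˡ 0≤η q≤s) (≤-trans
              (≤-reflexive (trans (*-assoc (fromℕ (50 ℕ.* s)) (inv n) (fromℕ s))
                (trans (cong (fromℕ (50 ℕ.* s) *_) (*-comm (inv n) (fromℕ s)))
                  (trans (sym (*-assoc (fromℕ (50 ℕ.* s)) (fromℕ s) (inv n))) (cong (_* inv n) (sym (fromℕ-* (50 ℕ.* s) s)))))))
              (frac-≤ (50 ℕ.* s ℕ.* s) 50 1≤n 1≤K (ℕ.≤-trans (ℕ.≤-reflexive (comm₂ s K))
                (ℕ.*-monoʳ-≤ 50 (ℕ.≤-trans (ℕ.m≤m*n (s ℕ.* s ℕ.* K) K {{ℕ.>-nonZero 1≤K}})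
                  (ℕ.≤-trans (ℕ.≤-reflexive (comm₃ s K)) [Ks]²≤n))))))
            (L , bound) = expError-small 0≤p 0≤q 0≤η η≤1 (≤-trans ηq≤ (50/K≤½ K K≥100)) fine-≤ fine-≥
            total : η * q + η * q ≤ ε
            total = ≤-trans (+-mono-≤ (≤-trans ηq≤ 50/K≤) (≤-trans ηq≤ 50/K≤)) (≤-reflexive (½*+½* ε))
        in L , λ j j≥ → let (up , low) = bound j j≥ in
          ≤-trans up total , ≤-trans (neg-antimono-≤ total) low
      where
      comm : ∀ s K → 50 ℕ.* s ℕ.* K ≡ 50 ℕ.* (K ℕ.* s)
      comm = solve-∀
      comm₂ : ∀ s K → 50 ℕ.* s ℕ.* s ℕ.* K ≡ 50 ℕ.* (s ℕ.* s ℕ.* K)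
      comm₂ = solve-∀
      comm₃ : ∀ s K → s ℕ.* s ℕ.* K ℕ.* K ≡ K ℕ.* s ℕ.* (K ℕ.* s)
      comm₃ = solve-∀

theorem3 : (∀ (k : ℝ) → fromℕᵣ 12 ≤ᵣ k →
    ∃[ c₁ ] ∃[ c₂ ] (c₁ <ᵣ 1ᵣ × 1ᵣ <ᵣ c₂ ×
    (∀ (n : ℕ) (χ : Colouring n) → Bounded k χ →
    exp (-ᵣ (c₂ *ᵣ μ χ)) ≤ᵣ Pr[rainbow] χ ×
    Pr[rainbow] χ ≤ᵣ exp (-ᵣ (c₁ *ᵣ μ χ)))))
    ×
    (∀ (k : ℕ → ℝ) (χ : ∀ n → Colouring n) →
    (∀ n → 0ᵣ <ᵣ k n) → (∀ n → Bounded (k n) (χ n)) →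
    (k ∈ω[ (λ _ → 1ᵣ) ] →
    ∃[ δ ] (δ ∈o[1] × Eventually λ n →
    Pr[rainbow] (χ n) ≈ᵣ exp (-ᵣ ((1ᵣ +ᵣ δ n) *ᵣ μ (χ n)))))
    ×
    (k ∈ω[ √ ] →
    ∃[ δ ] (δ ∈o[1] × Eventually λ n →
    Pr[rainbow] (χ n) ≈ᵣ exp (-ᵣ μ (χ n)) *ᵣ (1ᵣ +ᵣ δ n))))
theorem3 = part₁ , λ k χ _ bounded → part₂ k χ bounded , part₃ k χ bounded
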